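{- Let $V$ be a finite set of at least $3$ points in the plane $\mathbb{R}^2$. Then the number $N(V)$ of double-normal pairs in $V$ satisfies \[N(V)\leq 3\left\lfloor\frac{|V|}{2}\right\rfloor .\] This bound can be attained for all cardinalities $|V|\geq 3$; that is, for every integer $n\geq 3$ there exists a set $V\subset\mathbb{R}^2$ with $|V|=n$ and $N(V)=3\lfloor n/2\rfloor$. Moreover, if $|V|$ is even and $N(V)=3|V|/2$, then $V$ lies on a circle and is symmetric with respect to the centre of the circle.
   Context: For a finite set $V$ of points in Euclidean space $\mathbb{R}^d$, a double-normal pair of $V$ is an (unordered) pair $\{p,q\}$ of distinct points of $V$ such that $V$ lies in the closed strip bounded by the hyperplanes through $p$ and $q$, respectively, that are perpendicular to the segment $pq$. $N(V)$ denotes the number of double-normal pairs of $V$. -}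

module Defs where

open import Algebra.Bundles using (CommutativeRing)
open import Algebra.Core using (Op₁; Op₂)
open import Algebra.Structures using (IsCommutativeRing)
open import Data.List.Base using (List; []; _∷_; _++_; map; filter; length)
open import Data.List.Relation.Unary.All using (All; all?)
open import Data.Nat.Base using (ℕ)
open import Data.Product.Base using (_×_; _,_; ∃; ∃-syntax)
open import Data.Product.Relation.Binary.Pointwise.NonDependent using (×-decSetoid)
open import Level using (Level; _⊔_; suc)
open import Relation.Binary.Bundles using (Setoid; DecSetoid)
open import Relation.Binary.Core using (Rel)
open import Relation.Binary.Structures using (IsDecTotalOrder)
open import Relation.Nullary.Decidable using (Dec; ¬?; _×-dec_)
open import Relation.Nullary.Negation using (¬_)
open import Relation.Unary using (Pred)
import Data.List.Membership.Setoid as Membership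
import Data.List.Relation.Unary.Unique.Setoid as Uniqueness
import Relation.Binary.Construct.NonStrictToStrict as ToStrict

private variable
  a c ℓ ℓ₁ ℓ₂ : Level
  A : Set a

-- The real line, characterised up to isomorphism as the Dedekind-complete
-- ordered field.  The reals are understood classically: the order is total
-- and decidable, and every inhabited predicate that is bounded above has a
-- least upper bound.

record CompleteOrderedField c ℓ₁ ℓ₂ : Set (suc (c ⊔ ℓ₁ ⊔ ℓ₂)) where
  infix  8 -_
  infixl 7 _*_
  infixl 6 _+_
  infix  4 _≈_ _≤_
  field
    Carrier           : Set c
    _≈_               : Rel Carrier ℓ₁
    _≤_               : Rel Carrier ℓ₂
    _+_ _*_           : Op₂ Carrier
    -_                : Op₁ Carrier
    0# 1#             : Carrier
    isCommutativeRing : IsCommutativeRing _≈_ _+_ _*_ -_ 0# 1#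
    isDecTotalOrder   : IsDecTotalOrder _≈_ _≤_
    0≉1               : ¬ (0# ≈ 1#)
    *-inverse         : ∀ x → ¬ (x ≈ 0#) → ∃[ y ] x * y ≈ 1#
    +-monoˡ-≤         : ∀ {x y} z → x ≤ y → x + z ≤ y + z
    *-nonneg          : ∀ {x y} → 0# ≤ x → 0# ≤ y → 0# ≤ x * y

  UpperBound : Pred Carrier ℓ → Carrier → Set (c ⊔ ℓ₂ ⊔ ℓ)
  UpperBound P u = ∀ x → P x → x ≤ u

  LeastUpperBound : Pred Carrier ℓ → Carrier → Set (c ⊔ ℓ₂ ⊔ ℓ)
  LeastUpperBound P s = UpperBound P s × (∀ u → UpperBound P u → s ≤ u)

  field
    complete : (P : Pred Carrier (c ⊔ ℓ₁ ⊔ ℓ₂)) →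
               ∃ P → ∃ (UpperBound P) → ∃ (LeastUpperBound P)

  commutativeRing : CommutativeRing c ℓ₁
  commutativeRing = record { isCommutativeRing = isCommutativeRing }

  open CommutativeRing commutativeRing public using (_-_)
  open IsDecTotalOrder isDecTotalOrder public using (_≟_; _≤?_)
  open ToStrict _≈_ _≤_ public using (_<_)

  decSetoid : DecSetoid c ℓ₁
  decSetoid = record
    { isDecEquivalence = record
      { isEquivalence = IsDecTotalOrder.isEquivalence isDecTotalOrder
      ; _≟_           = _≟_
      }
    }

-- Each two-element subset of positions is listed once, so for a list without
-- repetitions these are exactly its unordered pairs of distinct elements.

unorderedPairs : List A → List (A × A)
unorderedPairs []       = []
unorderedPairs (x ∷ xs) = map (x ,_) xs ++ unorderedPairs xs

module Plane (ℝ : CompleteOrderedField c ℓ₁ ℓ₂) where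
  open CompleteOrderedField ℝ

  Point : Set c
  Point = Carrier × Carrier

  pointDecSetoid : DecSetoid c ℓ₁
  pointDecSetoid = ×-decSetoid decSetoid decSetoid

  pointSetoid : Setoid c ℓ₁
  pointSetoid = DecSetoid.setoid pointDecSetoid

  open DecSetoid pointDecSetoid public using () renaming
    (_≈_ to _≈ₚ_; _≟_ to _≟ₚ_)
  open Membership pointSetoid public using (_∈_)
  open Uniqueness pointSetoid public using (Unique)

  infixl 6 _+ₚ_ _-ₚ_

  _+ₚ_ : Point → Point → Point
  (x₁ , y₁) +ₚ (x₂ , y₂) = (x₁ + x₂) , (y₁ + y₂)

  _-ₚ_ : Point → Point → Point
  (x₁ , y₁) -ₚ (x₂ , y₂) = (x₁ - x₂) , (y₁ - y₂)

  ⟨_,_⟩ : Point → Point → Carrier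
  ⟨ (x₁ , y₁) , (x₂ , y₂) ⟩ = x₁ * x₂ + y₁ * y₂

  record FiniteSet : Set (c ⊔ ℓ₁) where
    field
      points   : List Point
      distinct : Unique points

  open FiniteSet public

  ∣_∣ : FiniteSet → ℕ
  ∣ V ∣ = length (points V)

  -- For p ≠ q, the hyperplane through a point w perpendicular to pq is
  -- { x | ⟨x, q - p⟩ = ⟨w, q - p⟩ }, and ⟨p, q - p⟩ < ⟨q, q - p⟩.

  InStrip : Point → Point → Point → Set ℓ₂
  InStrip p q x = ⟨ p , q -ₚ p ⟩ ≤ ⟨ x , q -ₚ p ⟩ ×
                  ⟨ x , q -ₚ p ⟩ ≤ ⟨ q , q -ₚ p ⟩

  inStrip? : ∀ p q x → Dec (InStrip p q x)
  inStrip? p q x = (_ ≤? _) ×-dec (_ ≤? _)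

  DoubleNormal : FiniteSet → Point × Point → Set (c ⊔ ℓ₁ ⊔ ℓ₂)
  DoubleNormal V (p , q) = ¬ (p ≈ₚ q) × All (InStrip p q) (points V)

  doubleNormal? : ∀ V pq → Dec (DoubleNormal V pq)
  doubleNormal? V (p , q) = ¬? (p ≟ₚ q) ×-dec all? (inStrip? p q) (points V)

  N : FiniteSet → ℕ
  N V = length (filter (doubleNormal? V) (unorderedPairs (points V)))

  OnCircle : Point → Carrier → Point → Set ℓ₁
  OnCircle o r p = ⟨ p -ₚ o , p -ₚ o ⟩ ≈ r * r

  LiesOnCircle : FiniteSet → Point → Carrier → Set (c ⊔ ℓ₁ ⊔ ℓ₂)
  LiesOnCircle V o r = 0# < r × All (OnCircle o r) (points V)

  SymmetricAbout : FiniteSet → Point → Set (c ⊔ ℓ₁)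
  SymmetricAbout V o = All (λ p → ((o +ₚ o) -ₚ p) ∈ points V) (points V)

{-# OPTIONS --safe #-}

-- Call r the leftmost neighbour of p if, seen from p, no double normal at p lies to the left of pr.
-- If a double normal pq is leftmost neither at p nor at q, then the double normals pr and qs to its
-- left are opposite sides of a rectangle p r q s: no angle of this quadrilateral exceeds a right
-- angle.  Hence r and s are determined by pq, and such pairs pq form a matching.  The leftmost
-- pairs number at most n and the matched ones at most n / 2, so 2 N ≤ 3 n.
--
-- In the rectangle of a matched pair pq, p is the rightmost neighbour of r.  Comparing with the
-- mirror image of the argument, where r has a matched partner t, the rectangle on r t shares the
-- side pr with the first one; two strips then force t = s, so both rectangles have the same centre.
--
-- If 2 N = 3 n - 1, then on each side exactly one vertex is unmatched, say v on the left and u on the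
-- right, and u ≠ v is matched on the left with some w.  Passing to the leftmost neighbour keeps the
-- centre of a matched pair, so it maps the vertices whose pair has the same centre as uw injectively
-- to themselves, but it never reaches u.
--
-- If 2 N = 3 n, every vertex is matched, and the vertices with a given centre and a given radius
-- form a polygon all of whose sides bound V.  So V lies in the disc of each class, and two centrally
-- symmetric classes lying in each other's discs have the same circle.
--
-- For even n the bound is attained by centrally symmetric points on a circle (the diameters and the
-- diagonals next to them), for odd n ≥ 5 by adding the centre, and for n = 3 by a right triangle.

module Submission where

open import Algebra.Bundles using (CommutativeRing)
import Algebra.Properties.Ring
import Algebra.Properties.Semiring.Mult.TCOptimised
import Algebra.Solver.Ring
open import Algebra.Solver.Ring.AlmostCommutativeRing
  using (AlmostCommutativeRing; fromCommutativeRing; _-Raw-AlmostCommutative⟶_; Induced-equivalence)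
open import Data.Empty using (⊥)
open import Data.Fin.Base as Fin using (Fin; zero; suc)
import Data.Fin.Properties as Fin
open import Data.Integer.Base as ℤ using (ℤ; +_; -[1+_])
import Data.Integer.Properties as ℤP
open import Data.List.Base
  using (List; []; _∷_; _++_; map; filter; length; allFin; cartesianProduct; lookup)
open import Data.List.Membership.Propositional using () renaming (_∈_ to _∈ₗ_)
import Data.List.Membership.Propositional.Properties as Mem
import Data.List.Membership.Setoid.Properties as SetoidMembership
import Data.List.Properties as List
open import Data.List.Relation.Binary.Sublist.Propositional
  using (_⊆_; []; _∷_; _∷ʳ_; minimum; ⊆-refl; ⊆-trans)
import Data.List.Relation.Binary.Sublist.Propositional.Properties as Sublist
open import Data.List.Relation.Unary.All as All using (All; []; _∷_)
import Data.List.Relation.Unary.All.Properties as All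
open import Data.List.Relation.Unary.AllPairs using (AllPairs; []; _∷_)
import Data.List.Relation.Unary.AllPairs.Properties as AllPairs
open import Data.List.Relation.Unary.Any using (here; there; index)
import Data.List.Relation.Unary.Any.Properties as Any
import Data.List.Relation.Unary.Unique.Propositional as Propositional
import Data.List.Relation.Unary.Unique.Propositional.Properties as Unique
open import Data.Maybe.Base using (just; nothing)
import Data.Nat.Base as ℕ
import Data.Nat.DivMod as ℕ
import Data.Nat.Divisibility as ℕ
import Data.Nat.Properties as ℕP
open import Data.Product.Base using (_,_; ∃; proj₁; proj₂; swap)
open import Data.Sum.Base using (_⊎_; inj₁; inj₂)
open import Defs
open import Level using (Level)
open import Relation.Binary.Bundles using (DecSetoid)
import Relation.Binary.Construct.On as On
open import Relation.Binary.Core using (Rel)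
open import Relation.Binary.Definitions using (Symmetric; WeaklyDecidable; tri<; tri≈; tri>)
import Relation.Binary.PropositionalEquality as ≡
open import Relation.Binary.PropositionalEquality using (_≢_)
import Relation.Binary.Reasoning.Setoid
open import Relation.Binary.Structures using (IsDecEquivalence; IsDecTotalOrder)
open import Relation.Nullary.Decidable using (Dec; yes; no; ¬?; _×-dec_; _→-dec_)
open import Relation.Nullary.Negation using (¬_; contradiction)
open import Relation.Unary using (Pred; Decidable)
open import Data.Nat using (ℕ; ⌊_/2⌋)
open import Data.Nat.Divisibility using (_∣_)
open import Data.Product using (_×_; ∃-syntax)
open import Relation.Binary.PropositionalEquality using (_≡_)

-- A ring solver with integer coefficients.

module IntegerCoefficients {c ℓ} (R : CommutativeRing c ℓ) where
  open CommutativeRing R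
  open Algebra.Properties.Ring ring
  open Algebra.Properties.Semiring.Mult.TCOptimised semiring
    renaming (_×_ to _·_)
  open Relation.Binary.Reasoning.Setoid setoid

  -- With the optimised multiple `_·_` small numerals reduce definitionally: `con (+ 1)` denotes
  -- `1#` and `con (+ 2)` denotes `1# + 1#`, so they match the goals given to `solve`.
  fromℤ : ℤ → Carrier
  fromℤ (+ n)    = n · 1#
  fromℤ -[1+ n ] = - (ℕ.suc n · 1#)

  private
    fromℤ-neg : ∀ i → fromℤ (ℤ.- i) ≈ - fromℤ i
    fromℤ-neg (+ ℕ.zero)  = sym -0#≈0#
    fromℤ-neg (+ ℕ.suc n) = refl
    fromℤ-neg -[1+ n ]    = sym (-‿involutive _)

    fromℤ-⊖ : ∀ m n → fromℤ (m ℤ.⊖ n) ≈ m · 1# - n · 1#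
    fromℤ-⊖ m ℕ.zero = begin
      m · 1#          ≈⟨ +-identityʳ _ ⟨
      m · 1# + 0#     ≈⟨ +-congˡ -0#≈0# ⟨
      m · 1# - 0#     ∎
    fromℤ-⊖ ℕ.zero (ℕ.suc n) = sym (+-identityˡ _)
    fromℤ-⊖ (ℕ.suc m) (ℕ.suc n) = begin
      fromℤ (ℕ.suc m ℤ.⊖ ℕ.suc n)         ≡⟨ ≡.cong fromℤ (ℤP.[1+m]⊖[1+n]≡m⊖n m n) ⟩
      fromℤ (m ℤ.⊖ n)                     ≈⟨ fromℤ-⊖ m n ⟩
      m · 1# - n · 1#                     ≈⟨ +-congʳ (+-identityˡ _) ⟨
      -- The inserted `1# - 1#` supplies one more unit for each of the two multiples.
      0# + m · 1# - n · 1#                ≈⟨ +-congʳ (+-congʳ (-‿inverseʳ 1#)) ⟨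
      1# - 1# + m · 1# - n · 1#           ≈⟨ +-congʳ (+-assoc _ _ _) ⟩
      1# + (- 1# + m · 1#) - n · 1#       ≈⟨ +-congʳ (+-congˡ (+-comm _ _)) ⟩
      1# + (m · 1# - 1#) - n · 1#         ≈⟨ +-congʳ (+-assoc _ _ _) ⟨
      1# + m · 1# - 1# - n · 1#           ≈⟨ +-assoc _ _ _ ⟩
      1# + m · 1# + (- 1# - n · 1#)       ≈⟨ +-congˡ (-‿+-comm _ _) ⟩
      1# + m · 1# - (1# + n · 1#)         ≈⟨ +-cong (1+× m 1#) (-‿cong (1+× n 1#)) ⟨
      ℕ.suc m · 1# - ℕ.suc n · 1#         ∎

    fromℤ-+ : ∀ i j → fromℤ (i ℤ.+ j) ≈ fromℤ i + fromℤ j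
    fromℤ-+ (+ m)    (+ n)    = ×-homo-+ 1# m n
    fromℤ-+ (+ m)    -[1+ n ] = fromℤ-⊖ m (ℕ.suc n)
    fromℤ-+ -[1+ m ] (+ n)    = trans (fromℤ-⊖ n (ℕ.suc m)) (+-comm _ _)
    fromℤ-+ -[1+ m ] -[1+ n ] = begin
      - (ℕ.suc (ℕ.suc (m ℕ.+ n)) · 1#)     ≡⟨ ≡.cong (λ k → - (k · 1#)) (ℕP.+-suc (ℕ.suc m) n) ⟨
      - ((ℕ.suc m ℕ.+ ℕ.suc n) · 1#)       ≈⟨ -‿cong (×-homo-+ 1# (ℕ.suc m) (ℕ.suc n)) ⟩
      - (ℕ.suc m · 1# + ℕ.suc n · 1#)      ≈⟨ -‿+-comm _ _ ⟨
      - (ℕ.suc m · 1#) - (ℕ.suc n · 1#)    ∎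

    fromℤ-*ℕ : ∀ i n → fromℤ (i ℤ.* + n) ≈ fromℤ i * fromℤ (+ n)
    fromℤ-*ℕ (+ m) n = begin
      fromℤ (+ m ℤ.* + n)   ≡⟨ ≡.cong fromℤ (≡.sym (ℤP.pos-* m n)) ⟩
      (m ℕ.* n) · 1#        ≈⟨ ×1-homo-* m n ⟩
      m · 1# * (n · 1#)     ∎
    fromℤ-*ℕ -[1+ m ] n = begin
      fromℤ (ℤ.- (+ ℕ.suc m) ℤ.* + n)     ≡⟨ ≡.cong fromℤ (ℤP.neg-distribˡ-* (+ ℕ.suc m) (+ n)) ⟨
      fromℤ (ℤ.- (+ ℕ.suc m ℤ.* + n))     ≈⟨ fromℤ-neg (+ ℕ.suc m ℤ.* + n) ⟩
      - fromℤ (+ ℕ.suc m ℤ.* + n)         ≈⟨ -‿cong (fromℤ-*ℕ (+ ℕ.suc m) n) ⟩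
      - (ℕ.suc m · 1# * (n · 1#))         ≈⟨ -‿distribˡ-* _ _ ⟩
      - (ℕ.suc m · 1#) * (n · 1#)         ∎

    fromℤ-* : ∀ i j → fromℤ (i ℤ.* j) ≈ fromℤ i * fromℤ j
    fromℤ-* i (+ n)    = fromℤ-*ℕ i n
    fromℤ-* i -[1+ n ] = begin
      fromℤ (i ℤ.* ℤ.- (+ ℕ.suc n))    ≡⟨ ≡.cong fromℤ (ℤP.neg-distribʳ-* i (+ ℕ.suc n)) ⟨
      fromℤ (ℤ.- (i ℤ.* + ℕ.suc n))    ≈⟨ fromℤ-neg (i ℤ.* + ℕ.suc n) ⟩
      - fromℤ (i ℤ.* + ℕ.suc n)        ≈⟨ -‿cong (fromℤ-*ℕ i (ℕ.suc n)) ⟩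
      - (fromℤ i * (ℕ.suc n · 1#))     ≈⟨ -‿distribʳ-* _ _ ⟩
      fromℤ i * - (ℕ.suc n · 1#)       ∎

    almostCommutativeRing : AlmostCommutativeRing c ℓ
    almostCommutativeRing = fromCommutativeRing R

    morphism : ℤ.+-*-rawRing -Raw-AlmostCommutative⟶ almostCommutativeRing
    morphism = record
      { ⟦_⟧    = fromℤ
      ; +-homo = fromℤ-+
      ; *-homo = fromℤ-*
      ; -‿homo = fromℤ-neg
      ; 0-homo = refl
      ; 1-homo = refl
      }

    coeff≟ : WeaklyDecidable (Induced-equivalence morphism)
    coeff≟ i j with i ℤP.≟ j
    ... | yes ≡.refl = just refl
    ... | no _       = nothing

  open Algebra.Solver.Ring ℤ.+-*-rawRing almostCommutativeRing morphism coeff≟ public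
    using (Polynomial; con; _:+_; _:*_; _:-_; :-_; solve; _:=_)

-- Signs, products and sums in an ordered field.

module OrderedField {c ℓ₁ ℓ₂} (ℝ : CompleteOrderedField c ℓ₁ ℓ₂) where
  open CompleteOrderedField ℝ
  open CommutativeRing commutativeRing public
    using (refl; sym; trans; +-cong; +-congˡ; +-congʳ; *-cong; *-congˡ; *-congʳ;
           -‿cong; +-identityˡ; +-identityʳ; *-identityˡ; *-identityʳ; zeroˡ; zeroʳ; *-comm; +-comm)
  open IsDecTotalOrder isDecTotalOrder public
    using (antisym; total; ≤-respʳ-≈; ≤-respˡ-≈)
    renaming (refl to ≤-refl; trans to ≤-trans; reflexive to ≤-reflexive)
  open IntegerCoefficients commutativeRing public

  -- Inequalities are mostly kept in the form `0# ≤ x`, so that a single ring identity for `x`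
  -- carries one into another.
  0≤-resp : ∀ {x y} → x ≈ y → 0# ≤ x → 0# ≤ y
  0≤-resp = ≤-respʳ-≈

  0<-resp : ∀ {x y} → x ≈ y → 0# < x → 0# < y
  0<-resp x≈y (0≤x , 0≉x) = 0≤-resp x≈y 0≤x , λ 0≈y → 0≉x (trans 0≈y (sym x≈y))

  <⇒≤ : ∀ {x y} → x < y → x ≤ y
  <⇒≤ = proj₁

  ≤⇒0≤- : ∀ {x y} → x ≤ y → 0# ≤ y - x
  ≤⇒0≤- {x} {y} x≤y = ≤-respˡ-≈ (solve 1 (λ x → x :- x := con (+ 0)) refl x) (+-monoˡ-≤ (- x) x≤y)

  0≤-⇒≤ : ∀ {x y} → 0# ≤ y - x → x ≤ y
  0≤-⇒≤ {x} {y} 0≤y-x = ≤-respʳ-≈ (solve 2 (λ x y → y :- x :+ x := y) refl x y)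
    (≤-respˡ-≈ (+-identityˡ x) (+-monoˡ-≤ x 0≤y-x))

  +-nonneg : ∀ {x y} → 0# ≤ x → 0# ≤ y → 0# ≤ x + y
  +-nonneg {x} {y} 0≤x 0≤y = ≤-trans 0≤y (≤-respˡ-≈ (+-identityˡ y) (+-monoˡ-≤ y 0≤x))

  nonneg∧nonpos⇒≈0 : ∀ {x} → 0# ≤ x → 0# ≤ - x → x ≈ 0#
  nonneg∧nonpos⇒≈0 {x} 0≤x 0≤-x = antisym
    (0≤-⇒≤ (0≤-resp (sym (+-identityˡ (- x))) 0≤-x)) 0≤x

  <⇒≱-neg : ∀ {x} → 0# < x → ¬ (0# ≤ - x)
  <⇒≱-neg (0≤x , 0≉x) 0≤-x = 0≉x (sym (nonneg∧nonpos⇒≈0 0≤x 0≤-x))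

  0≤⊎0<- : ∀ x → 0# ≤ x ⊎ 0# < - x
  0≤⊎0<- x with 0# ≤? x
  ... | yes 0≤x = inj₁ 0≤x
  ... | no  0≰x with total 0# x
  ...   | inj₁ 0≤x = contradiction 0≤x 0≰x
  ...   | inj₂ x≤0 = inj₂ (0≤-resp (+-identityˡ (- x)) (≤⇒0≤- x≤0) , λ 0≈-x → 0≰x (≤-reflexive
    (trans (solve 0 (con (+ 0) := :- con (+ 0)) refl) (trans (-‿cong 0≈-x)
      (solve 1 (λ x → :- (:- x) := x) refl x)))))

  0<⊎0≤- : ∀ x → 0# < x ⊎ 0# ≤ - x
  0<⊎0≤- x with 0≤⊎0<- (- x)
  ... | inj₁ 0≤-x = inj₂ 0≤-x
  ... | inj₂ 0<x  = inj₁ (0<-resp (solve 1 (λ x → :- (:- x) := x) refl x) 0<x)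

  square-nonneg : ∀ x → 0# ≤ x * x
  square-nonneg x with 0≤⊎0<- x
  ... | inj₁ 0≤x  = *-nonneg 0≤x 0≤x
  ... | inj₂ 0<-x = 0≤-resp (solve 1 (λ x → :- x :* :- x := x :* x) refl x)
    (*-nonneg (<⇒≤ 0<-x) (<⇒≤ 0<-x))

  x*y≈0⇒y≈0 : ∀ {x y} → ¬ (x ≈ 0#) → x * y ≈ 0# → y ≈ 0#
  x*y≈0⇒y≈0 {x} {y} x≉0 xy≈0 with *-inverse x x≉0
  ... | z , xz≈1 = trans (sym (*-identityˡ y)) (trans (*-congʳ (sym xz≈1))
    (trans (solve 3 (λ x y z → x :* z :* y := z :* (x :* y)) refl x y z)
    (trans (*-congˡ xy≈0) (zeroʳ z))))

  0<⇒≉0 : ∀ {x} → 0# < x → ¬ (x ≈ 0#)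
  0<⇒≉0 (_ , 0≉x) x≈0 = 0≉x (sym x≈0)

  0≤∧≉0⇒0< : ∀ {x} → 0# ≤ x → ¬ (x ≈ 0#) → 0# < x
  0≤∧≉0⇒0< 0≤x x≉0 = 0≤x , λ 0≈x → x≉0 (sym 0≈x)

  *-pos : ∀ {x y} → 0# < x → 0# < y → 0# < x * y
  *-pos 0<x 0<y = 0≤∧≉0⇒0< (*-nonneg (<⇒≤ 0<x) (<⇒≤ 0<y))
    λ xy≈0 → 0<⇒≉0 0<y (x*y≈0⇒y≈0 (0<⇒≉0 0<x) xy≈0)

  +≈0⇒ˡ≈0 : ∀ {x y} → 0# ≤ x → 0# ≤ y → x + y ≈ 0# → x ≈ 0#
  +≈0⇒ˡ≈0 {x} {y} 0≤x 0≤y x+y≈0 = nonneg∧nonpos⇒≈0 0≤x (0≤-resp eq 0≤y)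
    where
    eq : y ≈ - x
    eq = trans (solve 2 (λ x y → y := x :+ y :- x) refl x y)
         (trans (+-congʳ x+y≈0) (+-identityˡ (- x)))

  +≈0⇒ʳ≈0 : ∀ {x y} → 0# ≤ x → 0# ≤ y → x + y ≈ 0# → y ≈ 0#
  +≈0⇒ʳ≈0 {x} {y} 0≤x 0≤y x+y≈0 = +≈0⇒ˡ≈0 0≤y 0≤x (trans (+-comm y x) x+y≈0)

  +-pos-nonneg : ∀ {x y} → 0# < x → 0# ≤ y → 0# < x + y
  +-pos-nonneg 0<x 0≤y = 0≤∧≉0⇒0< (+-nonneg (<⇒≤ 0<x) 0≤y)
    λ x+y≈0 → 0<⇒≉0 0<x (+≈0⇒ˡ≈0 (<⇒≤ 0<x) 0≤y x+y≈0)

  0<1 : 0# < 1#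
  0<1 = 0≤-resp (*-identityˡ 1#) (square-nonneg 1#) , 0≉1

  *-cancelˡ-nonneg : ∀ {x y} → 0# < x → 0# ≤ x * y → 0# ≤ y
  *-cancelˡ-nonneg {x} {y} 0<x 0≤xy with 0≤⊎0<- y
  ... | inj₁ 0≤y  = 0≤y
  ... | inj₂ 0<-y = contradiction
    (0≤-resp (solve 2 (λ x y → x :* y := :- (x :* (:- y))) refl x y) 0≤xy)
    (<⇒≱-neg (*-pos 0<x 0<-y))

  *-cancelˡ-pos : ∀ {x y} → 0# ≤ x → 0# < x * y → 0# < y
  *-cancelˡ-pos {x} {y} 0≤x 0<xy with 0<⊎0≤- y
  ... | inj₁ 0<y  = 0<y
  ... | inj₂ 0≤-y = contradiction
    (0≤-resp (solve 2 (λ x y → x :* :- y := :- (x :* y)) refl x y) (*-nonneg 0≤x 0≤-y))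
    (<⇒≱-neg 0<xy)

  *-pos∧+-pos⇒pos : ∀ {x y} → 0# < x * y → 0# < x + y → 0# < x
  *-pos∧+-pos⇒pos {x} {y} 0<xy 0<x+y with 0<⊎0≤- x
  ... | inj₁ 0<x  = 0<x
  ... | inj₂ 0≤-x = contradiction
    (0≤-resp (solve 2 (λ x y → :- x :+ :- y := :- (x :+ y)) refl x y) (+-nonneg 0≤-x 0≤-y)) (<⇒≱-neg 0<x+y)
    where
    0≤-y : 0# ≤ - y
    0≤-y = <⇒≤ (*-cancelˡ-pos 0≤-x (0<-resp (solve 2 (λ x y → x :* y := :- x :* :- y) refl x y) 0<xy))

  -≈0⇒≈ : ∀ {x y} → x - y ≈ 0# → x ≈ y
  -≈0⇒≈ {x} {y} x-y≈0 = trans (solve 2 (λ x y → x := x :- y :+ y) refl x y)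
    (trans (+-congʳ x-y≈0) (+-identityˡ y))

  ≈⇒-≈0 : ∀ {x y} → x ≈ y → x - y ≈ 0#
  ≈⇒-≈0 {x} {y} x≈y = trans (+-congʳ x≈y) (solve 1 (λ y → y :- y := con (+ 0)) refl y)

  x*x≈0⇒x≈0 : ∀ {x} → x * x ≈ 0# → x ≈ 0#
  x*x≈0⇒x≈0 {x} xx≈0 with x ≟ 0#
  ... | yes x≈0 = x≈0
  ... | no  x≉0 = contradiction xx≈0 (λ eq → x≉0 (x*y≈0⇒y≈0 x≉0 eq))

  -- The vanishing `y * w - x * x` is `w * (y - x) + x * (w - x)`, a sum of nonnegative terms, and
  -- likewise with `y` and `w` exchanged. The conclusion is a single sum because in the applications
  -- it is the squared distance of two points.
  product-of-upper-bounds : ∀ {x y w} → 0# ≤ x → 0# < y → 0# < w →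
    0# ≤ y - x → 0# ≤ w - x → y * w ≈ x * x → y - x + (w - x) ≈ 0#
  product-of-upper-bounds {x} {y} {w} 0≤x 0<y 0<w x≤y x≤w yw≈xx =
    trans (+-cong y-x≈0 w-x≈0) (+-identityˡ 0#)
    where
    diff≈0 : y * w - x * x ≈ 0#
    diff≈0 = ≈⇒-≈0 yw≈xx
    y-x≈0 : y - x ≈ 0#
    y-x≈0 = x*y≈0⇒y≈0 (0<⇒≉0 0<w) (+≈0⇒ˡ≈0 (*-nonneg (<⇒≤ 0<w) x≤y) (*-nonneg 0≤x x≤w)
      (trans (solve 3 (λ x y w → w :* (y :- x) :+ x :* (w :- x) := y :* w :- x :* x) refl x y w) diff≈0))
    w-x≈0 : w - x ≈ 0#
    w-x≈0 = x*y≈0⇒y≈0 (0<⇒≉0 0<y) (+≈0⇒ˡ≈0 (*-nonneg (<⇒≤ 0<y) x≤w) (*-nonneg 0≤x x≤y)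
      (trans (solve 3 (λ x y w → y :* (w :- x) :+ x :* (y :- x) := y :* w :- x :* x) refl x y w) diff≈0))

  -- The product of the lower bounds α, β and that of the upper bounds δ, ε have the same factors
  -- x, D - x, X, D - X and y, y, Y, Y, which forces equality in all four.
  module _ {D x y X Y : Carrier}
    (0<D : 0# < D) (0<y : 0# < y) (0<Y : 0# < Y)
    (0≤x : 0# ≤ x) (x≤D : 0# ≤ D - x) (0≤X : 0# ≤ X) (X≤D : 0# ≤ D - X)
    (α : 0# ≤ x * (D - X) - y * Y) (β : 0# ≤ X * (D - x) - y * Y)
    (δ : 0# ≤ y * y - x * (D - x)) (ε : 0# ≤ Y * Y - X * (D - X)) where
    private
      γ>0 : 0# < y * Y
      γ>0 = *-pos 0<y 0<Y
      β≥0 : 0# ≤ X * (D - x)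
      β≥0 = *-nonneg 0≤X x≤D
      δ≥0 : 0# ≤ x * (D - x)
      δ≥0 = *-nonneg 0≤x x≤D
      s₁ s₂ s₃ s₄ : Carrier
      s₁ = (x * (D - X) - y * Y) * (X * (D - x))
      s₂ = y * Y * (X * (D - x) - y * Y)
      s₃ = Y * Y * (y * y - x * (D - x))
      s₄ = x * (D - x) * (Y * Y - X * (D - X))
      h₁ : 0# ≤ s₁
      h₁ = *-nonneg α β≥0
      h₂ : 0# ≤ s₂
      h₂ = *-nonneg (<⇒≤ γ>0) β
      h₃ : 0# ≤ s₃
      h₃ = *-nonneg (square-nonneg Y) δ
      h₄ : 0# ≤ s₄
      h₄ = *-nonneg δ≥0 ε
      h₁₂ : 0# ≤ s₁ + s₂
      h₁₂ = +-nonneg h₁ h₂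
      h₃₄ : 0# ≤ s₃ + s₄
      h₃₄ = +-nonneg h₃ h₄
      -- The weights make the four slacks telescope: the subtracted part of each term is the leading
      -- part of the next, cyclically.
      sum≈0 : s₁ + s₂ + (s₃ + s₄) ≈ 0#
      sum≈0 = solve 5 (λ D x y X Y →
        ((x :* (D :- X) :- y :* Y) :* (X :* (D :- x)) :+ y :* Y :* (X :* (D :- x) :- y :* Y)) :+
        (Y :* Y :* (y :* y :- x :* (D :- x)) :+ x :* (D :- x) :* (Y :* Y :- X :* (D :- X)))
        := con (+ 0)) refl D x y X Y
      s₂≈0 : s₂ ≈ 0#
      s₂≈0 = +≈0⇒ʳ≈0 h₁ h₂ (+≈0⇒ˡ≈0 h₁₂ h₃₄ sum≈0)
      s₃≈0 : s₃ ≈ 0#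
      s₃≈0 = +≈0⇒ˡ≈0 h₃ h₄ (+≈0⇒ʳ≈0 h₁₂ h₃₄ sum≈0)
      β≈γ : X * (D - x) - y * Y ≈ 0#
      β≈γ = x*y≈0⇒y≈0 (0<⇒≉0 γ>0) s₂≈0
      -- By `β≈γ` the weight `X * (D - x)` equals the positive `y * Y` and can be cancelled from
      -- `s₁`.
      α≈γ : x * (D - X) - y * Y ≈ 0#
      α≈γ = x*y≈0⇒y≈0 (0<⇒≉0 (0<-resp (sym (-≈0⇒≈ β≈γ)) γ>0))
        (trans (*-comm _ _) (+≈0⇒ˡ≈0 h₁ h₂ (+≈0⇒ˡ≈0 h₁₂ h₃₄ sum≈0)))

    tight⇒right-angle : y * y - x * (D - x) ≈ 0#
    tight⇒right-angle = x*y≈0⇒y≈0 (0<⇒≉0 (*-pos 0<Y 0<Y)) s₃≈0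

    tight⇒x-X≈0 : x - X ≈ 0#
    tight⇒x-X≈0 = x*y≈0⇒y≈0 (0<⇒≉0 0<D)
      (trans (solve 5 (λ D x y X Y → D :* (x :- X) :=
        (x :* (D :- X) :- y :* Y) :- (X :* (D :- x) :- y :* Y)) refl D x y X Y)
      (trans (+-cong α≈γ (-‿cong β≈γ)) (solve 0 (con (+ 0) :- con (+ 0) := con (+ 0)) refl)))

    tight⇒y-Y≈0 : y - Y ≈ 0#
    tight⇒y-Y≈0 = x*y≈0⇒y≈0 (0<⇒≉0 0<y)
      (trans (solve 5 (λ D x y X Y → y :* (y :- Y) :=
        (y :* y :- x :* (D :- x)) :+ (x :* (D :- X) :- y :* Y) :- x :* (x :- X)) refl D x y X Y)
      (trans (+-cong (+-cong tight⇒right-angle α≈γ) (-‿cong (*-congˡ tight⇒x-X≈0)))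
        (solve 1 (λ x → con (+ 0) :+ con (+ 0) :- x :* con (+ 0) := con (+ 0)) refl x)))

-- Square roots from completeness, for the radius of the extremal circle.

module SquareRoot {c ℓ₁ ℓ₂} (ℝ : CompleteOrderedField c ℓ₁ ℓ₂) where
  open CompleteOrderedField ℝ
  open OrderedField ℝ

  inverse-pos : ∀ {x} → 0# < x → ∃[ y ] 0# < y × x * y ≈ 1#
  inverse-pos {x} 0<x with *-inverse x (0<⇒≉0 0<x)
  ... | y , xy≈1 = y , *-cancelˡ-pos (<⇒≤ 0<x) (0<-resp (sym xy≈1) 0<1) , xy≈1

  square-≤⇒≤ : ∀ {x u} → 0# ≤ u → x * x ≤ u * u → x ≤ u
  square-≤⇒≤ {x} {u} 0≤u xx≤uu with 0≤⊎0<- (u - x)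
  ... | inj₁ 0≤u-x = 0≤-⇒≤ 0≤u-x
  ... | inj₂ u<x   = contradiction (≤⇒0≤- xx≤uu) (λ 0≤uu-xx → <⇒≱-neg (*-pos u<x 0<x+u)
    (0≤-resp (solve 2 (λ x u → u :* u :- x :* x := :- (:- (u :- x) :* (:- (u :- x) :+ (u :+ u)))) refl x u) 0≤uu-xx))
    where
    0<x+u : 0# < - (u - x) + (u + u)
    0<x+u = +-pos-nonneg u<x (+-nonneg 0≤u 0≤u)

  module _ {a : Carrier} (0<a : 0# < a) where
    private
      -- The lift brings the predicate to the level over which `complete` quantifies.
      SquareBelow : Carrier → Set (c Level.⊔ ℓ₁ Level.⊔ ℓ₂)
      SquareBelow x = Level.Lift (c Level.⊔ ℓ₁) (x * x ≤ a)

      0≤a : 0# ≤ a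
      0≤a = <⇒≤ 0<a
      0<1+a : 0# < 1# + a
      0<1+a = +-pos-nonneg 0<1 0≤a

      -- The quotient a / (1 + a) is a positive member of the set, which keeps the supremum
      -- positive.
      e : Carrier
      e = a * proj₁ (inverse-pos 0<1+a)

      0<e : 0# < e
      0<e = *-pos 0<a (proj₁ (proj₂ (inverse-pos 0<1+a)))

      [1+a]e≈a : (1# + a) * e ≈ a
      [1+a]e≈a = trans (solve 3 (λ x a i → x :* (a :* i) := a :* (x :* i)) refl (1# + a) a (proj₁ (inverse-pos 0<1+a)))
        (trans (*-congˡ (proj₂ (proj₂ (inverse-pos 0<1+a)))) (solve 1 (λ a → a :* con (+ 1) := a) refl a))

      e-below : SquareBelow e
      e-below = Level.lift (0≤-⇒≤ (*-cancelˡ-nonneg (*-pos 0<1+a 0<1+a) (0≤-resp (sym (trans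
        (solve 2 (λ a e → let x = con (+ 1) :+ a in
          (x :* x) :* (a :- e :* e) := x :* x :* a :- (x :* e) :* (x :* e)) refl a e)
        (trans (+-congˡ (-‿cong (*-cong [1+a]e≈a [1+a]e≈a)))
          (solve 1 (λ a → (con (+ 1) :+ a) :* (con (+ 1) :+ a) :* a :- a :* a := a :* (con (+ 1) :+ a :+ a :* a)) refl a))))
        (*-nonneg 0≤a (+-nonneg (<⇒≤ 0<1+a) (square-nonneg a))))))

      bounded : UpperBound SquareBelow (1# + a)
      bounded x (Level.lift xx≤a) = square-≤⇒≤ (<⇒≤ 0<1+a) (≤-trans xx≤a (0≤-⇒≤ (0≤-resp
        (solve 1 (λ a → con (+ 1) :+ a :+ a :* a := (con (+ 1) :+ a) :* (con (+ 1) :+ a) :- a) refl a)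
        (+-nonneg (<⇒≤ 0<1+a) (square-nonneg a)))))

      supremum : ∃ (LeastUpperBound SquareBelow)
      supremum = complete SquareBelow (e , e-below) (1# + a , bounded)

      s : Carrier
      s = proj₁ supremum

      0<s : 0# < s
      0<s = 0<-resp (solve 2 (λ e s → e :+ (s :- e) := s) refl e s)
        (+-pos-nonneg 0<e (≤⇒0≤- (proj₁ (proj₂ supremum) e e-below)))

      -- The harmonic mean 2as / (s² + a) of s and a / s has square at most a.
      a≤ss : 0# ≤ s * s - a
      a≤ss = *-cancelˡ-nonneg 0<s (0≤-resp (trans (solve 3 (λ s m t → m :* (s :- t) := m :* s :- m :* t) refl s m t)
        (trans (+-congˡ (-‿cong mt≈2as))
          (solve 2 (λ s a → (s :* s :+ a) :* s :- (a :+ a) :* s := s :* (s :* s :- a)) refl s a)))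
        (*-nonneg (<⇒≤ 0<m) (≤⇒0≤- (proj₁ (proj₂ supremum) t t-below))))
        where
        m t : Carrier
        m = s * s + a
        0<m : 0# < m
        0<m = +-pos-nonneg (*-pos 0<s 0<s) 0≤a
        t = (a + a) * s * proj₁ (inverse-pos 0<m)
        mt≈2as : m * t ≈ (a + a) * s
        mt≈2as = trans (solve 3 (λ m x i → m :* (x :* i) := x :* (m :* i)) refl m ((a + a) * s) (proj₁ (inverse-pos 0<m)))
          (trans (*-congˡ (proj₂ (proj₂ (inverse-pos 0<m)))) (solve 1 (λ a → a :* con (+ 1) := a) refl ((a + a) * s)))
        t-below : SquareBelow t
        t-below = Level.lift (0≤-⇒≤ (*-cancelˡ-nonneg (*-pos 0<m 0<m) (0≤-resp (sym (trans
          (solve 3 (λ a m t → (m :* m) :* (a :- t :* t) := m :* m :* a :- (m :* t) :* (m :* t)) refl a m t)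
          (trans (+-congˡ (-‿cong (*-cong mt≈2as mt≈2as)))
            (solve 2 (λ a s → let m = s :* s :+ a in
              m :* m :* a :- ((a :+ a) :* s) :* ((a :+ a) :* s) := a :* ((s :* s :- a) :* (s :* s :- a))) refl a s))))
          (*-nonneg 0≤a (square-nonneg (s * s - a))))))

      -- The arithmetic mean (s² + a) / 2s has square at least a.
      ss≤a : 0# ≤ - (s * s - a)
      ss≤a = 0≤-resp (trans (solve 3 (λ s d u → d :* (u :- s) := d :* u :- d :* s) refl s d u)
        (trans (+-congʳ du≈m) (solve 2 (λ s a → (s :* s :+ a) :- (s :+ s) :* s := :- (s :* s :- a)) refl s a)))
        (*-nonneg (<⇒≤ 0<d) (≤⇒0≤- (proj₂ (proj₂ supremum) u u-bound)))
        where
        d u : Carrier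
        d = s + s
        0<d : 0# < d
        0<d = +-pos-nonneg 0<s (<⇒≤ 0<s)
        u = (s * s + a) * proj₁ (inverse-pos 0<d)
        0≤u : 0# ≤ u
        0≤u = *-nonneg (+-nonneg (square-nonneg s) 0≤a) (<⇒≤ (proj₁ (proj₂ (inverse-pos 0<d))))
        du≈m : d * u ≈ s * s + a
        du≈m = trans (solve 3 (λ m x i → m :* (x :* i) := x :* (m :* i)) refl d (s * s + a) (proj₁ (inverse-pos 0<d)))
          (trans (*-congˡ (proj₂ (proj₂ (inverse-pos 0<d)))) (solve 1 (λ a → a :* con (+ 1) := a) refl (s * s + a)))
        a≤uu : a ≤ u * u
        a≤uu = 0≤-⇒≤ (*-cancelˡ-nonneg (*-pos 0<d 0<d) (0≤-resp (sym (trans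
          (solve 3 (λ a d u → (d :* d) :* (u :* u :- a) := (d :* u) :* (d :* u) :- d :* d :* a) refl a d u)
          (trans (+-congʳ (*-cong du≈m du≈m))
            (solve 2 (λ a s → let m = s :* s :+ a in
              m :* m :- (s :+ s) :* (s :+ s) :* a := (s :* s :- a) :* (s :* s :- a)) refl a s))))
          (square-nonneg (s * s - a))))
        u-bound : UpperBound SquareBelow u
        u-bound x (Level.lift xx≤a) = square-≤⇒≤ 0≤u (≤-trans xx≤a a≤uu)

    square-root : ∃[ r ] 0# < r × r * r ≈ a
    square-root = s , 0<s , -≈0⇒≈ (nonneg∧nonpos⇒≈0 a≤ss ss≤a)

-- Plane geometry of angles, rectangles and discs.

module PlaneGeometry {c ℓ₁ ℓ₂} (ℝ : CompleteOrderedField c ℓ₁ ℓ₂) where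
  open CompleteOrderedField ℝ
  open OrderedField ℝ public
  open Plane ℝ

  det : Point → Point → Carrier
  det (a₁ , a₂) (b₁ , b₂) = a₁ * b₂ - a₂ * b₁

  private
    -- Formal counterparts of points, `_-ₚ_`, `⟨_,_⟩` and `det`, so that identities can be given to
    -- `solve` in vector notation.
    Vec² : ℕ → Set
    Vec² n = Polynomial n × Polynomial n

    infixl 6 _⊖_
    infix  9 _⊙_ _⊗_

    _⊖_ : ∀ {n} → Vec² n → Vec² n → Vec² n
    (a₁ , a₂) ⊖ (b₁ , b₂) = a₁ :- b₁ , a₂ :- b₂

    _⊙_ _⊗_ : ∀ {n} → Vec² n → Vec² n → Polynomial n
    (a₁ , a₂) ⊙ (b₁ , b₂) = a₁ :* b₁ :+ a₂ :* b₂
    (a₁ , a₂) ⊗ (b₁ , b₂) = a₁ :* b₂ :- a₂ :* b₁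

  norm²-nonneg : ∀ a → 0# ≤ ⟨ a , a ⟩
  norm²-nonneg (a₁ , a₂) = +-nonneg (square-nonneg a₁) (square-nonneg a₂)

  norm²≈0⇒≈0 : ∀ a → ⟨ a , a ⟩ ≈ 0# → a ≈ₚ (0# , 0#)
  norm²≈0⇒≈0 (a₁ , a₂) eq =
    x*x≈0⇒x≈0 (+≈0⇒ˡ≈0 (square-nonneg a₁) (square-nonneg a₂) eq) ,
    x*x≈0⇒x≈0 (+≈0⇒ʳ≈0 (square-nonneg a₁) (square-nonneg a₂) eq)

  dist²≈0⇒≈ : ∀ p q → ⟨ q -ₚ p , q -ₚ p ⟩ ≈ 0# → p ≈ₚ q
  dist²≈0⇒≈ p q eq with norm²≈0⇒≈0 (q -ₚ p) eq
  ... | e₁ , e₂ = sym (-≈0⇒≈ e₁) , sym (-≈0⇒≈ e₂)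

  0<dist² : ∀ p q → ¬ (p ≈ₚ q) → 0# < ⟨ q -ₚ p , q -ₚ p ⟩
  0<dist² p q p≉q = 0≤∧≉0⇒0< (norm²-nonneg (q -ₚ p)) λ eq → p≉q (dist²≈0⇒≈ p q eq)

  -- The apex of the angle is p; right angles are included.
  Acute : Point → Point → Point → Set ℓ₂
  Acute p q x = 0# ≤ ⟨ x -ₚ p , q -ₚ p ⟩

  -- The vertices are listed in cyclic order.
  record Rectangle (p r q s : Point) : Set ℓ₁ where
    field
      centre      : (p +ₚ q) ≈ₚ (r +ₚ s)
      right-angle : ⟨ r -ₚ p , q -ₚ r ⟩ ≈ 0#

  open Rectangle public

  -- For a = q - p and b = r - p a vanishing determinant gives |a|²|b|² = ⟨a,b⟩² by Lagrange's
  -- identity, while the angles at `q` and `r` bound ⟨a,b⟩ by |a|² and by |b|². Hence all three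
  -- agree and |a - b| = 0.
  direction-injective : ∀ p q r → ¬ (p ≈ₚ q) → ¬ (p ≈ₚ r) → Acute p q r → Acute q p r → Acute r p q →
    det (q -ₚ p) (r -ₚ p) ≈ 0# → q ≈ₚ r
  direction-injective p@(p₁ , p₂) q@(q₁ , q₂) r@(r₁ , r₂) p≉q p≉r pqr qpr rpq det≈0 =
    dist²≈0⇒≈ q r (trans (solve 6 (λ p₁ p₂ q₁ q₂ r₁ r₂ →
          let p = p₁ , p₂ ; q = q₁ , q₂ ; r = r₁ , r₂ ; x = (r ⊖ p) ⊙ (q ⊖ p) in
          (r ⊖ q) ⊙ (r ⊖ q) := ((q ⊖ p) ⊙ (q ⊖ p) :- x) :+ ((r ⊖ p) ⊙ (r ⊖ p) :- x)) refl p₁ p₂ q₁ q₂ r₁ r₂)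
      (product-of-upper-bounds pqr (0<dist² p q p≉q) (0<dist² p r p≉r)
        (0≤-resp (solve 6 (λ p₁ p₂ q₁ q₂ r₁ r₂ →
          let p = p₁ , p₂ ; q = q₁ , q₂ ; r = r₁ , r₂ in
          (r ⊖ q) ⊙ (p ⊖ q) := (q ⊖ p) ⊙ (q ⊖ p) :- (r ⊖ p) ⊙ (q ⊖ p)) refl p₁ p₂ q₁ q₂ r₁ r₂) qpr)
        (0≤-resp (solve 6 (λ p₁ p₂ q₁ q₂ r₁ r₂ →
          let p = p₁ , p₂ ; q = q₁ , q₂ ; r = r₁ , r₂ in
          (q ⊖ r) ⊙ (p ⊖ r) := (r ⊖ p) ⊙ (r ⊖ p) :- (r ⊖ p) ⊙ (q ⊖ p)) refl p₁ p₂ q₁ q₂ r₁ r₂) rpq)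
        (trans (solve 6 (λ p₁ p₂ q₁ q₂ r₁ r₂ →
          let a = (q₁ , q₂) ⊖ (p₁ , p₂) ; b = (r₁ , r₂) ⊖ (p₁ , p₂) in
          (a ⊙ a) :* (b ⊙ b) := (b ⊙ a) :* (b ⊙ a) :+ (a ⊗ b) :* (a ⊗ b)) refl p₁ p₂ q₁ q₂ r₁ r₂)
        (trans (+-congˡ (*-congˡ det≈0)) (trans (+-congˡ (zeroʳ _)) (+-identityʳ _))))))

  -- The sign `σ` selects a handedness, so that every argument also covers its mirror image.
  module Orientation (σ : Carrier) (σσ≈1 : σ * σ ≈ 1#) where

    orient : Point → Point → Carrier
    orient a b = σ * det a b

    σ-cancel : ∀ m n → (σ * m) * (σ * n) ≈ m * n
    σ-cancel m n = trans (solve 3 (λ s m n → (s :* m) :* (s :* n) := (s :* s) :* (m :* n)) refl σ m n)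
      (trans (*-congʳ σσ≈1) (*-identityˡ _))

    -- Seen from p, the point r lies to the left of q (to the right if σ = -1).
    Left : Point → Point → Point → Set (ℓ₁ Level.⊔ ℓ₂)
    Left p q r = 0# < orient (q -ₚ p) (r -ₚ p)

    left-irrefl : ∀ p q → ¬ Left p q q
    left-irrefl p q (_ , 0≉) = 0≉ (sym (lemma (q -ₚ p)))
      where
      lemma : ∀ a → orient a a ≈ 0#
      lemma (a₁ , a₂) = solve 3 (λ s a₁ a₂ → s :* (a₁ :* a₂ :- a₂ :* a₁) := con (+ 0)) refl σ a₁ a₂

    -- Writing × for `orient`, |b|²(a × c) = (a × b)⟨b,c⟩ + (b × c)⟨a,b⟩ is nonnegative. If a × c
    -- were not positive, both summands would vanish, so ⟨b,c⟩ = 0, and then |b|²⟨a,c⟩ = -(a × b)(b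
    -- × c) would be negative.
    orient-trans : ∀ a b c → 0# ≤ ⟨ a , b ⟩ → 0# ≤ ⟨ b , c ⟩ → 0# ≤ ⟨ a , c ⟩ →
      0# < orient a b → 0# < orient b c → 0# < orient a c
    orient-trans a@(a₁ , a₂) b@(b₁ , b₂) c@(c₁ , c₂) ab bc ac 0<a×b 0<b×c with 0<⊎0≤- (orient a c)
    ... | inj₁ 0<a×c  = 0<a×c
    ... | inj₂ 0≤-a×c = contradiction (0≤-resp ac-eq (*-nonneg (norm²-nonneg b) ac))
      (<⇒≱-neg (0<-resp (σ-cancel _ _) (*-pos 0<a×b 0<b×c)))
      where
      s₁≥0 : 0# ≤ orient a b * ⟨ b , c ⟩
      s₁≥0 = *-nonneg (<⇒≤ 0<a×b) bc
      s₂≥0 : 0# ≤ orient b c * ⟨ a , b ⟩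
      s₂≥0 = *-nonneg (<⇒≤ 0<b×c) ab
      sum≈0 : orient a b * ⟨ b , c ⟩ + orient b c * ⟨ a , b ⟩ ≈ 0#
      sum≈0 = nonneg∧nonpos⇒≈0 (+-nonneg s₁≥0 s₂≥0) (0≤-resp
        (solve 7 (λ s a₁ a₂ b₁ b₂ c₁ c₂ → let a = a₁ , a₂ ; b = b₁ , b₂ ; c = c₁ , c₂ in
          (b ⊙ b) :* (:- (s :* (a ⊗ c))) := :- (s :* (a ⊗ b) :* (b ⊙ c) :+ s :* (b ⊗ c) :* (a ⊙ b)))
          refl σ a₁ a₂ b₁ b₂ c₁ c₂)
        (*-nonneg (norm²-nonneg b) 0≤-a×c))
      bc≈0 : ⟨ b , c ⟩ ≈ 0#
      bc≈0 = x*y≈0⇒y≈0 (0<⇒≉0 0<a×b) (+≈0⇒ˡ≈0 s₁≥0 s₂≥0 sum≈0)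
      ac-eq : ⟨ b , b ⟩ * ⟨ a , c ⟩ ≈ - (det a b * det b c)
      ac-eq = trans (solve 6 (λ a₁ a₂ b₁ b₂ c₁ c₂ → let a = a₁ , a₂ ; b = b₁ , b₂ ; c = c₁ , c₂ in
          (b ⊙ b) :* (a ⊙ c) := (a ⊙ b) :* (b ⊙ c) :- (a ⊗ b) :* (b ⊗ c))
          refl a₁ a₂ b₁ b₂ c₁ c₂)
        (trans (+-congʳ (trans (*-congˡ bc≈0) (zeroʳ _))) (+-identityˡ _))

    left-total : ∀ p q r → ¬ (p ≈ₚ q) → ¬ (p ≈ₚ r) → Acute p q r → Acute q p r → Acute r p q →
      ¬ (q ≈ₚ r) → Left p q r ⊎ Left p r q
    left-total p@(p₁ , p₂) q@(q₁ , q₂) r@(r₁ , r₂) p≉q p≉r pqr qpr rpq q≉r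
      with 0<⊎0≤- (orient (q -ₚ p) (r -ₚ p))
    ... | inj₁ 0<q×r  = inj₁ 0<q×r
    ... | inj₂ 0≤-q×r = inj₂ (0≤-resp flip 0≤-q×r , λ 0≈r×q → q≉r
      (direction-injective p q r p≉q p≉r pqr qpr rpq (x*x≈0⇒x≈0
        (trans (sym (σ-cancel _ _)) (trans (*-congˡ (trans (solve 1 (λ x → x := :- (:- x)) refl _)
          (trans (-‿cong (trans flip (sym 0≈r×q))) (solve 0 (:- con (+ 0) := con (+ 0)) refl)))) (zeroʳ _))))))
      where
      flip : - orient (q -ₚ p) (r -ₚ p) ≈ orient (r -ₚ p) (q -ₚ p)
      flip = solve 7 (λ s p₁ p₂ q₁ q₂ r₁ r₂ →
        let a = (q₁ , q₂) ⊖ (p₁ , p₂) ; b = (r₁ , r₂) ⊖ (p₁ , p₂) in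
        :- (s :* (a ⊗ b)) := s :* (b ⊗ a)) refl σ p₁ p₂ q₁ q₂ r₁ r₂

    module _ (p q r s : Point)
      (p≉q : ¬ (p ≈ₚ q)) (pqr : Acute p q r) (qpr : Acute q p r) (pqs : Acute p q s) (qps : Acute q p s)
      (prs : Acute p r s) (rpq : Acute r p q) (qsr : Acute q s r) (sqp : Acute s q p)
      (left-r : Left p q r) (left-s : Left q p s) where
      private
        p₁ p₂ q₁ q₂ r₁ r₂ s₁ s₂ D x y X Y : Carrier
        p₁ = proj₁ p
        p₂ = proj₂ p
        q₁ = proj₁ q
        q₂ = proj₂ q
        r₁ = proj₁ r
        r₂ = proj₂ r
        s₁ = proj₁ s
        s₂ = proj₂ s
        -- Up to the factor |pq|, `x` and `y` are the components of pr along and across pq, and `X`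
        -- and `Y` are those of qs along and across qp.
        D = ⟨ q -ₚ p , q -ₚ p ⟩
        x = ⟨ r -ₚ p , q -ₚ p ⟩
        y = orient (q -ₚ p) (r -ₚ p)
        X = ⟨ s -ₚ q , p -ₚ q ⟩
        Y = orient (p -ₚ q) (s -ₚ q)
        0<D : 0# < D
        0<D = 0<dist² p q p≉q
        x≤D : 0# ≤ D - x
        x≤D = 0≤-resp (solve 6 (λ p₁ p₂ q₁ q₂ r₁ r₂ →
          let p = p₁ , p₂ ; q = q₁ , q₂ ; r = r₁ , r₂ in
          (r ⊖ q) ⊙ (p ⊖ q) := (q ⊖ p) ⊙ (q ⊖ p) :- (r ⊖ p) ⊙ (q ⊖ p)) refl p₁ p₂ q₁ q₂ r₁ r₂) qpr
        X≤D : 0# ≤ D - X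
        X≤D = 0≤-resp (solve 6 (λ p₁ p₂ q₁ q₂ s₁ s₂ →
          let p = p₁ , p₂ ; q = q₁ , q₂ ; s = s₁ , s₂ in
          (s ⊖ p) ⊙ (q ⊖ p) := (q ⊖ p) ⊙ (q ⊖ p) :- (s ⊖ q) ⊙ (p ⊖ q)) refl p₁ p₂ q₁ q₂ s₁ s₂) pqs
        -- Multiplied by `D`, the bounds on the angles of the quadrilateral at `p`, `q`, `r` and `s`
        -- become `α`, `β`, `δ` and `ε`.
        α : 0# ≤ x * (D - X) - y * Y
        α = 0≤-resp (trans (solve 8 (λ p₁ p₂ q₁ q₂ r₁ r₂ s₁ s₂ →
          let p = p₁ , p₂ ; q = q₁ , q₂ ; r = r₁ , r₂ ; s = s₁ , s₂ ; d = q ⊖ p in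
          (d ⊙ d) :* ((s ⊖ p) ⊙ (r ⊖ p)) :=
            ((r ⊖ p) ⊙ d) :* ((d ⊙ d) :- (s ⊖ q) ⊙ (p ⊖ q)) :- (d ⊗ (r ⊖ p)) :* ((p ⊖ q) ⊗ (s ⊖ q)))
          refl p₁ p₂ q₁ q₂ r₁ r₂ s₁ s₂) (+-congˡ (-‿cong (sym (σ-cancel _ _)))))
          (*-nonneg (<⇒≤ 0<D) prs)
        β : 0# ≤ X * (D - x) - y * Y
        β = 0≤-resp (trans (solve 8 (λ p₁ p₂ q₁ q₂ r₁ r₂ s₁ s₂ →
          let p = p₁ , p₂ ; q = q₁ , q₂ ; r = r₁ , r₂ ; s = s₁ , s₂ ; d = q ⊖ p in
          (d ⊙ d) :* ((r ⊖ q) ⊙ (s ⊖ q)) :=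
            ((s ⊖ q) ⊙ (p ⊖ q)) :* ((d ⊙ d) :- (r ⊖ p) ⊙ d) :- (d ⊗ (r ⊖ p)) :* ((p ⊖ q) ⊗ (s ⊖ q)))
          refl p₁ p₂ q₁ q₂ r₁ r₂ s₁ s₂) (+-congˡ (-‿cong (sym (σ-cancel _ _)))))
          (*-nonneg (<⇒≤ 0<D) qsr)
        δ : 0# ≤ y * y - x * (D - x)
        δ = 0≤-resp (trans (solve 6 (λ p₁ p₂ q₁ q₂ r₁ r₂ →
          let p = p₁ , p₂ ; q = q₁ , q₂ ; r = r₁ , r₂ ; d = q ⊖ p ; a = r ⊖ p in
          (d ⊙ d) :* ((q ⊖ r) ⊙ (p ⊖ r)) :=
            (d ⊗ a) :* (d ⊗ a) :- (a ⊙ d) :* ((d ⊙ d) :- a ⊙ d))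
          refl p₁ p₂ q₁ q₂ r₁ r₂) (+-congʳ (sym (σ-cancel _ _))))
          (*-nonneg (<⇒≤ 0<D) rpq)
        ε : 0# ≤ Y * Y - X * (D - X)
        ε = 0≤-resp (trans (solve 6 (λ p₁ p₂ q₁ q₂ s₁ s₂ →
          let p = p₁ , p₂ ; q = q₁ , q₂ ; s = s₁ , s₂ ; d = p ⊖ q ; b = s ⊖ q in
          ((q ⊖ p) ⊙ (q ⊖ p)) :* ((p ⊖ s) ⊙ (q ⊖ s)) :=
            (d ⊗ b) :* (d ⊗ b) :- (b ⊙ d) :* ((q ⊖ p) ⊙ (q ⊖ p) :- b ⊙ d))
          refl p₁ p₂ q₁ q₂ s₁ s₂) (+-congʳ (sym (σ-cancel _ _))))
          (*-nonneg (<⇒≤ 0<D) sqp)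
        x-X≈0 : x - X ≈ 0#
        x-X≈0 = tight⇒x-X≈0 0<D left-r left-s pqr x≤D qps X≤D α β δ ε
        y-Y≈0 : y - Y ≈ 0#
        y-Y≈0 = tight⇒y-Y≈0 0<D left-r left-s pqr x≤D qps X≤D α β δ ε
        det≈0 : det (q -ₚ p) (r -ₚ p) - det (p -ₚ q) (s -ₚ q) ≈ 0#
        det≈0 = trans (sym (*-identityˡ _)) (trans (*-congʳ (sym σσ≈1))
          (trans (solve 3 (λ σ m n → (σ :* σ) :* (m :- n) := σ :* (σ :* m :- σ :* n)) refl σ
            (det (q -ₚ p) (r -ₚ p)) (det (p -ₚ q) (s -ₚ q)))
          (trans (*-congˡ y-Y≈0) (zeroʳ _))))
        -- Each coordinate of (p + q) - (r + s), multiplied by `D`, has this shape, with `u` and `v`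
        -- the coordinates of q - p up to order and sign.
        combination≈0 : ∀ u v → u * (x - X) - v * (det (q -ₚ p) (r -ₚ p) - det (p -ₚ q) (s -ₚ q)) ≈ 0#
        combination≈0 u v = trans (+-cong (*-congˡ x-X≈0) (-‿cong (*-congˡ det≈0)))
          (solve 2 (λ u v → u :* con (+ 0) :- v :* con (+ 0) := con (+ 0)) refl u v)

      -- The angles of the quadrilateral p r q s sum to four right angles, and none of them
      -- exceeds a right angle.
      opposite-normals⇒rectangle : Rectangle p r q s
      opposite-normals⇒rectangle .centre =
        -≈0⇒≈ (x*y≈0⇒y≈0 (0<⇒≉0 0<D) (trans (solve 8 (λ p₁ p₂ q₁ q₂ r₁ r₂ s₁ s₂ →
          let p = p₁ , p₂ ; q = q₁ , q₂ ; r = r₁ , r₂ ; s = s₁ , s₂ ; d = q ⊖ p in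
          (d ⊙ d) :* ((p₁ :+ q₁) :- (r₁ :+ s₁)) :=
            (p₁ :- q₁) :* ((r ⊖ p) ⊙ d :- (s ⊖ q) ⊙ (p ⊖ q)) :-
            (p₂ :- q₂) :* (d ⊗ (r ⊖ p) :- (p ⊖ q) ⊗ (s ⊖ q)))
          refl p₁ p₂ q₁ q₂ r₁ r₂ s₁ s₂) (combination≈0 (p₁ - q₁) (p₂ - q₂)))) ,
        -≈0⇒≈ (x*y≈0⇒y≈0 (0<⇒≉0 0<D) (trans (solve 8 (λ p₁ p₂ q₁ q₂ r₁ r₂ s₁ s₂ →
          let p = p₁ , p₂ ; q = q₁ , q₂ ; r = r₁ , r₂ ; s = s₁ , s₂ ; d = q ⊖ p in
          (d ⊙ d) :* ((p₂ :+ q₂) :- (r₂ :+ s₂)) :=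
            (p₂ :- q₂) :* ((r ⊖ p) ⊙ d :- (s ⊖ q) ⊙ (p ⊖ q)) :-
            (q₁ :- p₁) :* (d ⊗ (r ⊖ p) :- (p ⊖ q) ⊗ (s ⊖ q)))
          refl p₁ p₂ q₁ q₂ r₁ r₂ s₁ s₂) (combination≈0 (p₂ - q₂) (q₁ - p₁))))
      opposite-normals⇒rectangle .right-angle =
        x*y≈0⇒y≈0 (0<⇒≉0 0<D) (trans (solve 6 (λ p₁ p₂ q₁ q₂ r₁ r₂ →
          let p = p₁ , p₂ ; q = q₁ , q₂ ; r = r₁ , r₂ ; d = q ⊖ p ; a = r ⊖ p in
          (d ⊙ d) :* ((r ⊖ p) ⊙ (q ⊖ r)) :=
            :- ((d ⊗ a) :* (d ⊗ a) :- (a ⊙ d) :* ((d ⊙ d) :- a ⊙ d)))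
          refl p₁ p₂ q₁ q₂ r₁ r₂)
        (trans (-‿cong (trans (+-congʳ (sym (σ-cancel _ _)))
          (tight⇒right-angle 0<D left-r left-s pqr x≤D qps X≤D α β δ ε)))
          (solve 0 (:- con (+ 0) := con (+ 0)) refl)))

    -- Seen from `r`, the point `q` is a right angle to the left of `p`; a point `z` to the right of
    -- `p` would form an obtuse angle with `q`.
    right-angle⇒rightmost : ∀ p q r z → ⟨ r -ₚ p , q -ₚ r ⟩ ≈ 0# →
      Left p q r → Left r z p → ¬ Acute r z q
    right-angle⇒rightmost p@(p₁ , p₂) q@(q₁ , q₂) r@(r₁ , r₂) z@(z₁ , z₂) right left-r left-p rzq =
      <⇒≱-neg (0<-resp (σ-cancel _ _) (*-pos left-r left-p)) (0≤-resp
        (trans (solve 8 (λ p₁ p₂ q₁ q₂ r₁ r₂ z₁ z₂ →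
          let p = p₁ , p₂ ; q = q₁ , q₂ ; r = r₁ , r₂ ; z = z₁ , z₂ in
          ((r ⊖ p) ⊙ (r ⊖ p)) :* ((q ⊖ r) ⊙ (z ⊖ r)) :=
            ((z ⊖ r) ⊙ (r ⊖ p)) :* ((r ⊖ p) ⊙ (q ⊖ r)) :- ((q ⊖ p) ⊗ (r ⊖ p)) :* ((z ⊖ r) ⊗ (p ⊖ r)))
          refl p₁ p₂ q₁ q₂ r₁ r₂ z₁ z₂)
        (trans (+-congʳ (trans (*-congˡ right) (zeroʳ _))) (+-identityˡ _)))
        (*-nonneg (norm²-nonneg (r -ₚ p)) rzq))

    -- Both rectangles have the side p r and lie on the same side of it; since pq is a
    -- double normal the first is not shorter, and since rt is one it is not longer.
    rectangles-on-a-side-agree : ∀ {p q r s t z} → Rectangle p r q s → Rectangle r p t z →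
      Left p q r → Left r p t → Acute q p z → Acute t r s → s ≈ₚ t
    rectangles-on-a-side-agree {p₁ , p₂} {q₁ , q₂} {r₁ , r₂} {s₁ , s₂} {t₁ , t₂} {z₁ , z₂} R R′ left-r left-t qpz trs =
      dist²≈0⇒≈ s t (trans (solve 6 (λ p₁ p₂ s₁ s₂ t₁ t₂ →
          let b = (s₁ , s₂) ⊖ (p₁ , p₂) ; T = (t₁ , t₂) ⊖ (p₁ , p₂) in
          ((t₁ , t₂) ⊖ (s₁ , s₂)) ⊙ ((t₁ , t₂) ⊖ (s₁ , s₂)) := (b ⊙ b :- b ⊙ T) :+ (T ⊙ T :- b ⊙ T))
          refl p₁ p₂ s₁ s₂ t₁ t₂)
        (product-of-upper-bounds (<⇒≤ 0<bT) 0<bb 0<TT bT≤bb bT≤TT bbTT))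
      where
      p q r s t z a b T : Point
      p = p₁ , p₂
      q = q₁ , q₂
      r = r₁ , r₂
      s = s₁ , s₂
      t = t₁ , t₂
      z = z₁ , z₂
      -- The common side is `a`; the sides `b` and `T` at `p` are perpendicular to it and point the
      -- same way, so only their lengths have to be compared.
      a = r -ₚ p
      b = s -ₚ p
      T = t -ₚ p
      det-ba det-Ta : Carrier
      det-ba = det b a
      det-Ta = det T a

      cancel-right : ∀ {p q r s} → p + q ≈ r + s → q - r ≈ s - p
      cancel-right {p} {q} {r} {s} eq = trans (solve 3 (λ p q r → q :- r := (p :+ q) :- (p :+ r)) refl p q r)
        (trans (+-congʳ eq) (solve 3 (λ p r s → (r :+ s) :- (p :+ r) := s :- p) refl p r s))

      q-r₁≈b₁ : q₁ - r₁ ≈ s₁ - p₁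
      q-r₁≈b₁ = cancel-right (proj₁ (centre R))
      q-r₂≈b₂ : q₂ - r₂ ≈ s₂ - p₂
      q-r₂≈b₂ = cancel-right (proj₂ (centre R))

      ab≈0 : ⟨ a , b ⟩ ≈ 0#
      ab≈0 = trans (+-cong (*-congˡ (sym q-r₁≈b₁)) (*-congˡ (sym q-r₂≈b₂))) (right-angle R)

      aT≈0 : ⟨ a , T ⟩ ≈ 0#
      aT≈0 = trans (solve 6 (λ p₁ p₂ r₁ r₂ t₁ t₂ →
          let p = p₁ , p₂ ; r = r₁ , r₂ ; t = t₁ , t₂ in
          (r ⊖ p) ⊙ (t ⊖ p) := :- ((p ⊖ r) ⊙ (t ⊖ p))) refl p₁ p₂ r₁ r₂ t₁ t₂)
        (trans (-‿cong (right-angle R′)) (solve 0 (:- con (+ 0) := con (+ 0)) refl))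

      0<det-ba : 0# < σ * det-ba
      0<det-ba = 0<-resp (*-congˡ (trans (solve 6 (λ p₁ p₂ q₁ q₂ r₁ r₂ →
          let p = p₁ , p₂ ; q = q₁ , q₂ ; r = r₁ , r₂ in
          (q ⊖ p) ⊗ (r ⊖ p) := (q ⊖ r) ⊗ (r ⊖ p)) refl p₁ p₂ q₁ q₂ r₁ r₂)
        (+-cong (*-congʳ q-r₁≈b₁) (-‿cong (*-congʳ q-r₂≈b₂))))) left-r

      0<det-Ta : 0# < σ * det-Ta
      0<det-Ta = 0<-resp (*-congˡ (solve 6 (λ p₁ p₂ r₁ r₂ t₁ t₂ →
          let p = p₁ , p₂ ; r = r₁ , r₂ ; t = t₁ , t₂ in
          (p ⊖ r) ⊗ (t ⊖ r) := (t ⊖ p) ⊗ (r ⊖ p)) refl p₁ p₂ r₁ r₂ t₁ t₂)) left-t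

      0<bT : 0# < ⟨ b , T ⟩
      0<bT = *-cancelˡ-pos (norm²-nonneg a) (0<-resp (sym (trans
        (solve 6 (λ a₁ a₂ b₁ b₂ t₁ t₂ → let a = a₁ , a₂ ; b = b₁ , b₂ ; T = t₁ , t₂ in
          (a ⊙ a) :* (b ⊙ T) := (a ⊙ b) :* (a ⊙ T) :+ (b ⊗ a) :* (T ⊗ a))
          refl (proj₁ a) (proj₂ a) (proj₁ b) (proj₂ b) (proj₁ T) (proj₂ T))
        (trans (+-congʳ (trans (*-congʳ ab≈0) (zeroˡ _))) (+-identityˡ _))))
        (0<-resp (σ-cancel _ _) (*-pos 0<det-ba 0<det-Ta)))

      a≉0 : ¬ (⟨ a , a ⟩ ≈ 0#)
      a≉0 aa≈0 with norm²≈0⇒≈0 a aa≈0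
      ... | a₁≈0 , a₂≈0 = 0<⇒≉0 0<det-ba (trans (*-congˡ (+-cong (*-congˡ a₂≈0) (-‿cong (*-congˡ a₁≈0))))
        (solve 3 (λ s b₁ b₂ → s :* (b₁ :* con (+ 0) :- b₂ :* con (+ 0)) := con (+ 0)) refl σ (proj₁ b) (proj₂ b)))

      det-bT≈0 : det b T ≈ 0#
      det-bT≈0 = x*y≈0⇒y≈0 a≉0 (trans
        (solve 6 (λ a₁ a₂ b₁ b₂ t₁ t₂ → let a = a₁ , a₂ ; b = b₁ , b₂ ; T = t₁ , t₂ in
          (a ⊙ a) :* (b ⊗ T) := (b ⊗ a) :* (a ⊙ T) :- (T ⊗ a) :* (a ⊙ b))
          refl (proj₁ a) (proj₂ a) (proj₁ b) (proj₂ b) (proj₁ T) (proj₂ T))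
        (trans (+-cong (*-congˡ aT≈0) (-‿cong (*-congˡ ab≈0)))
          (solve 2 (λ u v → u :* con (+ 0) :- v :* con (+ 0) := con (+ 0)) refl det-ba det-Ta)))

      bbTT : ⟨ b , b ⟩ * ⟨ T , T ⟩ ≈ ⟨ b , T ⟩ * ⟨ b , T ⟩
      bbTT = trans (solve 4 (λ b₁ b₂ t₁ t₂ → let b = b₁ , b₂ ; T = t₁ , t₂ in
          (b ⊙ b) :* (T ⊙ T) := (b ⊙ T) :* (b ⊙ T) :+ (b ⊗ T) :* (b ⊗ T))
          refl (proj₁ b) (proj₂ b) (proj₁ T) (proj₂ T))
        (trans (+-congˡ (trans (*-congˡ det-bT≈0) (zeroʳ _))) (+-identityʳ _))

      0<bbTT : 0# < ⟨ b , b ⟩ * ⟨ T , T ⟩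
      0<bbTT = 0<-resp (sym bbTT) (*-pos 0<bT 0<bT)
      0<TT : 0# < ⟨ T , T ⟩
      0<TT = *-cancelˡ-pos (norm²-nonneg b) 0<bbTT
      0<bb : 0# < ⟨ b , b ⟩
      0<bb = *-cancelˡ-pos (norm²-nonneg T) (0<-resp (*-comm _ _) 0<bbTT)

      -- Here z - q = T - b and p - q = - a - b, so the angle at `q` bounds `T` in terms of `b`.
      bT≤bb : 0# ≤ ⟨ b , b ⟩ - ⟨ b , T ⟩
      bT≤bb = 0≤-resp (trans (+-cong (*-cong (z-q≈t-s (proj₁ (centre R)) (proj₁ (centre R′))) (p-q≈-a-b (proj₁ (centre R))))
                                     (*-cong (z-q≈t-s (proj₂ (centre R)) (proj₂ (centre R′))) (p-q≈-a-b (proj₂ (centre R)))))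
        (trans (solve 8 (λ p₁ p₂ r₁ r₂ s₁ s₂ t₁ t₂ →
            let p = p₁ , p₂ ; r = r₁ , r₂ ; s = s₁ , s₂ ; t = t₁ , t₂ ; a = r ⊖ p ; b = s ⊖ p ; T = t ⊖ p in
            (t₁ :- s₁) :* (:- (r₁ :- p₁) :- (s₁ :- p₁)) :+ (t₂ :- s₂) :* (:- (r₂ :- p₂) :- (s₂ :- p₂)) :=
            (b ⊙ b :- b ⊙ T) :+ (a ⊙ b :- a ⊙ T)) refl p₁ p₂ r₁ r₂ s₁ s₂ t₁ t₂)
          (trans (+-congˡ (trans (+-cong ab≈0 (-‿cong aT≈0)) (solve 0 (con (+ 0) :- con (+ 0) := con (+ 0)) refl)))
            (+-identityʳ _)))) qpz
        where
        z-q≈t-s : ∀ {p q r s t z} → p + q ≈ r + s → r + t ≈ p + z → z - q ≈ t - s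
        z-q≈t-s {p} {q} {r} {s} {t} {z} e e′ = trans
          (solve 3 (λ p q z → z :- q := (p :+ z) :- (p :+ q)) refl p q z)
          (trans (+-cong (sym e′) (-‿cong e))
            (solve 3 (λ r s t → (r :+ t) :- (r :+ s) := t :- s) refl r s t))
        p-q≈-a-b : ∀ {p q r s} → p + q ≈ r + s → p - q ≈ - (r - p) - (s - p)
        p-q≈-a-b {p} {q} {r} {s} e = trans
          (solve 2 (λ p q → p :- q := p :+ p :- (p :+ q)) refl p q)
          (trans (+-congˡ (-‿cong e))
            (solve 3 (λ p r s → p :+ p :- (r :+ s) := :- (r :- p) :- (s :- p)) refl p r s))

      bT≤TT : 0# ≤ ⟨ T , T ⟩ - ⟨ b , T ⟩
      bT≤TT = 0≤-resp (trans (solve 8 (λ p₁ p₂ r₁ r₂ s₁ s₂ t₁ t₂ →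
            let p = p₁ , p₂ ; r = r₁ , r₂ ; s = s₁ , s₂ ; t = t₁ , t₂ ; a = r ⊖ p ; b = s ⊖ p ; T = t ⊖ p in
            (s ⊖ t) ⊙ (r ⊖ t) :=
            (T ⊙ T :- b ⊙ T) :+ (a ⊙ b :- a ⊙ T)) refl p₁ p₂ r₁ r₂ s₁ s₂ t₁ t₂)
          (trans (+-congˡ (trans (+-cong ab≈0 (-‿cong aT≈0)) (solve 0 (con (+ 0) :- con (+ 0) := con (+ 0)) refl)))
            (+-identityʳ _))) trs

    -- X and S are consecutive vertices of a polygon inscribed in a circle around the origin,
    -- W lies in the half plane of the side X S and X is the vertex farthest in direction W.
    side⇒in-disc : ∀ X S W → ⟨ S , S ⟩ ≈ ⟨ X , X ⟩ → 0# < orient X S → 0# ≤ orient X W →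
      0# ≤ ⟨ W , X ⟩ - ⟨ W , S ⟩ → 0# ≤ ⟨ X -ₚ W , X +ₚ S ⟩ → 0# ≤ ⟨ X , X ⟩ - ⟨ W , W ⟩
    side⇒in-disc X@(x₁ , x₂) S@(s₁ , s₂) W@(w₁ , w₂) SS≈XX 0<Δ 0≤B WS≤WX half-plane =
      *-cancelˡ-nonneg 0<ρ (0≤-resp (trans
        (solve 3 (λ ρ A N → (ρ :* A :- N) :+ ρ :* (ρ :- A) := ρ :* ρ :- N) refl ρ A (A * A + B * B))
        (trans (+-congˡ (-‿cong AABB)) (solve 2 (λ ρ N → ρ :* ρ :- ρ :* N := ρ :* (ρ :- N)) refl ρ ⟨ W , W ⟩)))
        (+-nonneg within-A (*-nonneg (<⇒≤ 0<ρ) A≤ρ)))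
      where
      ρ A B C Δ : Carrier
      -- In the frame along and across `X`, scaled by |X|, the points `X`, `S` and `W` are (ρ, 0),
      -- (C, Δ) and (A, B).
      ρ = ⟨ X , X ⟩
      A = ⟨ W , X ⟩
      B = orient X W
      C = ⟨ S , X ⟩
      Δ = orient X S

      AABB : A * A + B * B ≈ ρ * ⟨ W , W ⟩
      AABB = trans (+-congˡ (σ-cancel _ _)) (solve 4 (λ x₁ x₂ w₁ w₂ →
        let X = x₁ , x₂ ; W = w₁ , w₂ in
        (W ⊙ X) :* (W ⊙ X) :+ (X ⊗ W) :* (X ⊗ W) := (X ⊙ X) :* (W ⊙ W)) refl x₁ x₂ w₁ w₂)

      CCΔΔ : C * C + Δ * Δ ≈ ρ * ρ
      CCΔΔ = trans (+-congˡ (σ-cancel _ _)) (trans (solve 4 (λ x₁ x₂ w₁ w₂ →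
        let X = x₁ , x₂ ; W = w₁ , w₂ in
        (W ⊙ X) :* (W ⊙ X) :+ (X ⊗ W) :* (X ⊗ W) := (X ⊙ X) :* (W ⊙ W)) refl x₁ x₂ s₁ s₂) (*-congˡ SS≈XX))

      ACBΔ : A * C + B * Δ ≈ ρ * ⟨ W , S ⟩
      ACBΔ = trans (+-congˡ (σ-cancel _ _)) (solve 6 (λ x₁ x₂ s₁ s₂ w₁ w₂ →
        let X = x₁ , x₂ ; S = s₁ , s₂ ; W = w₁ , w₂ in
        (W ⊙ X) :* (S ⊙ X) :+ (X ⊗ W) :* (X ⊗ S) := (X ⊙ X) :* (W ⊙ S)) refl x₁ x₂ s₁ s₂ w₁ w₂)

      0<ΔΔ : 0# < Δ * Δ
      0<ΔΔ = *-pos 0<Δ 0<Δ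

      0<ρ : 0# < ρ
      0<ρ = 0≤∧≉0⇒0< (norm²-nonneg X) λ ρ≈0 → case (norm²≈0⇒≈0 X ρ≈0)
        where
        case : ¬ (X ≈ₚ (0# , 0#))
        case (x₁≈0 , x₂≈0) = 0<⇒≉0 0<Δ (trans (*-congˡ (+-cong (*-congʳ x₁≈0) (-‿cong (*-congʳ x₂≈0))))
          (solve 3 (λ s b₁ b₂ → s :* (con (+ 0) :* b₁ :- con (+ 0) :* b₂) := con (+ 0)) refl σ s₂ s₁))

      0<[ρ-C][ρ+C] : 0# < (ρ - C) * (ρ + C)
      0<[ρ-C][ρ+C] = 0<-resp (trans (solve 2 (λ C Δ → Δ := C :+ Δ :- C) refl (C * C) (Δ * Δ))
        (trans (+-congʳ CCΔΔ) (solve 2 (λ ρ C → ρ :* ρ :- C :* C := (ρ :- C) :* (ρ :+ C)) refl ρ C))) 0<ΔΔ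

      0<ρ+ρ : 0# < ρ + ρ
      0<ρ+ρ = +-pos-nonneg 0<ρ (<⇒≤ 0<ρ)
      0<ρ-C : 0# < ρ - C
      0<ρ-C = *-pos∧+-pos⇒pos 0<[ρ-C][ρ+C] (0<-resp (solve 2 (λ ρ C → ρ :+ ρ := ρ :- C :+ (ρ :+ C)) refl ρ C) 0<ρ+ρ)
      0<ρ+C : 0# < ρ + C
      0<ρ+C = *-cancelˡ-pos (<⇒≤ 0<ρ-C) 0<[ρ-C][ρ+C]

      h₁ : 0# ≤ A * (ρ - C) - B * Δ
      h₁ = 0≤-resp (trans (solve 3 (λ ρ A w → ρ :* (A :- w) := ρ :* A :- ρ :* w) refl ρ A ⟨ W , S ⟩)
        (trans (+-congˡ (-‿cong (sym ACBΔ)))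
          (solve 4 (λ ρ A C N → ρ :* A :- (A :* C :+ N) := A :* (ρ :- C) :- N) refl ρ A C (B * Δ))))
        (*-nonneg (<⇒≤ 0<ρ) WS≤WX)

      h₂ : 0# ≤ (ρ - A) * (ρ + C) - B * Δ
      h₂ = 0≤-resp (trans (solve 6 (λ x₁ x₂ s₁ s₂ w₁ w₂ →
          let X = x₁ , x₂ ; S = s₁ , s₂ ; W = w₁ , w₂ ; ρ = X ⊙ X in
          ρ :* ((X ⊖ W) ⊙ (x₁ :+ s₁ , x₂ :+ s₂)) := ρ :* (ρ :+ S ⊙ X :- W ⊙ X) :- ρ :* (W ⊙ S)) refl x₁ x₂ s₁ s₂ w₁ w₂)
        (trans (+-congˡ (-‿cong (sym ACBΔ)))
          (solve 4 (λ ρ A C N → ρ :* (ρ :+ C :- A) :- (A :* C :+ N) := (ρ :- A) :* (ρ :+ C) :- N) refl ρ A C (B * Δ))))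
        (*-nonneg (<⇒≤ 0<ρ) half-plane)

      0≤BΔ : 0# ≤ B * Δ
      0≤BΔ = *-nonneg 0≤B (<⇒≤ 0<Δ)

      0≤A : 0# ≤ A
      0≤A = *-cancelˡ-nonneg 0<ρ-C (0≤-resp (solve 4 (λ ρ A C N → A :* (ρ :- C) :- N :+ N := (ρ :- C) :* A) refl ρ A C (B * Δ))
        (+-nonneg h₁ 0≤BΔ))

      A≤ρ : 0# ≤ ρ - A
      A≤ρ = *-cancelˡ-nonneg 0<ρ+C (0≤-resp (solve 4 (λ ρ A C N → (ρ :- A) :* (ρ :+ C) :- N :+ N := (ρ :+ C) :* (ρ :- A)) refl ρ A C (B * Δ))
        (+-nonneg h₂ 0≤BΔ))

      i : 0# ≤ A * (B * Δ) - B * B * (ρ + C)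
      i = *-cancelˡ-nonneg 0<ρ-C (0≤-resp (trans
        (solve 5 (λ ρ A B C Δ → (B :* Δ) :* (A :* (ρ :- C) :- B :* Δ) :=
          (ρ :- C) :* (A :* (B :* Δ)) :- B :* B :* ((C :* C :+ Δ :* Δ) :- C :* C)) refl ρ A B C Δ)
        (trans (+-congˡ (-‿cong (*-congˡ (+-congʳ CCΔΔ))))
          (solve 4 (λ ρ N B C → (ρ :- C) :* N :- B :* B :* (ρ :* ρ :- C :* C) := (ρ :- C) :* (N :- B :* B :* (ρ :+ C)))
            refl ρ (A * (B * Δ)) B C)))
        (*-nonneg 0≤BΔ h₁))

      -- `h₁`, `h₂` and `0≤B` confine `W` to the triangle formed by the origin, `X` and the midpoint
      -- of XS. It has its right angle at the midpoint, so by Thales it lies in the disc whose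
      -- diameter runs from the origin to `X`; this is the inequality.
      within-A : 0# ≤ ρ * A - (A * A + B * B)
      within-A = *-cancelˡ-nonneg 0<ρ+C (0≤-resp
        (solve 5 (λ ρ A B C N → (A :* N :- B :* B :* (ρ :+ C)) :+ A :* ((ρ :- A) :* (ρ :+ C) :- N) :=
          (ρ :+ C) :* (ρ :* A :- (A :* A :+ B :* B))) refl ρ A B C (B * Δ))
        (+-nonneg i (*-nonneg 0≤A h₂)))

    -- Seen from the centre and doubled to avoid halves, the corners `p` and `s` are `X` and `S`.
    -- Since `X +ₚ S` is twice p - r, the bound on the angle at `p` between `r` and `k` is the half
    -- plane of the side ps.
    rectangle-in-disc : ∀ {p q r s} k → Rectangle p r q s → Left p q r → Acute p r k →
      let X = p -ₚ q ; S = s -ₚ r ; W = (k +ₚ k) -ₚ (p +ₚ q) in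
      0# ≤ orient X W → ⟨ W , S ⟩ ≤ ⟨ W , X ⟩ → ⟨ W , W ⟩ ≤ ⟨ X , X ⟩
    rectangle-in-disc {p₁ , p₂} {q₁ , q₂} {r₁ , r₂} {s₁ , s₂} (k₁ , k₂) R left-r prk 0≤X×W WS≤WX =
      0≤-⇒≤ (side⇒in-disc X S′ W
        (-≈0⇒≈ (trans (solve 6 (λ p₁ p₂ q₁ q₂ r₁ r₂ →
          let p = p₁ , p₂ ; q = q₁ , q₂ ; r = r₁ , r₂ ; S = (p₁ :+ q₁ , p₂ :+ q₂) ⊖ (r₁ :+ r₁ , r₂ :+ r₂) in
          S ⊙ S :- (p ⊖ q) ⊙ (p ⊖ q) := con (-[1+ 3 ]) :* ((r ⊖ p) ⊙ (q ⊖ r))) refl p₁ p₂ q₁ q₂ r₁ r₂)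
          (trans (*-congˡ (right-angle R)) (zeroʳ _))))
        (0<-resp (solve 7 (λ σ p₁ p₂ q₁ q₂ r₁ r₂ →
          let p = p₁ , p₂ ; q = q₁ , q₂ ; r = r₁ , r₂ ; S = (p₁ :+ q₁ , p₂ :+ q₂) ⊖ (r₁ :+ r₁ , r₂ :+ r₂) in
          σ :* ((q ⊖ p) ⊗ (r ⊖ p)) :+ σ :* ((q ⊖ p) ⊗ (r ⊖ p)) := σ :* ((p ⊖ q) ⊗ S)) refl σ p₁ p₂ q₁ q₂ r₁ r₂)
          (+-pos-nonneg left-r (<⇒≤ left-r)))
        0≤X×W
        (0≤-resp (+-congˡ (-‿cong (+-cong (*-congˡ (side (proj₁ (centre R)))) (*-congˡ (side (proj₂ (centre R)))))))
          (≤⇒0≤- WS≤WX))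
        (0≤-resp (solve 8 (λ p₁ p₂ q₁ q₂ r₁ r₂ k₁ k₂ →
          let p = p₁ , p₂ ; q = q₁ , q₂ ; r = r₁ , r₂ ; k = k₁ , k₂
              S = (p₁ :+ q₁ , p₂ :+ q₂) ⊖ (r₁ :+ r₁ , r₂ :+ r₂) ; X = p ⊖ q
              W = (k₁ :+ k₁ , k₂ :+ k₂) ⊖ (p₁ :+ q₁ , p₂ :+ q₂)
              d = (k ⊖ p) ⊙ (r ⊖ p) in
          (d :+ d) :+ (d :+ d) := (X ⊖ W) ⊙ (proj₁ X :+ proj₁ S , proj₂ X :+ proj₂ S)) refl p₁ p₂ q₁ q₂ r₁ r₂ k₁ k₂)
          (+-nonneg (+-nonneg prk prk) (+-nonneg prk prk))))
      where
      X S′ W : Point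
      X = (p₁ , p₂) -ₚ (q₁ , q₂)
      -- This is `s -ₚ r` with `s` eliminated by means of the common centre.
      S′ = ((p₁ , p₂) +ₚ (q₁ , q₂)) -ₚ ((r₁ , r₂) +ₚ (r₁ , r₂))
      W = ((k₁ , k₂) +ₚ (k₁ , k₂)) -ₚ ((p₁ , p₂) +ₚ (q₁ , q₂))
      side : ∀ {p q r s} → p + q ≈ r + s → s - r ≈ p + q - (r + r)
      side {p} {q} {r} {s} e = trans (solve 2 (λ r s → s :- r := (r :+ s) :- (r :+ r)) refl r s) (+-congʳ (sym e))

  rectangle-diagonals : ∀ {p q r s} → Rectangle p r q s → ⟨ r -ₚ s , r -ₚ s ⟩ ≈ ⟨ p -ₚ q , p -ₚ q ⟩
  rectangle-diagonals {p₁ , p₂} {q₁ , q₂} {r₁ , r₂} {s₁ , s₂} R =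
    -≈0⇒≈ (trans (+-congʳ (+-cong (*-cong e₁ e₁) (*-cong e₂ e₂))) (trans
      (solve 6 (λ p₁ p₂ q₁ q₂ r₁ r₂ →
        let p = p₁ , p₂ ; q = q₁ , q₂ ; r = r₁ , r₂ ; S = (r₁ :+ r₁ , r₂ :+ r₂) ⊖ (p₁ :+ q₁ , p₂ :+ q₂) in
        S ⊙ S :- (p ⊖ q) ⊙ (p ⊖ q) := con (-[1+ 3 ]) :* ((r ⊖ p) ⊙ (q ⊖ r))) refl p₁ p₂ q₁ q₂ r₁ r₂)
      (trans (*-congˡ (right-angle R)) (zeroʳ _))))
    where
    diagonal : ∀ {p q r s} → p + q ≈ r + s → r - s ≈ r + r - (p + q)
    diagonal {p} {q} {r} {s} e = trans (solve 2 (λ r s → r :- s := (r :+ r) :- (r :+ s)) refl r s) (+-congˡ (-‿cong (sym e)))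
    e₁ : r₁ - s₁ ≈ r₁ + r₁ - (p₁ + q₁)
    e₁ = diagonal (proj₁ (centre R))
    e₂ : r₂ - s₂ ≈ r₂ + r₂ - (p₂ + q₂)
    e₂ = diagonal (proj₂ (centre R))

  -- k lies in the disc with diameter pq, scaled by 2 to avoid the midpoint.
  InDisc : Point → Point → Point → Set ℓ₂
  InDisc p q k = let W = (k +ₚ k) -ₚ (p +ₚ q) in ⟨ W , W ⟩ ≤ ⟨ p -ₚ q , p -ₚ q ⟩

  -- By the parallelogram law, `p` and `q` lying in the disc on rs gives |C|² ≤ |rs|² - |pq|², where
  -- `C` is twice the difference of the centres. The same with the pairs exchanged forces C = 0 and
  -- then equal diameters.
  discs-agree : ∀ p q r s → InDisc p q r → InDisc p q s → InDisc r s p → InDisc r s q →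
    (p +ₚ q) ≈ₚ (r +ₚ s) × ⟨ p -ₚ q , p -ₚ q ⟩ ≈ ⟨ r -ₚ s , r -ₚ s ⟩
  discs-agree p@(p₁ , p₂) q@(q₁ , q₂) r@(r₁ , r₂) s@(s₁ , s₂) pqr pqs rsp rsq =
    (-≈0⇒≈ (proj₁ C≈0) , -≈0⇒≈ (proj₂ C≈0)) ,
    sym (-≈0⇒≈ (nonneg∧nonpos⇒≈0
      (*-cancelˡ-nonneg 0<2 (add-back a))
      (*-cancelˡ-nonneg 0<2 (0≤-resp (solve 2 (λ x y → con (+ 2) :* (x :- y) := con (+ 2) :* (:- (y :- x)))
        refl ⟨ p -ₚ q , p -ₚ q ⟩ ⟨ r -ₚ s , r -ₚ s ⟩) (add-back b)))))
    where
    C : Point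
    C = (p +ₚ q) -ₚ (r +ₚ s)
    0<2 : 0# < 1# + 1#
    0<2 = +-pos-nonneg 0<1 (<⇒≤ 0<1)
    CC : Carrier
    CC = (1# + 1#) * ⟨ C , C ⟩
    CC≥0 : 0# ≤ CC
    CC≥0 = *-nonneg (<⇒≤ 0<2) (norm²-nonneg C)
    add-back : ∀ {x} → 0# ≤ x - CC → 0# ≤ x
    add-back {x} 0≤x-CC = 0≤-resp (solve 2 (λ x y → x :- y :+ y := x) refl x CC) (+-nonneg 0≤x-CC CC≥0)
    parallelogram : ∀ p q r s → InDisc r s p → InDisc r s q →
      let C = (p +ₚ q) -ₚ (r +ₚ s) in
      0# ≤ (1# + 1#) * (⟨ r -ₚ s , r -ₚ s ⟩ - ⟨ p -ₚ q , p -ₚ q ⟩) - (1# + 1#) * ⟨ C , C ⟩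
    parallelogram (p₁ , p₂) (q₁ , q₂) (r₁ , r₂) (s₁ , s₂) rsp rsq = 0≤-resp (solve 8 (λ p₁ p₂ q₁ q₂ r₁ r₂ s₁ s₂ →
      let p = p₁ , p₂ ; q = q₁ , q₂ ; r = r₁ , r₂ ; s = s₁ , s₂
          c = r₁ :+ s₁ , r₂ :+ s₂ ; C = (p₁ :+ q₁ , p₂ :+ q₂) ⊖ c
          P = (p₁ :+ p₁ , p₂ :+ p₂) ⊖ c ; Q = (q₁ :+ q₁ , q₂ :+ q₂) ⊖ c
          ρ = (r ⊖ s) ⊙ (r ⊖ s) in
      (ρ :- P ⊙ P) :+ (ρ :- Q ⊙ Q) :=
      con (+ 2) :* (ρ :- (p ⊖ q) ⊙ (p ⊖ q)) :- con (+ 2) :* (C ⊙ C)) refl p₁ p₂ q₁ q₂ r₁ r₂ s₁ s₂)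
      (+-nonneg (≤⇒0≤- rsp) (≤⇒0≤- rsq))
    a : 0# ≤ (1# + 1#) * (⟨ r -ₚ s , r -ₚ s ⟩ - ⟨ p -ₚ q , p -ₚ q ⟩) - CC
    a = parallelogram p q r s rsp rsq
    b : 0# ≤ (1# + 1#) * (⟨ p -ₚ q , p -ₚ q ⟩ - ⟨ r -ₚ s , r -ₚ s ⟩) - CC
    b = 0≤-resp (+-congˡ (-‿cong (*-congˡ (solve 4 (λ x y z w →
          (x :- z) :* (x :- z) :+ (y :- w) :* (y :- w) := (z :- x) :* (z :- x) :+ (w :- y) :* (w :- y)) refl
          (r₁ + s₁) (r₂ + s₂) (p₁ + q₁) (p₂ + q₂))))) (parallelogram r s p q pqr pqs)
    CC≈0 : CC ≈ 0#
    CC≈0 = +≈0⇒ʳ≈0 CC≥0 CC≥0 (nonneg∧nonpos⇒≈0 (+-nonneg CC≥0 CC≥0) (0≤-resp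
      (solve 3 (λ x y z → (con (+ 2) :* (x :- y) :- z) :+ (con (+ 2) :* (y :- x) :- z) := :- (z :+ z)) refl
        ⟨ r -ₚ s , r -ₚ s ⟩ ⟨ p -ₚ q , p -ₚ q ⟩ CC) (+-nonneg a b)))
    C≈0 : C ≈ₚ (0# , 0#)
    C≈0 = norm²≈0⇒≈0 C (x*y≈0⇒y≈0 (0<⇒≉0 0<2) CC≈0)

  inStrip⇒acute : ∀ p q x → InStrip p q x → Acute p q x × Acute q p x
  inStrip⇒acute (p₁ , p₂) (q₁ , q₂) (x₁ , x₂) (above , below) =
    0≤-resp (solve 6 (λ p₁ p₂ q₁ q₂ x₁ x₂ →
      (x₁ :* (q₁ :- p₁) :+ x₂ :* (q₂ :- p₂)) :- (p₁ :* (q₁ :- p₁) :+ p₂ :* (q₂ :- p₂)) :=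
      (x₁ :- p₁) :* (q₁ :- p₁) :+ (x₂ :- p₂) :* (q₂ :- p₂)) refl p₁ p₂ q₁ q₂ x₁ x₂) (≤⇒0≤- above) ,
    0≤-resp (solve 6 (λ p₁ p₂ q₁ q₂ x₁ x₂ →
      (q₁ :* (q₁ :- p₁) :+ q₂ :* (q₂ :- p₂)) :- (x₁ :* (q₁ :- p₁) :+ x₂ :* (q₂ :- p₂)) :=
      (x₁ :- q₁) :* (p₁ :- q₁) :+ (x₂ :- q₂) :* (p₂ :- q₂)) refl p₁ p₂ q₁ q₂ x₁ x₂) (≤⇒0≤- below)

  acute⇒inStrip : ∀ p q x → Acute p q x → Acute q p x → InStrip p q x
  acute⇒inStrip (p₁ , p₂) (q₁ , q₂) (x₁ , x₂) pqx qpx =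
    0≤-⇒≤ (0≤-resp (solve 6 (λ p₁ p₂ q₁ q₂ x₁ x₂ →
      (x₁ :- p₁) :* (q₁ :- p₁) :+ (x₂ :- p₂) :* (q₂ :- p₂) :=
      (x₁ :* (q₁ :- p₁) :+ x₂ :* (q₂ :- p₂)) :- (p₁ :* (q₁ :- p₁) :+ p₂ :* (q₂ :- p₂)))
      refl p₁ p₂ q₁ q₂ x₁ x₂) pqx) ,
    0≤-⇒≤ (0≤-resp (solve 6 (λ p₁ p₂ q₁ q₂ x₁ x₂ →
      (x₁ :- q₁) :* (p₁ :- q₁) :+ (x₂ :- q₂) :* (p₂ :- q₂) :=
      (q₁ :* (q₁ :- p₁) :+ q₂ :* (q₂ :- p₂)) :- (x₁ :* (q₁ :- p₁) :+ x₂ :* (q₂ :- p₂)))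
      refl p₁ p₂ q₁ q₂ x₁ x₂) qpx)

-- Pigeonhole arguments for lists.

lookup-injective : ∀ {a ℓ} {A : Set a} {_≈_ : Rel A ℓ} → Symmetric _≈_ →
  ∀ {xs} → AllPairs (λ x y → ¬ (x ≈ y)) xs → ∀ {i j} → lookup xs i ≈ lookup xs j → i ≡ j
lookup-injective sym (_ ∷ _)  {zero}  {zero}  _  = ≡.refl
lookup-injective sym (x∉ ∷ _) {zero}  {suc j} eq = contradiction eq (All.lookup x∉ (Mem.∈-lookup j))
lookup-injective sym (x∉ ∷ _) {suc i} {zero}  eq = contradiction (sym eq) (All.lookup x∉ (Mem.∈-lookup i))
lookup-injective sym (_ ∷ u)  {suc i} {suc j} eq = ≡.cong suc (lookup-injective sym u eq)

module _ {a} {A : Set a} where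

  unique⇒length-≤ : ∀ {xs ys : List A} → Propositional.Unique xs → (∀ {x} → x ∈ₗ xs → x ∈ₗ ys) →
    length xs ℕ.≤ length ys
  unique⇒length-≤ {xs} {ys} xs! xs⊆ys = Fin.injective⇒≤ {f = position} λ {i} {j} eq → lookup-injective ≡.sym xs!
    (≡.trans (Any.lookup-index (xs⊆ys (Mem.∈-lookup i)))
      (≡.trans (≡.cong (lookup ys) eq) (≡.sym (Any.lookup-index (xs⊆ys (Mem.∈-lookup j))))))
    where
    position : Fin (length xs) → Fin (length ys)
    position i = index (xs⊆ys (Mem.∈-lookup {xs = xs} i))

length-cartesianProduct : ∀ {a b} {A : Set a} {B : Set b} (xs : List A) (ys : List B) →
  length (cartesianProduct xs ys) ≡ length xs ℕ.* length ys
length-cartesianProduct []       ys = ≡.refl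
length-cartesianProduct (x ∷ xs) ys = ≡.trans (List.length-++ (map (x ,_) ys))
  (≡.cong₂ ℕ._+_ (List.length-map (x ,_) ys) (length-cartesianProduct xs ys))

module _ {a c r} {A : Set a} {C : Set c} (R : A → C → Set r)
  (injective : ∀ {x y d} → R x d → R y d → x ≡ y) where
  private
    images : ∀ {xs} → All (λ x → ∃ (R x)) xs → List C
    images []              = []
    images ((d , _) ∷ pxs) = d ∷ images pxs

    length-images : ∀ {xs} (pxs : All (λ x → ∃ (R x)) xs) → length (images pxs) ≡ length xs
    length-images []        = ≡.refl
    length-images (_ ∷ pxs) = ≡.cong ℕ.suc (length-images pxs)

    ∈-images : ∀ {xs} (pxs : All (λ x → ∃ (R x)) xs) {d} → d ∈ₗ images pxs → ∃[ x ] x ∈ₗ xs × R x d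
    ∈-images ((_ , r) ∷ _) (here ≡.refl) = _ , here ≡.refl , r
    ∈-images (_ ∷ pxs)     (there d∈)    with ∈-images pxs d∈
    ... | x , x∈xs , r = x , there x∈xs , r

    images! : ∀ {xs} (pxs : All (λ x → ∃ (R x)) xs) → Propositional.Unique xs → Propositional.Unique (images pxs)
    images! []              _         = []
    images! ((d , r) ∷ pxs) (x∉ ∷ xs!) = All.tabulate fresh ∷ images! pxs xs!
      where
      fresh : ∀ {e} → e ∈ₗ images pxs → d ≢ e
      fresh e∈ ≡.refl with ∈-images pxs e∈
      ... | y , y∈xs , r′ = All.lookup x∉ y∈xs (injective r r′)

  -- The chosen images of `xs` and the missed values `zs` are disjoint parts of `ys` without
  -- repetitions. A relation in place of a function allows the same injection to be used from darts
  -- to tokens and back.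
  pigeonhole : ∀ {xs ys zs} → Propositional.Unique xs → Propositional.Unique zs →
    (∀ {x} → x ∈ₗ xs → ∃ (R x)) → (∀ {x d} → x ∈ₗ xs → R x d → d ∈ₗ ys) →
    (∀ {d} → d ∈ₗ zs → d ∈ₗ ys) → (∀ {x d} → x ∈ₗ xs → d ∈ₗ zs → ¬ R x d) →
    length xs ℕ.+ length zs ℕ.≤ length ys
  pigeonhole {xs} {ys} {zs} xs! zs! total R⊆ys zs⊆ys missed = ≡.subst (ℕ._≤ length ys)
    (≡.trans (List.length-++ (images pxs)) (≡.cong (ℕ._+ length zs) (length-images pxs)))
    (unique⇒length-≤ (Unique.++⁺ (images! pxs xs!) zs! disjoint) included)
    where
    pxs : All (λ x → ∃ (R x)) xs
    pxs = All.tabulate total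
    disjoint : ∀ {d} → ¬ (d ∈ₗ images pxs × d ∈ₗ zs)
    disjoint (d∈ , d∈zs) with ∈-images pxs d∈
    ... | x , x∈xs , r = missed x∈xs d∈zs r
    included : ∀ {d} → d ∈ₗ images pxs ++ zs → d ∈ₗ ys
    included d∈ with Mem.∈-++⁻ (images pxs) d∈
    ... | inj₂ d∈zs = zs⊆ys d∈zs
    ... | inj₁ d∈im with ∈-images pxs d∈im
    ...   | x , x∈xs , r = R⊆ys x∈xs r

-- Otherwise the images of the members together with `u` would be one more than the members.
self-injection-misses-nothing : ∀ {n p} {P : Pred (Fin n) p} → Decidable P → (f : Fin n → Fin n) →
  (∀ {x} → P x → P (f x)) → (∀ {x y} → P x → P y → f x ≡ f y → x ≡ y) →
  ∀ {u} → P u → ¬ (∀ {x} → P x → f x ≢ u)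
self-injection-misses-nothing {n} {P = P} P? f closed injective {u} Pu missed =
  ℕP.1+n≰n (≡.subst (ℕ._≤ length members) (ℕP.+-comm _ 1)
    (pigeonhole (λ x y → P x × f x ≡ y) (λ (Px , fx≡d) (Py , fy≡d) → injective Px Py (≡.trans fx≡d (≡.sym fy≡d)))
      (Unique.filter⁺ P? (Unique.allFin⁺ n)) ([] ∷ [])
      (λ x∈ → f _ , proj₂ (Mem.∈-filter⁻ P? {xs = allFin n} x∈) , ≡.refl)
      (λ { _ (Px , ≡.refl) → member (closed Px) })
      (λ { (here ≡.refl) → member Pu })
      (λ { _ (here ≡.refl) (Px , fx≡u) → missed Px fx≡u })))
  where
  members : List (Fin n)
  members = filter P? (allFin n)
  member : ∀ {x} → P x → x ∈ₗ members
  member Px = Mem.∈-filter⁺ P? (Mem.∈-allFin _) Px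

-- Graphs with ordered neighbourhoods and the counting of their darts.

module _ {n : ℕ} {e : Level} {Edge : Fin n → Fin n → Set e} (edge? : ∀ p q → Dec (Edge p q)) where

  -- Every edge is listed in both directions, so that the bound on the edges becomes three darts per
  -- vertex.
  darts : List (Fin n × Fin n)
  darts = filter (λ (p , q) → edge? p q) (cartesianProduct (allFin n) (allFin n))

  darts! : Propositional.Unique darts
  darts! = Unique.filter⁺ (λ (p , q) → edge? p q) (Unique.cartesianProduct⁺ (Unique.allFin⁺ n) (Unique.allFin⁺ n))

  ∈-darts⁺ : ∀ {p q} → Edge p q → (p , q) ∈ₗ darts
  ∈-darts⁺ = Mem.∈-filter⁺ (λ (p , q) → edge? p q) (Mem.∈-cartesianProduct⁺ (Mem.∈-allFin _) (Mem.∈-allFin _))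

  ∈-darts⁻ : ∀ {p q} → (p , q) ∈ₗ darts → Edge p q
  ∈-darts⁻ pq∈ = proj₂ (Mem.∈-filter⁻ (λ (p , q) → edge? p q) {xs = cartesianProduct (allFin n) (allFin n)} pq∈)

-- A graph with its neighbourhoods ordered from right to left; the condition left-unique
-- expresses that a disjoint pair of edges determines a rectangle.
record Rotation {n : ℕ} {e : Level} {Edge : Fin n → Fin n → Set e}
                (edge? : ∀ p q → Dec (Edge p q)) (l : Level) : Set (e Level.⊔ Level.suc l) where
  field
    edge-sym    : ∀ {p q} → Edge p q → Edge q p
    Left        : Fin n → Fin n → Fin n → Set l
    left?       : ∀ p q r → Dec (Left p q r)
    left-irrefl : ∀ {p q} → ¬ Left p q q
    left-trans  : ∀ {p q r s} → Edge p q → Edge p r → Edge p s → Left p q r → Left p r s → Left p q s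
    left-total  : ∀ {p q r} → Edge p q → Edge p r → q ≢ r → Left p q r ⊎ Left p r q
    left-unique : ∀ {p q r r′ s} → Edge p q → Edge p r → Edge p r′ → Edge q s →
                  Left p q r → Left p q r′ → Left q p s → r ≡ r′

  Leftmost : Fin n → Fin n → Set (e Level.⊔ l)
  Leftmost p q = Edge p q × (∀ r → Edge p r → ¬ Left p q r)

  Matched : Fin n → Fin n → Set (e Level.⊔ l)
  Matched p q = Edge p q × ¬ Leftmost p q × ¬ Leftmost q p

  leftmost? : ∀ p q → Dec (Leftmost p q)
  leftmost? p q = edge? p q ×-dec Fin.all? (λ r → edge? p r →-dec ¬? (left? p q r))

  matched? : ∀ p q → Dec (Matched p q)
  matched? p q = edge? p q ×-dec (¬? (leftmost? p q) ×-dec ¬? (leftmost? q p))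

  matched-sym : ∀ {p q} → Matched p q → Matched q p
  matched-sym (e , ¬pq , ¬qp) = edge-sym e , ¬qp , ¬pq

  leftmost-unique : ∀ {p q r} → Leftmost p q → Leftmost p r → q ≡ r
  leftmost-unique {p} {q} {r} (pq , ¬q) (pr , ¬r) with q Fin.≟ r
  ... | yes q≡r = q≡r
  ... | no  q≢r with left-total pq pr q≢r
  ...   | inj₁ left = contradiction left (¬q r pr)
  ...   | inj₂ left = contradiction left (¬r q pq)

  leftmost-exists : ∀ {p q} → Edge p q → ∃ (Leftmost p)
  leftmost-exists {p} {q} pq with search (allFin n)
    where
    search : ∀ xs → ∃[ r ] Edge p r × (∀ {s} → s ∈ₗ xs → Edge p s → ¬ Left p r s)
    search []       = q , pq , λ ()
    search (x ∷ xs) with search xs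
    ... | r , pr , best with edge? p x ×-dec left? p r x
    ...   | yes (px , left) = x , px , λ
      { (here ≡.refl) _ → left-irrefl
      ; (there s∈xs) ps left′ → best s∈xs ps (left-trans pr px ps left left′) }
    ...   | no  ¬left       = r , pr , λ
      { (here ≡.refl) ps left′ → ¬left (ps , left′)
      ; (there s∈xs) → best s∈xs }
  ... | r , pr , best = r , pr , λ s → best (Mem.∈-allFin s)

  ¬leftmost⇒left : ∀ {p q} → Edge p q → ¬ Leftmost p q → ∃[ r ] Edge p r × Left p q r
  ¬leftmost⇒left {p} {q} pq ¬leftmost with Fin.any? (λ r → edge? p r ×-dec left? p q r)
  ... | yes found = found
  ... | no  none  = contradiction (pq , λ r pr left → none (r , pr , left)) ¬leftmost

  -- An edge further to the left would complete, with the same edge at `q`, a second rectangle on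
  -- pq, and `left-unique` identifies the two.
  left-of-matched⇒leftmost : ∀ {p q r} → Matched p q → Edge p r → Left p q r → Leftmost p r
  left-of-matched⇒leftmost {p} {q} {r} (pq , _ , ¬qp) pr left with ¬leftmost⇒left (edge-sym pq) ¬qp
  ... | s , qs , left-s = pr , λ r′ pr′ left′ → left-irrefl (≡.subst (Left p r)
    (≡.sym (left-unique pq pr pr′ qs left (left-trans pq pr pr′ left left′) left-s)) left′)

  matched⇒left : ∀ {p q r} → Matched p q → Leftmost p r → Left p q r
  matched⇒left {p} {q} m@(pq , ¬pq , _) leftmost with ¬leftmost⇒left pq ¬pq
  ... | r′ , pr′ , left = ≡.subst (Left p q) (leftmost-unique (left-of-matched⇒leftmost m pr′ left) leftmost) left

  -- Of two matched edges at `p` one would lie to the left of the other and so be leftmost.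
  matched-unique : ∀ {p q r} → Matched p q → Matched p r → q ≡ r
  matched-unique {p} {q} {r} m@(pq , ¬pq , _) m′@(pr , ¬pr , _) with q Fin.≟ r
  ... | yes q≡r = q≡r
  ... | no  q≢r with left-total pq pr q≢r
  ...   | inj₁ left = contradiction (left-of-matched⇒leftmost m pr left) ¬pr
  ...   | inj₂ left = contradiction (left-of-matched⇒leftmost m′ pq left) ¬pq

  edge-cases : ∀ {p q} → Edge p q → Leftmost p q ⊎ Leftmost q p ⊎ Matched p q
  edge-cases {p} {q} pq with leftmost? p q | leftmost? q p
  ... | yes l | _     = inj₁ l
  ... | no _  | yes l = inj₂ (inj₁ l)
  ... | no ¬l | no ¬r = inj₂ (inj₂ (pq , ¬l , ¬r))

  Dart Token : Set
  Dart  = Fin n × Fin n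
  Token = Fin n × Fin 3

  tokens : List Token
  tokens = cartesianProduct (allFin n) (allFin 3)

  private
    -- If the edge is leftmost at both ends, the smaller end owns it, so that no edge has two
    -- owners.
    Owns : Fin n → Fin n → Set (e Level.⊔ l)
    Owns p q = Leftmost p q × (Leftmost q p → p Fin.< q)

    -- A vertex has one token for each direction of its leftmost edge and one for its matched edge.
    data Takes : Dart → Token → Set (e Level.⊔ l) where
      forth   : ∀ {p q} → Owns p q    → Takes (p , q) (p , zero)
      back    : ∀ {p q} → Owns q p    → Takes (p , q) (q , suc zero)
      matched : ∀ {p q} → Matched p q → Takes (p , q) (p , suc (suc zero))

    takes-edge : ∀ {p q t} → Takes (p , q) t → Edge p q
    takes-edge (forth ((pq , _) , _)) = pq
    takes-edge (back ((qp , _) , _))  = edge-sym qp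
    takes-edge (matched (pq , _))     = pq

    takes-injective : ∀ {d d′ t} → Takes d t → Takes d′ t → d ≡ d′
    takes-injective (forth (l , _)) (forth (l′ , _)) = ≡.cong (_ ,_) (leftmost-unique l l′)
    takes-injective (back (l , _))  (back (l′ , _))  = ≡.cong (_, _) (leftmost-unique l l′)
    takes-injective (matched m)     (matched m′)     = ≡.cong (_ ,_) (matched-unique m m′)

    takes-functional : ∀ {d t t′} → Takes d t → Takes d t′ → t ≡ t′
    takes-functional (forth _) (forth _) = ≡.refl
    takes-functional (back _) (back _) = ≡.refl
    takes-functional (matched _) (matched _) = ≡.refl
    takes-functional (forth (l , p<q)) (back (l′ , q<p)) = contradiction (q<p l) (Fin.<-asym (p<q l′))
    takes-functional (back (l , q<p)) (forth (l′ , p<q)) = contradiction (q<p l′) (Fin.<-asym (p<q l))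
    takes-functional (forth (l , _)) (matched (_ , ¬l , _)) = contradiction l ¬l
    takes-functional (matched (_ , ¬l , _)) (forth (l , _)) = contradiction l ¬l
    takes-functional (back (l , _)) (matched (_ , _ , ¬l)) = contradiction l ¬l
    takes-functional (matched (_ , _ , ¬l)) (back (l , _)) = contradiction l ¬l

  edge-irrefl : (∀ {p} → ¬ Edge p p) → ∀ {p q} → Edge p q → p ≢ q
  edge-irrefl irrefl pq ≡.refl = irrefl pq

  module Counting (irrefl : ∀ {p} → ¬ Edge p p) where
    private
      takes-total : ∀ {p q} → Edge p q → ∃ (Takes (p , q))
      takes-total {p} {q} pq with leftmost? p q | leftmost? q p
      ... | yes l | no ¬r = _ , forth (l , λ r → contradiction r ¬r)
      ... | no ¬l | yes r = _ , back (r , λ l → contradiction l ¬l)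
      ... | no ¬l | no ¬r = _ , matched (pq , ¬l , ¬r)
      ... | yes l | yes r with Fin.<-cmp p q
      ...   | tri< p<q _ _ = _ , forth (l , λ _ → p<q)
      ...   | tri≈ _ p≡q _ = contradiction p≡q (edge-irrefl irrefl pq)
      ...   | tri> _ _ q<p = _ , back (r , λ _ → q<p)

      ∈-tokens : ∀ t → t ∈ₗ tokens
      ∈-tokens (p , i) = Mem.∈-cartesianProduct⁺ (Mem.∈-allFin p) (Mem.∈-allFin i)

      length-tokens : length tokens ≡ n ℕ.* 3
      length-tokens = ≡.trans (length-cartesianProduct (allFin n) (allFin 3))
        (≡.cong (ℕ._* 3) (List.length-tabulate {n = n} (λ i → i)))

      count : ∀ {zs} → Propositional.Unique zs → (∀ {d t} → t ∈ₗ zs → ¬ Takes d t) →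
        length (darts edge?) ℕ.+ length zs ℕ.≤ n ℕ.* 3
      count {zs} zs! missed = ≡.subst (length (darts edge?) ℕ.+ length zs ℕ.≤_) length-tokens
        (pigeonhole Takes takes-injective (darts! edge?) zs!
        (λ d∈ → takes-total (∈-darts⁻ edge? d∈)) (λ _ _ → ∈-tokens _) (λ _ → ∈-tokens _) (λ _ → missed))

      two-missed : ∀ {s t} → s ≢ t → (∀ {d} → ¬ Takes d s) → (∀ {d} → ¬ Takes d t) →
        length (darts edge?) ℕ.+ 2 ℕ.≤ n ℕ.* 3
      two-missed s≢t ¬s ¬t = count ((s≢t ∷ []) ∷ [] ∷ [])
        λ { (here ≡.refl) → ¬s ; (there (here ≡.refl)) → ¬t }

    length-darts≤ : length (darts edge?) ℕ.≤ n ℕ.* 3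
    length-darts≤ = ≡.subst (ℕ._≤ n ℕ.* 3) (ℕP.+-identityʳ _) (count [] (λ ()))

    -- A vertex without a matched edge leaves its third token free.
    perfect : n ℕ.* 3 ℕ.≤ length (darts edge?) → ∀ p → ∃ (Matched p)
    perfect many p with Fin.any? (matched? p)
    ... | yes m    = m
    ... | no  none = contradiction (ℕP.≤-trans (≡.subst (ℕ._≤ n ℕ.* 3) (ℕP.+-comm _ 1)
      (count {(p , suc (suc zero)) ∷ []} ([] ∷ []) λ { (here ≡.refl) (matched m) → none (_ , m) })) many) ℕP.1+n≰n

    -- At most one token is free here, so every situation with two free tokens is excluded.
    module AlmostFull (many : n ℕ.* 3 ℕ.≤ ℕ.suc (length (darts edge?))) where
      private
        ¬two-missed : ¬ (length (darts edge?) ℕ.+ 2 ℕ.≤ n ℕ.* 3)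
        ¬two-missed le = ℕP.1+n≰n (ℕP.≤-trans (≡.subst (ℕ._≤ n ℕ.* 3) (ℕP.+-comm _ 2) le) many)

        not-owner : ∀ {p q x} → p Fin.< q → Leftmost p q → Leftmost q p → ¬ Owns q x
        not-owner p<q l r (r′ , q<x) with leftmost-unique r r′
        ... | ≡.refl = Fin.<-asym p<q (q<x l)

      -- The larger of the two ends would own no edge, and its first two tokens would be free.
      not-leftmost-twice : ∀ {p q} → Leftmost p q → ¬ Leftmost q p
      not-leftmost-twice {p} {q} l r with Fin.<-cmp p q
      ... | tri≈ _ p≡q _ = edge-irrefl irrefl (proj₁ l) p≡q
      ... | tri< p<q _ _ = ¬two-missed (two-missed {q , zero} {q , suc zero} (λ ())
        (λ { (forth o) → not-owner p<q l r o }) (λ { (back o) → not-owner p<q l r o }))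
      ... | tri> _ _ q<p = ¬two-missed (two-missed {p , zero} {p , suc zero} (λ ())
        (λ { (forth o) → not-owner q<p r l o }) (λ { (back o) → not-owner q<p r l o }))

      leftmost : ∀ p → ∃ (Leftmost p)
      leftmost p with Fin.any? (edge? p)
      ... | yes (q , pq) = leftmost-exists pq
      ... | no  none     = contradiction (two-missed {p , zero} {p , suc zero} (λ ())
        (λ { (forth ((pq , _) , _)) → none (_ , pq) }) (λ { (back ((pq , _) , _)) → none (_ , pq) })) ¬two-missed

      unmatched-unique : ∀ {p q} → ¬ ∃ (Matched p) → ¬ ∃ (Matched q) → p ≡ q
      unmatched-unique {p} {q} ¬p ¬q with p Fin.≟ q
      ... | yes p≡q = p≡q
      ... | no  p≢q = contradiction (two-missed {p , suc (suc zero)} {q , suc (suc zero)} (λ { ≡.refl → p≢q ≡.refl })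
        (λ { (matched m) → ¬p (_ , m) }) (λ { (matched m) → ¬q (_ , m) })) ¬two-missed

      -- If every vertex were matched, every token would be taken; read backwards, the injection
      -- would give at least three darts per vertex.
      unmatched-exists : length (darts edge?) ℕ.< n ℕ.* 3 → ∃[ p ] ¬ ∃ (Matched p)
      unmatched-exists few with Fin.any? (λ p → ¬? (Fin.any? (matched? p)))
      ... | yes found = found
      ... | no  none  = contradiction (≡.subst₂ ℕ._≤_ (≡.trans (ℕP.+-identityʳ _) length-tokens) ≡.refl
        (pigeonhole (λ t d → Takes d t) takes-functional
          (Unique.cartesianProduct⁺ (Unique.allFin⁺ n) (Unique.allFin⁺ 3)) []
          (λ {t} _ → attained t) (λ _ takes → ∈-darts⁺ edge? (takes-edge takes)) (λ ()) (λ _ ()))) (ℕP.<⇒≱ few)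
        where
        owns : ∀ {p q} → Leftmost p q → Owns p q
        owns l = l , λ r → contradiction r (not-leftmost-twice l)
        attained : ∀ t → ∃[ d ] Takes d t
        attained (p , zero)           = _ , forth (owns (proj₂ (leftmost p)))
        attained (p , suc zero)       = _ , back (owns (proj₂ (leftmost p)))
        attained (p , suc (suc zero)) with Fin.any? (matched? p)
        ... | yes (_ , m) = _ , matched m
        ... | no  ¬m      = contradiction (p , ¬m) none

-- Unordered pairs of list entries.

length-filter-map : ∀ {a b p} {A : Set a} {B : Set b} {P : Pred B p} (P? : Decidable P) (f : A → B) xs →
  length (filter P? (map f xs)) ≡ length (filter (λ x → P? (f x)) xs)
length-filter-map P? f []       = ≡.refl
length-filter-map P? f (x ∷ xs) with P? (f x)
... | yes _ = ≡.cong ℕ.suc (length-filter-map P? f xs)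
... | no  _ = length-filter-map P? f xs

module _ {a} {A : Set a} where

  unorderedPairs-map : ∀ {b} {B : Set b} (f : A → B) xs →
    unorderedPairs (map f xs) ≡ map (λ (x , y) → f x , f y) (unorderedPairs xs)
  unorderedPairs-map f []       = ≡.refl
  unorderedPairs-map f (x ∷ xs) = ≡.trans
    (≡.cong₂ _++_ (≡.trans (≡.sym (List.map-∘ xs)) (List.map-∘ xs)) (unorderedPairs-map f xs))
    (≡.sym (List.map-++ _ (map (x ,_) xs) (unorderedPairs xs)))

  ∈-unorderedPairs⁻ : ∀ {r} {R : Rel A r} {xs} → AllPairs R xs →
    ∀ {x y} → (x , y) ∈ₗ unorderedPairs xs → x ∈ₗ xs × R x y
  ∈-unorderedPairs⁻ {xs = x ∷ xs} (Rx ∷ Rxs) xy∈ with Mem.∈-++⁻ (map (x ,_) xs) xy∈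
  ... | inj₂ xy∈xs = let x∈ , Rxy = ∈-unorderedPairs⁻ Rxs xy∈xs in there x∈ , Rxy
  ... | inj₁ xy∈x with Mem.∈-map⁻ (x ,_) xy∈x
  ...   | _ , y∈xs , ≡.refl = here ≡.refl , All.lookup Rx y∈xs

  ∈-unorderedPairs⁺ : ∀ {xs} {x y : A} → x ∈ₗ xs → y ∈ₗ xs → x ≢ y →
    (x , y) ∈ₗ unorderedPairs xs ⊎ (y , x) ∈ₗ unorderedPairs xs
  ∈-unorderedPairs⁺ (here ≡.refl) (here ≡.refl) x≢y = contradiction ≡.refl x≢y
  ∈-unorderedPairs⁺ (here ≡.refl) (there y∈)    _   = inj₁ (Mem.∈-++⁺ˡ (Mem.∈-map⁺ _ y∈))
  ∈-unorderedPairs⁺ (there x∈)    (here ≡.refl) _   = inj₂ (Mem.∈-++⁺ˡ (Mem.∈-map⁺ _ x∈))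
  ∈-unorderedPairs⁺ {z ∷ xs} (there x∈) (there y∈) x≢y with ∈-unorderedPairs⁺ x∈ y∈ x≢y
  ... | inj₁ xy∈ = inj₁ (Mem.∈-++⁺ʳ (map (z ,_) xs) xy∈)
  ... | inj₂ yx∈ = inj₂ (Mem.∈-++⁺ʳ (map (z ,_) xs) yx∈)

  unorderedPairs! : ∀ {xs : List A} → Propositional.Unique xs → Propositional.Unique (unorderedPairs xs)
  unorderedPairs! []                     = []
  unorderedPairs! {x ∷ xs} (x∉ ∷ xs!) = Unique.++⁺ (Unique.map⁺ (λ { ≡.refl → ≡.refl }) xs!) (unorderedPairs! xs!) disjoint
    where
    disjoint : ∀ {d} → ¬ (d ∈ₗ map (x ,_) xs × d ∈ₗ unorderedPairs xs)
    disjoint (d∈ , d∈′) with Mem.∈-map⁻ (x ,_) d∈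
    ... | _ , _ , ≡.refl = All.lookup x∉ (proj₁ (∈-unorderedPairs⁻ xs! d∈′)) ≡.refl

-- The graph of double normals and its two rotations.

module DoubleNormals {c ℓ₁ ℓ₂} (ℝ : CompleteOrderedField c ℓ₁ ℓ₂) (V : Plane.FiniteSet ℝ) where
  open CompleteOrderedField ℝ
  open PlaneGeometry ℝ
  open Plane ℝ
  open DecSetoid pointDecSetoid using () renaming (refl to ≈ₚ-refl; sym to ≈ₚ-sym)

  n : ℕ
  n = ∣ V ∣

  v : Fin n → Point
  v = lookup (points V)

  v-injective : ∀ {i j} → v i ≈ₚ v j → i ≡ j
  v-injective = lookup-injective ≈ₚ-sym (distinct V)

  Edge : Fin n → Fin n → Set (c Level.⊔ ℓ₁ Level.⊔ ℓ₂)
  Edge i j = DoubleNormal V (v i , v j)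

  edge? : ∀ i j → Dec (Edge i j)
  edge? i j = doubleNormal? V (v i , v j)

  acuteˡ : ∀ {i j} → Edge i j → ∀ k → Acute (v i) (v j) (v k)
  acuteˡ (_ , strip) k = proj₁ (inStrip⇒acute _ _ _ (All.lookup strip (Mem.∈-lookup k)))

  acuteʳ : ∀ {i j} → Edge i j → ∀ k → Acute (v j) (v i) (v k)
  acuteʳ (_ , strip) k = proj₂ (inStrip⇒acute _ _ _ (All.lookup strip (Mem.∈-lookup k)))

  edge-sym : ∀ {i j} → Edge i j → Edge j i
  edge-sym (i≉j , strip) = (λ j≈i → i≉j (≈ₚ-sym j≈i)) ,
    All.map (λ s → let a , b = inStrip⇒acute _ _ _ s in acute⇒inStrip _ _ _ b a) strip

  edge-irrefl : ∀ {i} → ¬ Edge i i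
  edge-irrefl (i≉i , _) = i≉i ≈ₚ-refl

  module Side (σ : Carrier) (σσ≈1 : σ * σ ≈ 1#) where
    private
      module O = Orientation σ σσ≈1

    Left : Fin n → Fin n → Fin n → Set (ℓ₁ Level.⊔ ℓ₂)
    Left p q r = O.Left (v p) (v q) (v r)

    -- The strip of pr bounds the angles of the quadrilateral at `p` and `r`, and the strip of qs
    -- those at `q` and `s`.
    edges⇒rectangle : ∀ {p q r s} → Edge p q → Edge p r → Edge q s → Left p q r → Left q p s →
      Rectangle (v p) (v r) (v q) (v s)
    edges⇒rectangle {p} {q} {r} {s} pq pr qs left-r left-s = O.opposite-normals⇒rectangle (v p) (v q) (v r) (v s)
      (proj₁ pq) (acuteˡ pq r) (acuteʳ pq r) (acuteˡ pq s) (acuteʳ pq s)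
      (acuteˡ pr s) (acuteʳ pr q) (acuteˡ qs r) (acuteʳ qs p) left-r left-s

    rectangle-vertex-unique : ∀ {p q r r′ s} → Rectangle p r q s → Rectangle p r′ q s → r ≈ₚ r′
    rectangle-vertex-unique {p₁ , p₂} {q₁ , q₂} {r₁ , r₂} {r′₁ , r′₂} {s₁ , s₂} R R′ =
      cancel (trans (sym (proj₁ (centre R))) (proj₁ (centre R′))) ,
      cancel (trans (sym (proj₂ (centre R))) (proj₂ (centre R′)))
      where
      cancel : ∀ {x y z} → x + z ≈ y + z → x ≈ y
      cancel {x} {y} {z} eq = trans (solve 2 (λ x z → x := x :+ z :- z) refl x z)
        (trans (+-congʳ eq) (solve 2 (λ y z → y :+ z :- z := y) refl y z))

    rotation : Rotation edge? (ℓ₁ Level.⊔ ℓ₂)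
    rotation = record
      { edge-sym    = edge-sym
      ; Left        = Left
      ; left?       = λ p q r → (0# ≤? _) ×-dec ¬? (0# ≟ _)
      ; left-irrefl = λ {p} {q} → O.left-irrefl (v p) (v q)
      ; left-trans  = λ {p} {q} {r} {s} pq pr ps → O.orient-trans (v q -ₚ v p) (v r -ₚ v p) (v s -ₚ v p)
          (acuteˡ pr q) (acuteˡ ps r) (acuteˡ ps q)
      ; left-total  = λ {p} {q} {r} pq pr q≢r → O.left-total (v p) (v q) (v r) (proj₁ pq) (proj₁ pr)
          (acuteˡ pq r) (acuteʳ pq r) (acuteʳ pr q) (λ q≈r → q≢r (v-injective q≈r))
      ; left-unique = λ pq pr pr′ qs left left′ left-s → v-injective
          (rectangle-vertex-unique (edges⇒rectangle pq pr qs left left-s) (edges⇒rectangle pq pr′ qs left′ left-s))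
      }

    open Rotation rotation public
      hiding (edge-sym; Left; edge-irrefl; module Counting)

    matched⇒rectangle : ∀ {p q r s} → Matched p q → Leftmost p r → Leftmost q s → Rectangle (v p) (v r) (v q) (v s)
    matched⇒rectangle m r s = edges⇒rectangle (proj₁ m) (proj₁ r) (proj₁ s) (matched⇒left m r)
      (matched⇒left (matched-sym m) s)

  -- The listed index pairs are increasing, so they and their swaps are disjoint and exhaust the
  -- darts.
  length-darts : length (darts edge?) ≡ N V ℕ.* 2
  length-darts = ≡.trans (ℕP.≤-antisym
      (unique⇒length-≤ (darts! edge?) (λ {(p , q)} pq∈ → edges⁺ (∈-darts⁻ edge? pq∈)))
      (unique⇒length-≤ both! (λ {(p , q)} pq∈ → ∈-darts⁺ edge? (edges⁻ pq∈))))
    (≡.trans (List.length-++ edges) (≡.trans (≡.cong (length edges ℕ.+_) (List.length-map swap edges))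
      (≡.trans (≡.cong (λ k → k ℕ.+ k) length-edges)
        (≡.trans (≡.cong (N V ℕ.+_) (≡.sym (ℕP.+-identityʳ (N V)))) (ℕP.*-comm 2 (N V))))))
    where
    pairs edges : List (Fin n × Fin n)
    pairs = unorderedPairs (allFin n)
    edges = filter (λ (p , q) → edge? p q) pairs

    sorted : AllPairs Fin._<_ (allFin n)
    sorted = AllPairs.tabulate⁺-< (λ i<j → i<j)

    edge∈ : ∀ {p q} → (p , q) ∈ₗ edges → p Fin.< q × Edge p q
    edge∈ pq∈ with Mem.∈-filter⁻ (λ (p , q) → edge? p q) {xs = pairs} pq∈
    ... | pq∈pairs , pq = proj₂ (∈-unorderedPairs⁻ sorted pq∈pairs) , pq

    edges⁺ : ∀ {p q} → Edge p q → (p , q) ∈ₗ edges ++ map swap edges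
    edges⁺ {p} {q} pq with ∈-unorderedPairs⁺ (Mem.∈-allFin p) (Mem.∈-allFin q) (λ { ≡.refl → edge-irrefl pq })
    ... | inj₁ pq∈ = Mem.∈-++⁺ˡ (Mem.∈-filter⁺ (λ (p , q) → edge? p q) pq∈ pq)
    ... | inj₂ qp∈ = Mem.∈-++⁺ʳ edges (Mem.∈-map⁺ swap (Mem.∈-filter⁺ (λ (p , q) → edge? p q) qp∈ (edge-sym pq)))

    edges⁻ : ∀ {p q} → (p , q) ∈ₗ edges ++ map swap edges → Edge p q
    edges⁻ pq∈ with Mem.∈-++⁻ edges pq∈
    ... | inj₁ pq∈edges = proj₂ (edge∈ pq∈edges)
    ... | inj₂ pq∈swap with Mem.∈-map⁻ swap pq∈swap
    ...   | _ , qp∈ , ≡.refl = edge-sym (proj₂ (edge∈ qp∈))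

    edges! : Propositional.Unique edges
    edges! = Unique.filter⁺ (λ (p , q) → edge? p q) (unorderedPairs! (Unique.allFin⁺ n))

    both! : Propositional.Unique (edges ++ map swap edges)
    both! = Unique.++⁺ edges! (Unique.map⁺ (λ { ≡.refl → ≡.refl }) edges!) disjoint
      where
      disjoint : ∀ {d} → ¬ (d ∈ₗ edges × d ∈ₗ map swap edges)
      disjoint (d∈ , d∈′) with Mem.∈-map⁻ swap d∈′
      ... | _ , qp∈ , ≡.refl = Fin.<-asym (proj₁ (edge∈ d∈)) (proj₁ (edge∈ qp∈))

    length-edges : length edges ≡ N V
    length-edges = ≡.trans (≡.sym (length-filter-map (doubleNormal? V) (λ (p , q) → v p , v q) pairs))
      (≡.cong (λ xs → length (filter (doubleNormal? V) xs))
        (≡.trans (≡.sym (unorderedPairs-map v (allFin n)))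
          (≡.cong unorderedPairs (≡.trans (List.map-tabulate (λ i → i) v) (List.tabulate-lookup (points V))))))

-- The interplay of the left and the right matching.

record Midpoints (n : ℕ) (s : Level) : Set (Level.suc s) where
  infix 4 _≋_
  field
    -- This stands for equality of midpoints and keeps coordinates out of the combinatorial
    -- argument.
    _≋_              : Rel (Fin n × Fin n) s
    isDecEquivalence : IsDecEquivalence _≋_
    swapped          : ∀ {p q} → (p , q) ≋ (q , p)
    cancel           : ∀ {p q r} → (p , q) ≋ (p , r) → q ≡ r

  open IsDecEquivalence isDecEquivalence public
    using () renaming (refl to ≋-refl; sym to ≋-sym; trans to ≋-trans; _≟_ to _≋?_)

-- M relates the ends of each edge that is not leftmost at either end and f p is the leftmost
-- neighbour of p; M′ and g are the same for the mirror image.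
record Matching {n e m s} (Edge : Fin n → Fin n → Set e) (mid : Midpoints n s)
                (M M′ : Fin n → Fin n → Set m) (f g : Fin n → Fin n) : Set (e Level.⊔ m Level.⊔ s) where
  open Midpoints mid
  field
    matched?   : ∀ p q → Dec (M p q)
    sym        : ∀ {p q} → M p q → M q p
    unique     : ∀ {p q r} → M p q → M p r → q ≡ r
    irrefl     : ∀ {p q} → M p q → p ≢ q
    edge       : ∀ {p q} → M p q → Edge p q
    edge-cases : ∀ {p q} → Edge p q → f p ≡ q ⊎ f q ≡ p ⊎ M p q
    f≢         : ∀ {p q} → M p q → f p ≢ q
    g∘f        : ∀ {p q} → M p q → g (f p) ≡ p
    -- The left rectangle on pq and the right one on the pair of `f p` and `t` share a side and
    -- therefore agree.
    partner    : ∀ {p q t} → M p q → M′ (f p) t → f q ≡ t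
    midpoint   : ∀ {p q} → M p q → (p , q) ≋ (f p , f q)

module Interplay {n e m s} {Edge : Fin n → Fin n → Set e} {mid : Midpoints n s}
  {M M′ : Fin n → Fin n → Set m} {f g : Fin n → Fin n}
  (A : Matching Edge mid M M′ f g) (B : Matching Edge mid M′ M g f) where
  open Midpoints mid
  open Matching A
  private
    module B = Matching B

  -- If the edge were extreme at `p` for the mirror image, that is `g p ≡ q`, then `f q ≡ p` because
  -- `p` has a partner in `M′`; but a pair in `M` is leftmost at neither end.
  matched-mirror : ∀ {p q} → M p q → ∃ (M′ p) → ∃ (M′ q) → M′ p q
  matched-mirror m (s , p-s) (t , q-t) with B.edge-cases (edge m)
  ... | inj₂ (inj₂ m′) = m′
  ... | inj₁ ≡.refl    = contradiction (B.g∘f p-s) (f≢ (sym m))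
  ... | inj₂ (inj₁ ≡.refl) = contradiction (B.g∘f q-t) (f≢ m)

  -- Otherwise f p = u would be the partner of f q in M′.
  f-avoids-unmatched : ∀ {p q u} → (∀ x → x ≢ u → ∃ (M′ x)) → ¬ ∃ (M′ u) → M p q → f p ≢ u
  f-avoids-unmatched {p} {q} {u} others ¬u m ≡.refl with others (f q) (λ fq≡u → irrefl m
    (≡.trans (≡.sym (g∘f m)) (≡.trans (≡.cong g (≡.sym fq≡u)) (g∘f (sym m)))))
  ... | t , m′ with partner (sym m) m′
  ...   | ≡.refl = ¬u (f q , B.sym m′)

  partners : ∀ {p q t} → M p q → M′ (f p) t → M′ (f p) (f q)
  partners m m′ with partner m m′
  ... | ≡.refl = m′

module _ {n e m s} {Edge : Fin n → Fin n → Set e} {mid : Midpoints n s}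
  {M M′ : Fin n → Fin n → Set m} {f g : Fin n → Fin n}
  (A : Matching Edge mid M M′ f g) (B : Matching Edge mid M′ M g f)
  (edge-sym : ∀ {p q} → Edge p q → Edge q p)
  (f-edge : ∀ p → Edge p (f p)) (f∘f≢ : ∀ p → f (f p) ≢ p)
  (beside : ∀ {p q r} → M p q → M′ p q → Edge p r → q ≢ r → f p ≡ r ⊎ g p ≡ r)
  {v u : Fin n} (others : ∀ x → x ≢ v → ∃ (M x)) (others′ : ∀ x → x ≢ u → ∃ (M′ x))
  (¬v : ¬ ∃ (M v)) (¬u : ¬ ∃ (M′ u)) where
  open Midpoints mid
  open Matching A
  private
    module B = Matching B
    module AB = Interplay A B
    module BA = Interplay B A

    M⇒≢v : ∀ {p q} → M p q → p ≢ v
    M⇒≢v m ≡.refl = ¬v (_ , m)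

    -- The vertex `f v` and its partner are matched on both sides, and the edge back to `v` lies
    -- beside this pair. So `v` is `f (f v)`, against `f∘f≢`, or `g (f v)`, although `g` avoids the
    -- vertex without partner in `M`.
    same : v ≡ u → ⊥
    same ≡.refl with others (f v) fv≢v
      where
      fv≢v : f v ≢ v
      fv≢v eq = f∘f≢ v (≡.trans (≡.cong f eq) eq)
    ... | q , m with beside m (AB.matched-mirror m (others′ (f v) (M⇒≢v m)) (others′ q (M⇒≢v (sym m))))
                      (edge-sym (f-edge v)) (M⇒≢v (sym m))
    ...   | inj₁ ffv≡v = f∘f≢ v ffv≡v
    ...   | inj₂ gfv≡v with others′ (f v) (M⇒≢v m)
    ...     | _ , m′ = BA.f-avoids-unmatched others ¬v m′ gfv≡v

    different : v ≢ u → ⊥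
    different v≢u with others u (λ u≡v → v≢u (≡.sym u≡v)) | others′ v v≢u
    ... | w , u-w | w′ , v-w′ = self-injection-misses-nothing inClass? f closed injective (w , u-w , ≋-refl)
            (λ (q , m , _) → AB.f-avoids-unmatched others′ ¬u m)
      where
      -- If the partner `x` of `w′` in `M` were not `u`, it would also be the partner in `M′`, which
      -- is `v`; but `v` has no partner in `M`.
      w≡w′ : w ≡ w′
      w≡w′ with others w′ (λ { ≡.refl → B.irrefl v-w′ ≡.refl })
      ... | x , w′-x with x Fin.≟ u
      ...   | yes ≡.refl = unique u-w (sym w′-x)
      ...   | no  x≢u    = contradiction
        (B.unique (AB.matched-mirror w′-x (v , B.sym v-w′) (others′ x x≢u)) (B.sym v-w′))
        (λ { ≡.refl → ¬v (w′ , sym w′-x) })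

      InClass : Fin n → Set (m Level.⊔ s)
      InClass p = ∃[ q ] M p q × (p , q) ≋ (u , w)

      inClass? : ∀ p → Dec (InClass p)
      inClass? p = Fin.any? (λ q → matched? p q ×-dec ((p , q) ≋? (u , w)))

      injective : ∀ {p q} → InClass p → InClass q → f p ≡ f q → p ≡ q
      injective (_ , m , _) (_ , m′ , _) eq = ≡.trans (≡.sym (g∘f m)) (≡.trans (≡.cong g eq) (g∘f m′))

      -- The partner of `v` in `M′` is `w`, and vw and uw have different midpoints. This keeps `f`
      -- on the class away from `v`.
      v-v-w : ∀ {x} → M′ v x → ¬ (v , x) ≋ (u , w)
      v-v-w v-x ≋uw with B.unique v-x v-w′ | w≡w′
      ... | ≡.refl | ≡.refl = v≢u (cancel (≋-trans swapped (≋-trans ≋uw swapped)))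

      -- `f p` and `f q` are partners in `M′` with the old midpoint; they are partners in `M` too as
      -- soon as both avoid `v`.
      closed : ∀ {p} → InClass p → InClass (f p)
      closed {p} (q , m , ≋uw) = f q , BA.matched-mirror fp-fq (others (f p) fp≢v) (others (f q) fq≢v) , ≋uw′
        where
        fp-fq : M′ (f p) (f q)
        fp-fq = AB.partners m (proj₂ (others′ (f p) (AB.f-avoids-unmatched others′ ¬u m)))
        ≋uw′ : (f p , f q) ≋ (u , w)
        ≋uw′ = ≋-trans (≋-sym (midpoint m)) ≋uw
        fp≢v : f p ≢ v
        fp≢v eq = v-v-w (≡.subst (λ x → M′ x (f q)) eq fp-fq) (≡.subst (λ x → (x , f q) ≋ (u , w)) eq ≋uw′)
        fq≢v : f q ≢ v
        fq≢v eq = v-v-w (≡.subst (λ x → M′ x (f p)) eq (B.sym fp-fq))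
          (≡.subst (λ x → (x , f p) ≋ (u , w)) eq (≋-trans swapped ≋uw′))

  one-unmatched-vertex-impossible : ⊥
  one-unmatched-vertex-impossible with v Fin.≟ u
  ... | yes v≡u = same v≡u
  ... | no  v≢u = different v≢u

-- For odd `n` the inequality admits just one value above the bound, m = (3n - 1) / 2, and this is
-- the excluded one. The recursion lowers `m` by 3 and `n` by 2.
m*2≤n*3⇒m≤3*⌊n/2⌋ : ∀ m n → m ℕ.* 2 ℕ.≤ n ℕ.* 3 → ℕ.suc (m ℕ.* 2) ≢ n ℕ.* 3 → m ℕ.≤ 3 ℕ.* ℕ.⌊ n /2⌋
m*2≤n*3⇒m≤3*⌊n/2⌋ 0 _ _ _ = ℕ.z≤n
m*2≤n*3⇒m≤3*⌊n/2⌋ 1 1 _ ≢ = contradiction ≡.refl ≢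
m*2≤n*3⇒m≤3*⌊n/2⌋ (ℕ.suc (ℕ.suc m)) 1 (ℕ.s≤s (ℕ.s≤s (ℕ.s≤s ()))) _
m*2≤n*3⇒m≤3*⌊n/2⌋ 1 (ℕ.suc (ℕ.suc n)) _ _ = ℕP.≤-trans (ℕ.s≤s ℕ.z≤n) (ℕP.*-monoʳ-≤ 3 {1} {ℕ.suc ℕ.⌊ n /2⌋} (ℕ.s≤s ℕ.z≤n))
m*2≤n*3⇒m≤3*⌊n/2⌋ 2 (ℕ.suc (ℕ.suc n)) _ _ = ℕP.≤-trans (ℕ.s≤s (ℕ.s≤s ℕ.z≤n)) (ℕP.*-monoʳ-≤ 3 {1} {ℕ.suc ℕ.⌊ n /2⌋} (ℕ.s≤s ℕ.z≤n))
m*2≤n*3⇒m≤3*⌊n/2⌋ (ℕ.suc (ℕ.suc (ℕ.suc m))) (ℕ.suc (ℕ.suc n)) (ℕ.s≤s (ℕ.s≤s (ℕ.s≤s (ℕ.s≤s (ℕ.s≤s (ℕ.s≤s le)))))) ≢ =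
  ≡.subst (3 ℕ.+ m ℕ.≤_) (≡.sym (ℕP.*-suc 3 ℕ.⌊ n /2⌋))
    (ℕP.+-monoʳ-≤ 3 (m*2≤n*3⇒m≤3*⌊n/2⌋ m n le (λ eq → ≢ (≡.cong (6 ℕ.+_) eq))))

-- The upper bound and the case of equality.

module Extremal {c ℓ₁ ℓ₂} (ℝ : CompleteOrderedField c ℓ₁ ℓ₂) (V : Plane.FiniteSet ℝ) where
  open CompleteOrderedField ℝ
  open PlaneGeometry ℝ
  open Plane ℝ
  open SquareRoot ℝ
  open DoubleNormals ℝ V
  open DecSetoid pointDecSetoid using () renaming
    (refl to ≈ₚ-refl; sym to ≈ₚ-sym; trans to ≈ₚ-trans; isDecEquivalence to ≈ₚ-isDecEquivalence)

  midpoints : Midpoints n ℓ₁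
  midpoints = record
    { _≋_              = λ (p , q) (r , s) → (v p +ₚ v q) ≈ₚ (v r +ₚ v s)
    ; isDecEquivalence = On.isDecEquivalence (λ (p , q) → v p +ₚ v q) ≈ₚ-isDecEquivalence
    ; swapped          = +-comm _ _ , +-comm _ _
    ; cancel           = λ (e₁ , e₂) → v-injective (cancelˡ e₁ , cancelˡ e₂)
    }
    where
    cancelˡ : ∀ {x y z} → z + x ≈ z + y → x ≈ y
    cancelˡ {x} {y} {z} eq = trans (solve 2 (λ x z → x := z :+ x :- z) refl x z)
      (trans (+-congʳ eq) (solve 2 (λ y z → z :+ y :- z := y) refl y z))

  module Count (σ : Carrier) (σσ≈1 : σ * σ ≈ 1#) where
    open Rotation.Counting (Side.rotation σ σσ≈1) edge-irrefl public

  module OneSide (σ : Carrier) (σσ≈1 : σ * σ ≈ 1#) (many : n ℕ.* 3 ℕ.≤ ℕ.suc (length (darts edge?))) where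
    open Side σ σσ≈1 public
    open Count.AlmostFull σ σσ≈1 many public
      using (not-leftmost-twice; leftmost; unmatched-unique; unmatched-exists)
    module O = Orientation σ σσ≈1

    abstract
      f : Fin n → Fin n
      f p = proj₁ (leftmost p)

      f-leftmost : ∀ p → Leftmost p (f p)
      f-leftmost p = proj₂ (leftmost p)

    f-unique : ∀ {p q} → Leftmost p q → f p ≡ q
    f-unique {p} = leftmost-unique (f-leftmost p)

    f∘f≢ : ∀ p → f (f p) ≢ p
    f∘f≢ p eq = not-leftmost-twice (f-leftmost p) (≡.subst (Leftmost (f p)) eq (f-leftmost (f p)))

    rectangle : ∀ {p q} → Matched p q → Rectangle (v p) (v (f p)) (v q) (v (f q))
    rectangle {p} {q} m = matched⇒rectangle m (f-leftmost p) (f-leftmost q)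

    f-cases : ∀ {p q} → Leftmost p q ⊎ Leftmost q p ⊎ Matched p q → f p ≡ q ⊎ f q ≡ p ⊎ Matched p q
    f-cases (inj₁ l)        = inj₁ (f-unique l)
    f-cases (inj₂ (inj₁ l)) = inj₂ (inj₁ (f-unique l))
    f-cases (inj₂ (inj₂ m)) = inj₂ (inj₂ m)

  -- `τ` is kept apart from `- σ` so that the signs 1 and -1 can be used in either order.
  module Mirror {σ τ : Carrier} (σσ≈1 : σ * σ ≈ 1#) (ττ≈1 : τ * τ ≈ 1#) (τ≈-σ : τ ≈ - σ)
    (many : n ℕ.* 3 ℕ.≤ ℕ.suc (length (darts edge?))) where
    private
      module A = OneSide σ σσ≈1 many
      module B = OneSide τ ττ≈1 many
      open A using (f)
      open B using () renaming (f to g)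

    left-mirror : ∀ {p q r} → B.Left p q r → A.Left p r q
    left-mirror {p} {q} {r} = 0<-resp (trans (*-congʳ τ≈-σ) (solve 5 (λ s a₁ a₂ b₁ b₂ →
      :- s :* (a₁ :* b₂ :- a₂ :* b₁) := s :* (b₁ :* a₂ :- b₂ :* a₁)) refl σ
      (proj₁ (v q) - proj₁ (v p)) (proj₂ (v q) - proj₂ (v p)) (proj₁ (v r) - proj₁ (v p)) (proj₂ (v r) - proj₂ (v p))))

    -- The rectangle of pq has a right angle at `f p`, and the strip of every double normal at `f p`
    -- contains `q`; so none of them lies beyond `p`.
    g∘f : ∀ {p q} → A.Matched p q → g (f p) ≡ p
    g∘f {p} {q} m = B.f-unique (edge-sym (proj₁ (A.f-leftmost p)) , λ z rz left →
      A.O.right-angle⇒rightmost (v p) (v q) (v (f p)) (v z) (right-angle (A.rectangle m))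
        (A.matched⇒left m (A.f-leftmost p)) (left-mirror {f p} {p} {z} left) (acuteˡ rz q))

    -- By `g∘f` the mirrored rectangle at `f p` also has the side from `f p` to `p`.
    partner : ∀ {p q t} → A.Matched p q → B.Matched (f p) t → f q ≡ t
    partner {p} {q} {t} m m′ = v-injective (A.O.rectangles-on-a-side-agree (A.rectangle m) R′
      (A.matched⇒left m (A.f-leftmost p))
      (left-mirror {f p} {t} {p} (≡.subst (B.Left (f p) t) (g∘f m) (B.matched⇒left m′ (B.f-leftmost (f p)))))
      (acuteʳ (proj₁ m) (g t)) (acuteʳ (proj₁ m′) (f q)))
      where
      R′ : Rectangle (v (f p)) (v p) (v t) (v (g t))
      R′ = ≡.subst (λ x → Rectangle (v (f p)) (v x) (v t) (v (g t))) (g∘f m) (B.rectangle m′)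

    matching : Matching Edge midpoints A.Matched B.Matched f g
    matching = record
      { matched?   = A.matched?
      ; sym        = A.matched-sym
      ; unique     = A.matched-unique
      ; irrefl     = λ { (e , _) ≡.refl → edge-irrefl e }
      ; edge       = proj₁
      ; edge-cases = λ e → A.f-cases (A.edge-cases e)
      ; f≢         = λ { {p} (_ , ¬pq , _) ≡.refl → ¬pq (A.f-leftmost p) }
      ; g∘f        = g∘f
      ; partner    = partner
      ; midpoint   = λ m → centre (A.rectangle m)
      }

  1*1≈1 : 1# * 1# ≈ 1#
  1*1≈1 = *-identityˡ 1#

  -1*-1≈1 : - 1# * - 1# ≈ 1#
  -1*-1≈1 = solve 0 (:- con (+ 1) :* :- con (+ 1) := con (+ 1)) refl

  1≈--1 : 1# ≈ - - 1#
  1≈--1 = solve 0 (con (+ 1) := :- (:- con (+ 1))) refl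

  length-darts≤3n : length (darts edge?) ℕ.≤ n ℕ.* 3
  length-darts≤3n = Count.length-darts≤ 1# 1*1≈1

  module BothSides (many : n ℕ.* 3 ℕ.≤ ℕ.suc (length (darts edge?))) where
    module A = OneSide 1# 1*1≈1 many
    module B = OneSide (- 1#) -1*-1≈1 many
    module AB = Mirror 1*1≈1 -1*-1≈1 refl many
    module BA = Mirror -1*-1≈1 1*1≈1 1≈--1 many

    -- A matched pair has only one edge on its own side at `p`, and here this holds for left and
    -- right.
    beside : ∀ {p q r} → A.Matched p q → B.Matched p q → Edge p r → q ≢ r → A.f p ≡ r ⊎ B.f p ≡ r
    beside {p} {q} {r} m m′ pr q≢r = conclude (A.left-total (proj₁ m) pr q≢r)
      where
      conclude : A.Left p q r ⊎ A.Left p r q → A.f p ≡ r ⊎ B.f p ≡ r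
      conclude (inj₁ left) = inj₁ (A.f-unique (A.left-of-matched⇒leftmost m pr left))
      conclude (inj₂ left) = inj₂ (B.f-unique (B.left-of-matched⇒leftmost m′ pr (BA.left-mirror {p} {r} {q} left)))

  length-darts≢3n-1 : ℕ.suc (length (darts edge?)) ≢ n ℕ.* 3
  length-darts≢3n-1 eq = conclude (A.unmatched-exists few) (B.unmatched-exists few)
    where
    open BothSides (ℕP.≤-reflexive (≡.sym eq))
    few : length (darts edge?) ℕ.< n ℕ.* 3
    few = ℕP.≤-reflexive eq

    matched-by : ∀ {m} {M : Fin n → Fin n → Set m} {u} → (∀ p q → Dec (M p q)) →
      (∀ {x y} → ¬ ∃ (M x) → ¬ ∃ (M y) → x ≡ y) → ¬ ∃ (M u) → ∀ x → x ≢ u → ∃ (M x)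
    matched-by M? unique ¬u x x≢u with Fin.any? (M? x)
    ... | yes m = m
    ... | no ¬m = contradiction (unique ¬m ¬u) x≢u

    conclude : ∃[ p ] ¬ ∃ (A.Matched p) → ∃[ p ] ¬ ∃ (B.Matched p) → ⊥
    conclude (p , ¬p) (q , ¬q) = one-unmatched-vertex-impossible AB.matching BA.matching edge-sym
      (λ x → proj₁ (A.f-leftmost x)) A.f∘f≢ beside
      (matched-by A.matched? A.unmatched-unique ¬p) (matched-by B.matched? B.unmatched-unique ¬q) ¬p ¬q

  N≤3*⌊n/2⌋ : N V ℕ.≤ 3 ℕ.* ℕ.⌊ n /2⌋
  N≤3*⌊n/2⌋ = m*2≤n*3⇒m≤3*⌊n/2⌋ (N V) n (≡.subst (ℕ._≤ n ℕ.* 3) length-darts length-darts≤3n)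
    λ eq → length-darts≢3n-1 (≡.trans (≡.cong ℕ.suc length-darts) eq)

  maximiser : ∀ {p} {P : Pred (Fin n) p} → Decidable P → (h : Fin n → Carrier) → ∀ {x} → P x →
    ∃[ y ] P y × (∀ z → P z → h z ≤ h y)
  maximiser {P = P} P? h {x} Px = let y , Py , max = search (allFin n) in y , Py , λ z → max (Mem.∈-allFin z)
    where
    search : ∀ xs → ∃[ y ] P y × (∀ {z} → z ∈ₗ xs → P z → h z ≤ h y)
    search []       = x , Px , λ ()
    search (w ∷ xs) with search xs
    ... | y , Py , max with P? w | total (h w) (h y)
    ...   | no ¬Pw | _          = y , Py , λ { (here ≡.refl) Pw → contradiction Pw ¬Pw ; (there z∈) → max z∈ }
    ...   | yes _  | inj₁ hw≤hy = y , Py , λ { (here ≡.refl) _ → hw≤hy ; (there z∈) → max z∈ }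
    ...   | yes Pw | inj₂ hy≤hw = w , Pw , λ { (here ≡.refl) _ → ≤-refl ; (there z∈) Pz → ≤-trans (max z∈ Pz) hy≤hw }

  -- Every vertex matched: all points on one circle.

  module Perfect (full : n ℕ.* 3 ℕ.≤ length (darts edge?)) where
    open BothSides (ℕP.m≤n⇒m≤1+n full)
    private
      module I  = Interplay AB.matching BA.matching
      module I′ = Interplay BA.matching AB.matching

    abstract
      star : Fin n → Fin n
      star p = proj₁ (Count.perfect 1# 1*1≈1 full p)

      matched : ∀ p → A.Matched p (star p)
      matched p = proj₂ (Count.perfect 1# 1*1≈1 full p)

    -- With no vertex unmatched on either side, the left and the right matching coincide.
    matched′ : ∀ p → B.Matched p (star p)
    matched′ p = I.matched-mirror (matched p) (perfect′ p) (perfect′ (star p))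
      where
      perfect′ : ∀ p → ∃ (B.Matched p)
      perfect′ = Count.perfect (- 1#) -1*-1≈1 full

    star-unique : ∀ {p q} → A.Matched p q → star p ≡ q
    star-unique {p} = A.matched-unique (matched p)

    star∘star : ∀ p → star (star p) ≡ p
    star∘star p = star-unique (A.matched-sym (matched p))

    star∘f : ∀ p → star (A.f p) ≡ A.f (star p)
    star∘f p = star-unique (I′.matched-mirror (I.partners (matched p) (matched′ (A.f p))) (_ , matched _) (_ , matched _))

    star∘g : ∀ p → star (B.f p) ≡ B.f (star p)
    star∘g p = star-unique (I′.partners (matched′ p) (matched (B.f p)))

    -- Twice the vector from the centre of the pair to `p`; `centre₂` and `offset` are doubled as
    -- well, which avoids halves.
    diagonal : Fin n → Point
    diagonal p = v p -ₚ v (star p)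

    centre₂ : Fin n → Point
    centre₂ p = v p +ₚ v (star p)

    SameCircle : Fin n → Fin n → Set ℓ₁
    SameCircle p q = centre₂ p ≈ₚ centre₂ q × ⟨ diagonal p , diagonal p ⟩ ≈ ⟨ diagonal q , diagonal q ⟩

    sameCircle? : ∀ p q → Dec (SameCircle p q)
    sameCircle? p q = (centre₂ p ≟ₚ centre₂ q) ×-dec (⟨ diagonal p , diagonal p ⟩ ≟ ⟨ diagonal q , diagonal q ⟩)

    sameCircle-trans : ∀ {p q r} → SameCircle p q → SameCircle q r → SameCircle p r
    sameCircle-trans (c , d) (c′ , d′) = ≈ₚ-trans c c′ , trans d d′

    sameCircle-star : ∀ p → SameCircle (star p) p
    sameCircle-star p = ≡.subst (λ x → (v (star p) +ₚ v x) ≈ₚ centre₂ p) (≡.sym (star∘star p)) (+-comm _ _ , +-comm _ _) ,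
      ≡.subst (λ x → ⟨ v (star p) -ₚ v x , v (star p) -ₚ v x ⟩ ≈ ⟨ diagonal p , diagonal p ⟩) (≡.sym (star∘star p))
        (solve 4 (λ x y z w → (z :- x) :* (z :- x) :+ (w :- y) :* (w :- y) := (x :- z) :* (x :- z) :+ (y :- w) :* (y :- w))
          refl (proj₁ (v p)) (proj₂ (v p)) (proj₁ (v (star p))) (proj₂ (v (star p))))

    rectangle-sameCircle : ∀ {p r s} → Rectangle (v p) (v r) (v (star p)) (v s) → star r ≡ s → SameCircle r p
    rectangle-sameCircle R ≡.refl = ≈ₚ-sym (centre R) , rectangle-diagonals R

    -- In the rectangle at `p` this vertex is opposite to `A.f p` and next to `p`; it plays the part
    -- of `s` in `rectangle-in-disc`.
    f-sameCircle : ∀ p → SameCircle (A.f (star p)) p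
    f-sameCircle p = sameCircle-trans
      (rectangle-sameCircle (A.rectangle (matched (star p))) (star∘f (star p))) (sameCircle-star p)

    g-sameCircle : ∀ p → SameCircle (B.f (star p)) p
    g-sameCircle p = sameCircle-trans
      (rectangle-sameCircle (B.rectangle (matched′ (star p))) (star∘g (star p))) (sameCircle-star p)

    offset : Fin n → Fin n → Point
    offset p k = (v k +ₚ v k) -ₚ centre₂ p

    -- Among the vertices on its circle, `p` reaches farthest in the direction from the centre to
    -- `k`.
    Farthest : Fin n → Fin n → Set (ℓ₁ Level.⊔ ℓ₂)
    Farthest k p = ∀ q → SameCircle q p → ⟨ offset p k , diagonal q ⟩ ≤ ⟨ offset p k , diagonal p ⟩

    farthest : ∀ k p₀ → ∃[ p ] SameCircle p p₀ × Farthest k p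
    farthest k p₀ = conclude (maximiser (λ p → sameCircle? p p₀) (λ q → ⟨ offset p₀ k , diagonal q ⟩) (≈ₚ-refl , refl))
      where
      conclude : ∃[ p ] SameCircle p p₀ × (∀ q → SameCircle q p₀ →
        ⟨ offset p₀ k , diagonal q ⟩ ≤ ⟨ offset p₀ k , diagonal p ⟩) → ∃[ p ] SameCircle p p₀ × Farthest k p
      conclude (p , p~p₀@((e₁ , e₂) , _) , max) = p , p~p₀ , λ q q~p →
        ≤-respˡ-≈ (sym (shift q)) (≤-respʳ-≈ (sym (shift p)) (max q (sameCircle-trans q~p p~p₀)))
        where
        shift : ∀ q → ⟨ offset p k , diagonal q ⟩ ≈ ⟨ offset p₀ k , diagonal q ⟩
        shift q = +-cong (*-congʳ (+-congˡ (-‿cong e₁))) (*-congʳ (+-congˡ (-‿cong e₂)))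

    -- The side of the diameter through `p` on which `k` lies decides whether the left or the right
    -- rectangle at `p` is used.
    farthest⇒inDisc : ∀ k p → Farthest k p → InDisc (v p) (v (star p)) (v k)
    farthest⇒inDisc k p far = conclude (0≤⊎0<- (A.O.orient (diagonal p) (offset p k)))
      where
      side-A : ⟨ offset p k , v (A.f (star p)) -ₚ v (A.f p) ⟩ ≤ ⟨ offset p k , diagonal p ⟩
      side-A = ≡.subst (λ x → ⟨ offset p k , v (A.f (star p)) -ₚ v x ⟩ ≤ ⟨ offset p k , diagonal p ⟩)
        (≡.trans (star∘f (star p)) (≡.cong A.f (star∘star p))) (far (A.f (star p)) (f-sameCircle p))
      side-B : ⟨ offset p k , v (B.f (star p)) -ₚ v (B.f p) ⟩ ≤ ⟨ offset p k , diagonal p ⟩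
      side-B = ≡.subst (λ x → ⟨ offset p k , v (B.f (star p)) -ₚ v x ⟩ ≤ ⟨ offset p k , diagonal p ⟩)
        (≡.trans (star∘g (star p)) (≡.cong B.f (star∘star p))) (far (B.f (star p)) (g-sameCircle p))
      conclude : 0# ≤ A.O.orient (diagonal p) (offset p k) ⊎ 0# < - A.O.orient (diagonal p) (offset p k) →
        InDisc (v p) (v (star p)) (v k)
      conclude (inj₁ 0≤X×W) = A.O.rectangle-in-disc (v k) (A.rectangle (matched p))
        (A.matched⇒left (matched p) (A.f-leftmost p)) (acuteˡ (proj₁ (A.f-leftmost p)) k) 0≤X×W side-A
      conclude (inj₂ X×W<0) = B.O.rectangle-in-disc (v k) (B.rectangle (matched′ p))
        (B.matched⇒left (matched′ p) (B.f-leftmost p)) (acuteˡ (proj₁ (B.f-leftmost p)) k)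
        (0≤-resp (solve 1 (λ x → :- (con (+ 1) :* x) := :- con (+ 1) :* x) refl (det (diagonal p) (offset p k)))
          (<⇒≤ X×W<0)) side-B

    inDisc : ∀ p k → InDisc (v p) (v (star p)) (v k)
    inDisc p₀ k = let p , ((e₁ , e₂) , ρ) , far = farthest k p₀ in
      ≤-respˡ-≈ (+-cong (*-cong (+-congˡ (-‿cong e₁)) (+-congˡ (-‿cong e₁))) (*-cong (+-congˡ (-‿cong e₂)) (+-congˡ (-‿cong e₂))))
        (≤-respʳ-≈ ρ (farthest⇒inDisc k p far))

    sameCircle : ∀ p q → SameCircle p q
    sameCircle p q = discs-agree (v p) (v (star p)) (v q) (v (star q))
      (inDisc p q) (inDisc p (star q)) (inDisc q p) (inDisc q (star p))

    private
      half : ∃[ h ] 0# < h × (1# + 1#) * h ≈ 1#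
      half = inverse-pos (+-pos-nonneg 0<1 (<⇒≤ 0<1))

    circle : Fin n → ∃[ o ] ∃[ r ] (LiesOnCircle V o r × SymmetricAbout V o)
    -- `h` is one half and `ρ` the diameter.
    circle p₀ = o , h * ρ , (*-pos 0<h 0<ρ , universal onCircle) , universal symmetric
      where
      h ρ : Carrier
      h = proj₁ half
      0<h : 0# < h
      0<h = proj₁ (proj₂ half)
      2h≈1 : (1# + 1#) * h ≈ 1#
      2h≈1 = proj₂ (proj₂ half)
      o : Point
      o = h * proj₁ (centre₂ p₀) , h * proj₂ (centre₂ p₀)
      root : ∃[ r ] 0# < r × r * r ≈ ⟨ diagonal p₀ , diagonal p₀ ⟩
      root = square-root (0<dist² (v (star p₀)) (v p₀) (λ eq → proj₁ (proj₁ (matched p₀)) (≈ₚ-sym eq)))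
      ρ = proj₁ root
      0<ρ : 0# < ρ
      0<ρ = proj₁ (proj₂ root)
      ρρ≈ : ρ * ρ ≈ ⟨ diagonal p₀ , diagonal p₀ ⟩
      ρρ≈ = proj₂ (proj₂ root)

      universal : ∀ {p} {P : Pred Point p} → (∀ k → P (v k)) → All P (points V)
      universal {P = P} Pv = ≡.subst (All P) (List.tabulate-lookup (points V)) (All.tabulate⁺ Pv)

      double : ∀ x → x ≈ h * (x + x)
      double x = trans (sym (*-identityˡ x)) (trans (*-congʳ (sym 2h≈1))
        (solve 2 (λ h x → (con (+ 2) :* h) :* x := h :* (x :+ x)) refl h x))

      radius : ∀ {x y c} → x + y ≈ c → x - h * c ≈ h * (x - y)
      radius {x} {y} {c} e = trans (+-cong (double x) (-‿cong (*-congˡ (sym e))))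
        (solve 3 (λ h x y → h :* (x :+ x) :- h :* (x :+ y) := h :* (x :- y)) refl h x y)

      onCircle : ∀ k → OnCircle o (h * ρ) (v k)
      onCircle k = trans (+-cong (*-cong r₁ r₁) (*-cong r₂ r₂)) (trans
        (solve 3 (λ h x y → (h :* x) :* (h :* x) :+ (h :* y) :* (h :* y) := (h :* h) :* (x :* x :+ y :* y)) refl h
          (proj₁ (diagonal k)) (proj₂ (diagonal k)))
        (trans (*-congˡ (trans (proj₂ (sameCircle k p₀)) (sym ρρ≈)))
          (solve 2 (λ h r → (h :* h) :* (r :* r) := (h :* r) :* (h :* r)) refl h ρ)))
        where
        r₁ : proj₁ (v k) - proj₁ o ≈ h * proj₁ (diagonal k)
        r₁ = radius (proj₁ (proj₁ (sameCircle k p₀)))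
        r₂ : proj₂ (v k) - proj₂ o ≈ h * proj₂ (diagonal k)
        r₂ = radius (proj₂ (proj₁ (sameCircle k p₀)))

      reflect : ∀ {x y c} → x + y ≈ c → y ≈ h * c + h * c - x
      reflect {x} {y} {c} e = trans (solve 2 (λ x y → y := x :+ y :- x) refl x y)
        (+-congʳ (trans e (trans (double c) (solve 2 (λ h c → h :* (c :+ c) := h :* c :+ h :* c) refl h c))))

      symmetric : ∀ k → ((o +ₚ o) -ₚ v k) ∈ points V
      symmetric k = SetoidMembership.∈-resp-≈ pointSetoid
        (reflect (proj₁ (proj₁ (sameCircle k p₀))) , reflect (proj₂ (proj₁ (sameCircle k p₀))))
        (SetoidMembership.∈-lookup pointSetoid (points V) (star k))

  extremal⇒circle : 3 ℕ.≤ n → 2 ∣ n → N V ≡ (3 ℕ.* n) ℕ./ 2 →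
    ∃[ o ] ∃[ r ] (LiesOnCircle V o r × SymmetricAbout V o)
  extremal⇒circle 3≤n 2∣n N≡ = Perfect.circle (ℕP.≤-reflexive (≡.sym darts≡))
    (Fin.fromℕ< (ℕP.≤-trans (ℕ.s≤s ℕ.z≤n) 3≤n))
    where
    darts≡ : length (darts edge?) ≡ n ℕ.* 3
    -- Evenness of `n` makes the division by 2 exact.
    darts≡ = ≡.trans length-darts (≡.trans (≡.cong (ℕ._* 2) N≡)
      (≡.trans (ℕ.m/n*n≡m (ℕ.∣n⇒∣m*n 3 2∣n)) (ℕP.*-comm 3 n)))

-- Lower bounds for filtered lists of pairs.

module _ {a p} {A : Set a} {P : Pred A p} (P? : Decidable P) where

  sublist⇒length-filter≥ : ∀ {xs ys} → xs ⊆ ys → All P xs → length xs ℕ.≤ length (filter P? ys)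
  sublist⇒length-filter≥ {xs} xs⊆ys Pxs = ≡.subst (λ zs → length zs ℕ.≤ _) (List.filter-all P? Pxs)
    (Sublist.length-mono-≤ (Sublist.filter⁺ P? P? (λ { ≡.refl Px → Px }) xs⊆ys))

module _ {a p} {A : Set a} {P : Pred (A × A) p} (P? : Decidable P) where

  -- Of the pairs that `x` adds, only those with the sublist `zs` are claimed; exact values follow
  -- later from the upper bound.
  length-filter-pairs : ∀ {x zs ys} → zs ⊆ ys → All (λ z → P (x , z)) zs →
    length zs ℕ.+ length (filter P? (unorderedPairs ys)) ℕ.≤ length (filter P? (unorderedPairs (x ∷ ys)))
  length-filter-pairs {x} {zs} {ys} zs⊆ys Pzs = ≡.subst (length zs ℕ.+ _ ℕ.≤_)
    (≡.sym (≡.trans (≡.cong length (List.filter-++ P? (map (x ,_) ys) (unorderedPairs ys)))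
      (List.length-++ (filter P? (map (x ,_) ys)))))
    (ℕP.+-monoˡ-≤ _ (≡.subst (ℕ._≤ length (filter P? (map (x ,_) ys))) (List.length-map (x ,_) zs)
      (sublist⇒length-filter≥ P? (Sublist.map⁺ (x ,_) zs⊆ys) (All.map⁺ Pzs))))

parity : ∀ n → ∃[ m ] (n ≡ m ℕ.+ m ⊎ n ≡ ℕ.suc (m ℕ.+ m))
parity ℕ.zero    = 0 , inj₁ ≡.refl
parity (ℕ.suc n) with parity n
... | m , inj₁ ≡.refl = m , inj₂ ≡.refl
... | m , inj₂ ≡.refl = ℕ.suc m , inj₁ (≡.cong ℕ.suc (≡.sym (ℕP.+-suc m m)))

-- Point sets that attain the bound.

module Construction {c ℓ₁ ℓ₂} (ℝ : CompleteOrderedField c ℓ₁ ℓ₂) where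
  open CompleteOrderedField ℝ
  open PlaneGeometry ℝ
  open Plane ℝ
  open SquareRoot ℝ using (inverse-pos)
  open DecSetoid pointDecSetoid using () renaming (sym to ≈ₚ-sym)

  ι : ℕ → Carrier
  ι ℕ.zero    = 0#
  ι (ℕ.suc k) = 1# + ι k

  ι-nonneg : ∀ k → 0# ≤ ι k
  ι-nonneg ℕ.zero    = ≤-refl
  ι-nonneg (ℕ.suc k) = +-nonneg (<⇒≤ 0<1) (ι-nonneg k)

  ι-mono : ∀ {j k} → j ℕ.≤ k → 0# ≤ ι k - ι j
  ι-mono {k = k} ℕ.z≤n = 0≤-resp (solve 1 (λ x → x := x :- con (+ 0)) refl (ι k)) (ι-nonneg k)
  ι-mono {ℕ.suc j} {ℕ.suc k} (ℕ.s≤s j≤k) =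
    0≤-resp (solve 2 (λ x y → y :- x := (con (+ 1) :+ y) :- (con (+ 1) :+ x)) refl (ι j) (ι k)) (ι-mono j≤k)

  ι-mono-< : ∀ {j k} → j ℕ.< k → 0# < ι k - ι j
  ι-mono-< {j} {ℕ.suc k} (ℕ.s≤s j≤k) =
    0<-resp (solve 2 (λ x y → con (+ 1) :+ (y :- x) := (con (+ 1) :+ y) :- x) refl (ι j) (ι k))
      (+-pos-nonneg 0<1 (ι-mono j≤k))

  0<1+ι*ι : ∀ j k → 0# < 1# + ι j * ι k
  0<1+ι*ι j k = +-pos-nonneg 0<1 (*-nonneg (ι-nonneg j) (ι-nonneg k))

  private
    inv : ∀ k → ∃[ y ] 0# < y × (1# + ι k * ι k) * y ≈ 1#
    inv k = inverse-pos (0<1+ι*ι k k)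

  abstract
    -- The reciprocal of 1 + k², by which points of the circle are obtained without roots.
    u : ℕ → Carrier
    u k = proj₁ (inv k)

    0<u : ∀ k → 0# < u k
    0<u k = proj₁ (proj₂ (inv k))

    unit : ∀ k → (1# + ι k * ι k) * u k ≈ 1#
    unit k = proj₂ (proj₂ (inv k))

  -- The square of half the distance between `P j` and `P k`, that is sin²(arctan j - arctan k).
  half-chord : ℕ → ℕ → Carrier
  half-chord j k = (ι j - ι k) * (ι j - ι k) * (u j * u k)

  abstract
    -- The point of the unit circle at angle 2 arctan k.
    P : ℕ → Point
    P k = (1# - ι k * ι k) * u k , (1# + 1#) * ι k * u k

    P·P : ∀ j k → ⟨ P j , P k ⟩ ≈ 1# - (1# + 1#) * half-chord j k
    P·P j k = trans (solve 4 (λ a b x y →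
        (con (+ 1) :- a :* a) :* x :* ((con (+ 1) :- b :* b) :* y) :+ con (+ 2) :* a :* x :* (con (+ 2) :* b :* y) :=
        ((con (+ 1) :+ a :* a) :* x) :* ((con (+ 1) :+ b :* b) :* y) :- con (+ 2) :* ((a :- b) :* (a :- b) :* (x :* y)))
        refl (ι j) (ι k) (u j) (u k))
      (+-congʳ (trans (*-cong (unit j) (unit k)) (*-identityˡ 1#)))

  infix 8 ⊝_

  ⊝_ : Point → Point
  ⊝ (x , y) = - x , - y

  0ₚ : Point
  0ₚ = 0# , 0#

  Unit : Point → Set ℓ₁
  Unit X = ⟨ X , X ⟩ ≈ 1#

  P-unit : ∀ k → Unit (P k)
  P-unit k = trans (P·P k k) (solve 2 (λ a x → con (+ 1) :- con (+ 2) :* ((a :- a) :* (a :- a) :* (x :* x)) := con (+ 1))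
    refl (ι k) (u k))

  ⊝-unit : ∀ {X} → Unit X → Unit (⊝ X)
  ⊝-unit {x , y} e = trans (solve 2 (λ x y → :- x :* :- x :+ :- y :* :- y := x :* x :+ y :* y) refl x y) e

  -- For unit vectors these are ⟨K - X, Y - X⟩ and ⟨K - Y, X - Y⟩, expanded so that only inner
  -- products of distinct points, known from `P·P`, remain.
  Between : Point → Point → Point → Set ℓ₂
  Between X Y K = 0# ≤ 1# + ⟨ K , Y ⟩ - ⟨ K , X ⟩ - ⟨ X , Y ⟩ × 0# ≤ 1# + ⟨ K , X ⟩ - ⟨ K , Y ⟩ - ⟨ X , Y ⟩

  between⇒inStrip : ∀ X Y K → Unit X → Unit Y → Between X Y K → InStrip X Y K
  between⇒inStrip (x₁ , x₂) (y₁ , y₂) (k₁ , k₂) unit-X unit-Y (h , h′) = acute⇒inStrip _ _ _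
    (0≤-resp (trans (+-congʳ (+-congʳ (+-congʳ (sym unit-X)))) (solve 6 (λ x₁ x₂ y₁ y₂ k₁ k₂ →
      (x₁ :* x₁ :+ x₂ :* x₂) :+ (k₁ :* y₁ :+ k₂ :* y₂) :- (k₁ :* x₁ :+ k₂ :* x₂) :- (x₁ :* y₁ :+ x₂ :* y₂) :=
      (k₁ :- x₁) :* (y₁ :- x₁) :+ (k₂ :- x₂) :* (y₂ :- x₂)) refl x₁ x₂ y₁ y₂ k₁ k₂)) h)
    (0≤-resp (trans (+-congʳ (+-congʳ (+-congʳ (sym unit-Y)))) (solve 6 (λ x₁ x₂ y₁ y₂ k₁ k₂ →
      (y₁ :* y₁ :+ y₂ :* y₂) :+ (k₁ :* x₁ :+ k₂ :* x₂) :- (k₁ :* y₁ :+ k₂ :* y₂) :- (x₁ :* y₁ :+ x₂ :* y₂) :=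
      (k₁ :- y₁) :* (x₁ :- y₁) :+ (k₂ :- y₂) :* (x₂ :- y₂)) refl x₁ x₂ y₁ y₂ k₁ k₂)) h′)

  between-⊝ʳ : ∀ X Y K → Between X Y K → Between X Y (⊝ K)
  between-⊝ʳ X Y K (h , h′) = 0≤-resp (flip X Y K) h′ ,
    0≤-resp (flip′ X Y K) h
    where
    flip : ∀ X Y K → 1# + ⟨ K , X ⟩ - ⟨ K , Y ⟩ - ⟨ X , Y ⟩ ≈ 1# + ⟨ ⊝ K , Y ⟩ - ⟨ ⊝ K , X ⟩ - ⟨ X , Y ⟩
    flip (x₁ , x₂) (y₁ , y₂) (k₁ , k₂) = solve 6 (λ x₁ x₂ y₁ y₂ k₁ k₂ →
      con (+ 1) :+ (k₁ :* x₁ :+ k₂ :* x₂) :- (k₁ :* y₁ :+ k₂ :* y₂) :- (x₁ :* y₁ :+ x₂ :* y₂) :=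
      con (+ 1) :+ (:- k₁ :* y₁ :+ :- k₂ :* y₂) :- (:- k₁ :* x₁ :+ :- k₂ :* x₂) :- (x₁ :* y₁ :+ x₂ :* y₂))
      refl x₁ x₂ y₁ y₂ k₁ k₂
    flip′ : ∀ X Y K → 1# + ⟨ K , Y ⟩ - ⟨ K , X ⟩ - ⟨ X , Y ⟩ ≈ 1# + ⟨ ⊝ K , X ⟩ - ⟨ ⊝ K , Y ⟩ - ⟨ X , Y ⟩
    flip′ (x₁ , x₂) (y₁ , y₂) (k₁ , k₂) = solve 6 (λ x₁ x₂ y₁ y₂ k₁ k₂ →
      con (+ 1) :+ (k₁ :* y₁ :+ k₂ :* y₂) :- (k₁ :* x₁ :+ k₂ :* x₂) :- (x₁ :* y₁ :+ x₂ :* y₂) :=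
      con (+ 1) :+ (:- k₁ :* x₁ :+ :- k₂ :* x₂) :- (:- k₁ :* y₁ :+ :- k₂ :* y₂) :- (x₁ :* y₁ :+ x₂ :* y₂))
      refl x₁ x₂ y₁ y₂ k₁ k₂

  between-⊝ˡ : ∀ X Y K → Between X Y K → Between (⊝ X) (⊝ Y) K
  between-⊝ˡ X Y K (h , h′) = 0≤-resp (flip X Y K) h′ , 0≤-resp (flip′ X Y K) h
    where
    flip : ∀ X Y K → 1# + ⟨ K , X ⟩ - ⟨ K , Y ⟩ - ⟨ X , Y ⟩ ≈ 1# + ⟨ K , ⊝ Y ⟩ - ⟨ K , ⊝ X ⟩ - ⟨ ⊝ X , ⊝ Y ⟩
    flip (x₁ , x₂) (y₁ , y₂) (k₁ , k₂) = solve 6 (λ x₁ x₂ y₁ y₂ k₁ k₂ →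
      con (+ 1) :+ (k₁ :* x₁ :+ k₂ :* x₂) :- (k₁ :* y₁ :+ k₂ :* y₂) :- (x₁ :* y₁ :+ x₂ :* y₂) :=
      con (+ 1) :+ (k₁ :* :- y₁ :+ k₂ :* :- y₂) :- (k₁ :* :- x₁ :+ k₂ :* :- x₂) :- (:- x₁ :* :- y₁ :+ :- x₂ :* :- y₂))
      refl x₁ x₂ y₁ y₂ k₁ k₂
    flip′ : ∀ X Y K → 1# + ⟨ K , Y ⟩ - ⟨ K , X ⟩ - ⟨ X , Y ⟩ ≈ 1# + ⟨ K , ⊝ X ⟩ - ⟨ K , ⊝ Y ⟩ - ⟨ ⊝ X , ⊝ Y ⟩
    flip′ (x₁ , x₂) (y₁ , y₂) (k₁ , k₂) = solve 6 (λ x₁ x₂ y₁ y₂ k₁ k₂ →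
      con (+ 1) :+ (k₁ :* y₁ :+ k₂ :* y₂) :- (k₁ :* x₁ :+ k₂ :* x₂) :- (x₁ :* y₁ :+ x₂ :* y₂) :=
      con (+ 1) :+ (k₁ :* :- x₁ :+ k₂ :* :- x₂) :- (k₁ :* :- y₁ :+ k₂ :* :- y₂) :- (:- x₁ :* :- y₁ :+ :- x₂ :* :- y₂))
      refl x₁ x₂ y₁ y₂ k₁ k₂

  -- The sum of the two inequalities for `K` is twice 1 - ⟨X,Y⟩, the value of both expressions at
  -- the origin.
  between⇒origin : ∀ X Y K → Between X Y K → Between X Y 0ₚ
  between⇒origin X@(x₁ , x₂) Y@(y₁ , y₂) K (h , h′) =
    0≤-resp (solve 5 (λ x₁ x₂ y₁ y₂ z → con (+ 1) :- z :=
      con (+ 1) :+ (con (+ 0) :* y₁ :+ con (+ 0) :* y₂) :- (con (+ 0) :* x₁ :+ con (+ 0) :* x₂) :- z) refl x₁ x₂ y₁ y₂ ⟨ X , Y ⟩) 0≤1-XY ,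
    0≤-resp (solve 5 (λ x₁ x₂ y₁ y₂ z → con (+ 1) :- z :=
      con (+ 1) :+ (con (+ 0) :* x₁ :+ con (+ 0) :* x₂) :- (con (+ 0) :* y₁ :+ con (+ 0) :* y₂) :- z) refl x₁ x₂ y₁ y₂ ⟨ X , Y ⟩) 0≤1-XY
    where
    0≤1-XY : 0# ≤ 1# - ⟨ X , Y ⟩
    0≤1-XY = *-cancelˡ-nonneg (+-pos-nonneg 0<1 (<⇒≤ 0<1)) (0≤-resp
      (solve 3 (λ a b z → (con (+ 1) :+ a :- b :- z) :+ (con (+ 1) :+ b :- a :- z) := con (+ 2) :* (con (+ 1) :- z))
        refl ⟨ K , Y ⟩ ⟨ K , X ⟩ ⟨ X , Y ⟩) (+-nonneg h h′))

  between-sym : ∀ X Y K → Between X Y K → Between Y X K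
  between-sym X Y K (h , h′) = 0≤-resp (+-congˡ (-‿cong (comm X Y))) h′ , 0≤-resp (+-congˡ (-‿cong (comm X Y))) h
    where
    comm : ∀ X Y → ⟨ X , Y ⟩ ≈ ⟨ Y , X ⟩
    comm (x₁ , x₂) (y₁ , y₂) = +-cong (*-comm _ _) (*-comm _ _)

  private
    *-unit : ∀ k x → x * ((1# + ι k * ι k) * u k) ≈ x
    *-unit k x = trans (*-congˡ (unit k)) (solve 1 (λ x → x :* con (+ 1) := x) refl x)

    ⟨⊝ʳ⟩ : ∀ X Y → ⟨ X , ⊝ Y ⟩ ≈ - ⟨ X , Y ⟩
    ⟨⊝ʳ⟩ (x₁ , x₂) (y₁ , y₂) = solve 4 (λ x₁ x₂ y₁ y₂ →
      x₁ :* :- y₁ :+ x₂ :* :- y₂ := :- (x₁ :* y₁ :+ x₂ :* y₂)) refl x₁ x₂ y₁ y₂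

  half-chord-sym : ∀ j k → half-chord j k ≈ half-chord k j
  half-chord-sym j k = solve 4 (λ a b x y → (a :- b) :* (a :- b) :* (x :* y) := (b :- a) :* (b :- a) :* (y :* x))
    refl (ι j) (ι k) (u j) (u k)

  -- This is sin²A + sin²B - sin²(A - B) = 2 sin A sin B cos(A - B) for A = arctan j - arctan a and
  -- B = arctan j - arctan b. Multiplying every term by its missing factor from `unit` makes it a
  -- polynomial identity.
  half-chords : ∀ a b j → half-chord j a + half-chord j b - half-chord a b ≈
    (1# + 1#) * ((ι j - ι a) * (ι j - ι b) * (1# + ι a * ι b) * (u a * u b * u j))
  half-chords a b j = trans
    (+-cong (+-cong (sym (*-unit b _)) (sym (*-unit a _))) (-‿cong (sym (*-unit j _))))
    (solve 6 (λ a b j x y z →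
      (j :- a) :* (j :- a) :* (z :* x) :* ((con (+ 1) :+ b :* b) :* y) :+
      (j :- b) :* (j :- b) :* (z :* y) :* ((con (+ 1) :+ a :* a) :* x) :-
      (a :- b) :* (a :- b) :* (x :* y) :* ((con (+ 1) :+ j :* j) :* z) :=
      con (+ 2) :* ((j :- a) :* (j :- b) :* (con (+ 1) :+ a :* b) :* (x :* y :* z)))
      refl (ι a) (ι b) (ι j) (u a) (u b) (u j))

  -- With the same angles, cos²A + cos²B - sin²(A - B) = 2 cos A cos B cos(A - B).
  half-chords′ : ∀ a b j → (1# + 1#) - half-chord j a - half-chord j b - half-chord a b ≈
    (1# + 1#) * ((1# + ι j * ι a) * (1# + ι j * ι b) * (1# + ι a * ι b) * (u a * u b * u j))
  half-chords′ a b j = trans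
    (+-cong (+-cong (+-cong two (-‿cong (sym (*-unit b _)))) (-‿cong (sym (*-unit a _)))) (-‿cong (sym (*-unit j _))))
    (solve 6 (λ a b j x y z →
      con (+ 2) :* ((con (+ 1) :+ a :* a) :* x) :* ((con (+ 1) :+ b :* b) :* y) :* ((con (+ 1) :+ j :* j) :* z) :-
      (j :- a) :* (j :- a) :* (z :* x) :* ((con (+ 1) :+ b :* b) :* y) :-
      (j :- b) :* (j :- b) :* (z :* y) :* ((con (+ 1) :+ a :* a) :* x) :-
      (a :- b) :* (a :- b) :* (x :* y) :* ((con (+ 1) :+ j :* j) :* z) :=
      con (+ 2) :* ((con (+ 1) :+ j :* a) :* (con (+ 1) :+ j :* b) :* (con (+ 1) :+ a :* b) :* (x :* y :* z)))
      refl (ι a) (ι b) (ι j) (u a) (u b) (u j))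
    where
    two : 1# + 1# ≈ (1# + 1#) * ((1# + ι a * ι a) * u a) * ((1# + ι b * ι b) * u b) * ((1# + ι j * ι j) * u j)
    two = sym (trans (*-unit j _) (trans (*-unit b _) (*-unit a _)))

  private
    0≤uuu : ∀ a b j → 0# ≤ u a * u b * u j
    0≤uuu a b j = <⇒≤ (*-pos (*-pos (0<u a) (0<u b)) (0<u j))

    0≤2* : ∀ {x} → 0# ≤ x → 0# ≤ (1# + 1#) * x
    0≤2* 0≤x = 0≤-resp (solve 1 (λ x → x :+ x := con (+ 2) :* x) refl _) (+-nonneg 0≤x 0≤x)

    half-chords-nonneg : ∀ a b j → 0# ≤ (ι j - ι a) * (ι j - ι b) → 0# ≤ half-chord j a + half-chord j b - half-chord a b
    half-chords-nonneg a b j h = 0≤-resp (sym (half-chords a b j))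
      (0≤2* (*-nonneg (*-nonneg h (<⇒≤ (0<1+ι*ι a b))) (0≤uuu a b j)))

  -- The hypothesis excludes that `j` lies strictly between `a` and `b`. The first inequality is
  -- then `half-chords`; the second is a product of cosines of angles below a right angle.
  between-P-⊝P : ∀ a b j → 0# ≤ (ι j - ι a) * (ι j - ι b) → Between (P a) (⊝ P b) (P j)
  between-P-⊝P a b j h =
    0≤-resp (sym (trans (+-cong (+-cong (+-congˡ (trans (⟨⊝ʳ⟩ (P j) (P b)) (-‿cong (P·P j b)))) (-‿cong (P·P j a)))
        (-‿cong (trans (⟨⊝ʳ⟩ (P a) (P b)) (-‿cong (P·P a b)))))
      (solve 3 (λ x y z → con (+ 1) :+ (:- (con (+ 1) :- con (+ 2) :* y)) :- (con (+ 1) :- con (+ 2) :* x) :- (:- (con (+ 1) :- con (+ 2) :* z)) :=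
        con (+ 2) :* (x :+ y :- z)) refl (half-chord j a) (half-chord j b) (half-chord a b))))
      (0≤2* (half-chords-nonneg a b j h)) ,
    0≤-resp (sym (trans (+-cong (+-cong (+-congˡ (P·P j a)) (-‿cong (trans (⟨⊝ʳ⟩ (P j) (P b)) (-‿cong (P·P j b)))))
        (-‿cong (trans (⟨⊝ʳ⟩ (P a) (P b)) (-‿cong (P·P a b)))))
      (trans (solve 3 (λ x y z → con (+ 1) :+ (con (+ 1) :- con (+ 2) :* x) :- (:- (con (+ 1) :- con (+ 2) :* y)) :- (:- (con (+ 1) :- con (+ 2) :* z)) :=
        con (+ 2) :* (con (+ 2) :- x :- y :- z)) refl (half-chord j a) (half-chord j b) (half-chord a b))
        (*-congˡ (half-chords′ a b j)))))
      (0≤2* (0≤2* (*-nonneg (*-nonneg (*-nonneg (<⇒≤ (0<1+ι*ι j a)) (<⇒≤ (0<1+ι*ι j b))) (<⇒≤ (0<1+ι*ι a b))) (0≤uuu a b j))))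

  -- Both inequalities are `half-chords-nonneg` based at an end of the arc, where the other two
  -- indices lie on the same side.
  between-P-P : ∀ {a b j} → b ℕ.≤ j → j ℕ.≤ a → Between (P a) (P b) (P j)
  between-P-P {a} {b} {j} b≤j j≤a =
    0≤-resp (sym (trans (+-cong (+-cong (+-congˡ (P·P j b)) (-‿cong (P·P j a))) (-‿cong (P·P a b)))
      (trans (solve 3 (λ x y z → con (+ 1) :+ (con (+ 1) :- con (+ 2) :* y) :- (con (+ 1) :- con (+ 2) :* x) :- (con (+ 1) :- con (+ 2) :* z) :=
        con (+ 2) :* (x :+ z :- y)) refl (half-chord j a) (half-chord j b) (half-chord a b))
      (*-congˡ (+-congʳ (+-congʳ (half-chord-sym j a)))))))
      (0≤2* (half-chords-nonneg j b a (*-nonneg (ι-mono j≤a) (ι-mono (ℕP.≤-trans b≤j j≤a))))) ,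
    0≤-resp (sym (trans (+-cong (+-cong (+-congˡ (P·P j a)) (-‿cong (P·P j b))) (-‿cong (P·P a b)))
      (trans (solve 3 (λ x y z → con (+ 1) :+ (con (+ 1) :- con (+ 2) :* x) :- (con (+ 1) :- con (+ 2) :* y) :- (con (+ 1) :- con (+ 2) :* z) :=
        con (+ 2) :* (y :+ z :- x)) refl (half-chord j a) (half-chord j b) (half-chord a b))
      (*-congˡ (+-congʳ (+-cong (half-chord-sym j b) (half-chord-sym a b)))))))
      (0≤2* (half-chords-nonneg j a b (0≤-resp
        (solve 3 (λ a b j → (j :- b) :* (a :- b) := (b :- j) :* (b :- a)) refl (ι a) (ι b) (ι j))
        (*-nonneg (ι-mono b≤j) (ι-mono (ℕP.≤-trans b≤j j≤a))))))

  ≈-unit⇒ : ∀ {X Y} → Unit X → X ≈ₚ Y → ⟨ X , Y ⟩ ≈ 1#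
  ≈-unit⇒ unit-X (e₁ , e₂) = trans (+-cong (*-congˡ (sym e₁)) (*-congˡ (sym e₂))) unit-X

  P-injective : ∀ {j k} → j ℕ.< k → ¬ (P k ≈ₚ P j)
  P-injective {j} {k} j<k eq = 0<⇒≉0 (*-pos (*-pos (ι-mono-< j<k) (ι-mono-< j<k)) (*-pos (0<u k) (0<u j)))
    (x*y≈0⇒y≈0 (0<⇒≉0 (+-pos-nonneg 0<1 (<⇒≤ 0<1))) (trans (solve 1 (λ x → con (+ 2) :* x := con (+ 1) :- (con (+ 1) :- con (+ 2) :* x)) refl (half-chord k j))
      (≈⇒-≈0 (sym (trans (sym (P·P k j)) (≈-unit⇒ (P-unit k) eq))))))

  P≉⊝P : ∀ j k → ¬ (P j ≈ₚ ⊝ P k)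
  P≉⊝P j k eq = 0<⇒≉0 (*-pos (*-pos (0<1+ι*ι j k) (0<1+ι*ι j k)) (*-pos (0<u j) (0<u k)))
    (x*y≈0⇒y≈0 (0<⇒≉0 (+-pos-nonneg 0<1 (<⇒≤ 0<1))) (trans
      (solve 4 (λ a b x y →
        con (+ 2) :* ((con (+ 1) :+ a :* b) :* (con (+ 1) :+ a :* b) :* (x :* y)) :=
        con (+ 2) :* (((con (+ 1) :+ a :* a) :* x) :* ((con (+ 1) :+ b :* b) :* y)) :- con (+ 2) :* ((a :- b) :* (a :- b) :* (x :* y)))
        refl (ι j) (ι k) (u j) (u k))
      (trans (+-congʳ (*-congˡ (trans (*-cong (unit j) (unit k)) (*-identityˡ 1#))))
      (trans (solve 1 (λ x → con (+ 2) :* con (+ 1) :- x := con (+ 1) :- (:- (con (+ 1) :- x))) refl ((1# + 1#) * half-chord j k))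
      (≈⇒-≈0 (sym (trans (-‿cong (sym (P·P j k))) (trans (sym (⟨⊝ʳ⟩ (P j) (P k))) (≈-unit⇒ (P-unit j) eq)))))))))

  ⊝-cong : ∀ {X Y} → ⊝ X ≈ₚ ⊝ Y → X ≈ₚ Y
  ⊝-cong (e₁ , e₂) = neg e₁ , neg e₂
    where
    neg : ∀ {x y} → - x ≈ - y → x ≈ y
    neg {x} {y} e = trans (solve 1 (λ x → x := :- (:- x)) refl x) (trans (-‿cong e) (solve 1 (λ x → :- (:- x) := x) refl y))

  unit≉0 : ∀ {X} → Unit X → ¬ (0ₚ ≈ₚ X)
  unit≉0 unit-X (e₁ , e₂) = 0≉1 (trans (solve 0 (con (+ 0) := con (+ 0) :* con (+ 0) :+ con (+ 0) :* con (+ 0)) refl)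
    (trans (+-cong (*-cong e₁ e₁) (*-cong e₂ e₂)) unit-X))

  -- The angles 2 arctan k increase from 0 and stay below π, so on the circle all the `P k` come
  -- first, followed by their antipodes in the same order.
  pts : ℕ → List Point
  pts ℕ.zero    = []
  pts (ℕ.suc k) = P k ∷ ⊝ P k ∷ pts k

  all-pts : ∀ {q} {Q : Pred Point q} m → (∀ j → j ℕ.< m → Q (P j)) → (∀ j → j ℕ.< m → Q (⊝ P j)) → All Q (pts m)
  all-pts ℕ.zero    _ _ = []
  all-pts (ℕ.suc m) p n = p m ℕP.≤-refl ∷ n m ℕP.≤-refl ∷
    all-pts m (λ j j<m → p j (ℕP.m<n⇒m<1+n j<m)) (λ j j<m → n j (ℕP.m<n⇒m<1+n j<m))

  pts! : ∀ m → Unique (pts m)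
  pts! ℕ.zero    = []
  pts! (ℕ.suc m) =
    (P≉⊝P m m ∷ all-pts m (λ j j<m → P-injective j<m) (λ j _ → P≉⊝P m j)) ∷
    all-pts m (λ j _ eq → P≉⊝P j m (≈ₚ-sym eq)) (λ j j<m eq → P-injective j<m (⊝-cong eq)) ∷
    pts! m

  length-pts : ∀ m → length (pts m) ≡ m ℕ.+ m
  length-pts ℕ.zero    = ≡.refl
  length-pts (ℕ.suc m) = ≡.cong ℕ.suc (≡.trans (≡.cong ℕ.suc (length-pts m)) (≡.sym (ℕP.+-suc m m)))

  -- The origin is included so that one computation serves the polygon with and without its centre.
  Spans : ℕ → Point → Point → Set (c Level.⊔ ℓ₁ Level.⊔ ℓ₂)
  Spans m X Y = ¬ (X ≈ₚ Y) × All (InStrip X Y) (0ₚ ∷ pts m)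

  between⇒spans : ∀ {m} X Y → 0 ℕ.< m → ¬ (X ≈ₚ Y) → Unit X → Unit Y →
    (∀ j → j ℕ.< m → Between X Y (P j)) → Spans m X Y
  between⇒spans {m} X Y 0<m X≉Y unit-X unit-Y between = X≉Y ,
    between⇒inStrip X Y 0ₚ unit-X unit-Y (between⇒origin X Y (P 0) (between 0 0<m)) ∷
    all-pts m (λ j j<m → between⇒inStrip X Y (P j) unit-X unit-Y (between j j<m))
      (λ j j<m → between⇒inStrip X Y (⊝ P j) unit-X unit-Y (between-⊝ʳ X Y (P j) (between j j<m)))

  spans-diameter : ∀ {m k} → k ℕ.< m → Spans m (P k) (⊝ P k)
  spans-diameter {k = k} k<m = between⇒spans (P k) (⊝ P k) (ℕP.≤-<-trans ℕ.z≤n k<m) (P≉⊝P k k) (P-unit k) (⊝-unit (P-unit k))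
    λ j _ → between-P-⊝P k k j (square-nonneg (ι j - ι k))

  -- No natural number lies strictly between `k` and `suc k`.
  consecutive : ∀ j k → 0# ≤ (ι j - ι k) * (ι j - ι (ℕ.suc k))
  consecutive j k with ℕP.<-≤-connex k j
  ... | inj₁ k<j = *-nonneg (ι-mono (ℕP.<⇒≤ k<j)) (ι-mono k<j)
  ... | inj₂ j≤k = 0≤-resp (solve 3 (λ x y z → (y :- x) :* (z :- x) := (x :- y) :* (x :- z)) refl (ι j) (ι k) (ι (ℕ.suc k)))
    (*-nonneg (ι-mono j≤k) (ι-mono (ℕP.m≤n⇒m≤1+n j≤k)))

  spans-long₁ : ∀ {m k} → ℕ.suc k ℕ.< m → Spans m (P (ℕ.suc k)) (⊝ P k)
  spans-long₁ {k = k} k<m = between⇒spans (P (ℕ.suc k)) (⊝ P k) (ℕP.≤-<-trans ℕ.z≤n k<m) (P≉⊝P (ℕ.suc k) k)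
    (P-unit (ℕ.suc k)) (⊝-unit (P-unit k))
    λ j _ → between-P-⊝P (ℕ.suc k) k j (0≤-resp (*-comm _ _) (consecutive j k))

  spans-long₂ : ∀ {m k} → ℕ.suc k ℕ.< m → Spans m (⊝ P (ℕ.suc k)) (P k)
  spans-long₂ {k = k} k<m = between⇒spans (⊝ P (ℕ.suc k)) (P k) (ℕP.≤-<-trans ℕ.z≤n k<m)
    (λ eq → P≉⊝P k (ℕ.suc k) (≈ₚ-sym eq)) (⊝-unit (P-unit (ℕ.suc k))) (P-unit k)
    λ j _ → between-sym (P k) (⊝ P (ℕ.suc k)) (P j) (between-P-⊝P k (ℕ.suc k) j (consecutive j k))

  -- On the circle the last antipode `⊝ P k` is followed by `P 0`, so this diagonal is next to the
  -- diameter at `P k`.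
  spans-wrap₁ : ∀ {k} → 0 ℕ.< k → Spans (ℕ.suc k) (P k) (P 0)
  spans-wrap₁ {k} 0<k = between⇒spans (P k) (P 0) ℕP.0<1+n (P-injective 0<k) (P-unit k) (P-unit 0)
    λ j j<1+k → between-P-P ℕ.z≤n (ℕP.≤-pred j<1+k)

  spans-wrap₂ : ∀ {k} → 0 ℕ.< k → Spans (ℕ.suc k) (⊝ P k) (⊝ P 0)
  spans-wrap₂ {k} 0<k = between⇒spans (⊝ P k) (⊝ P 0) ℕP.0<1+n (λ eq → P-injective 0<k (⊝-cong eq))
    (⊝-unit (P-unit k)) (⊝-unit (P-unit 0))
    λ j j<1+k → between-⊝ˡ (P k) (P 0) (P j) (between-P-P ℕ.z≤n (ℕP.≤-pred j<1+k))

  module _ {q} {Q : Pred (Point × Point) q} (Q? : Decidable Q) where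
    private
      count : List Point → ℕ
      count xs = length (filter Q? (unorderedPairs xs))

      oldest : ∀ k → (P 0 ∷ ⊝ P 0 ∷ []) ⊆ pts (ℕ.suc k)
      oldest ℕ.zero    = ⊆-refl
      oldest (ℕ.suc k) = _ ∷ʳ (_ ∷ʳ oldest k)

      oldest₁ : ∀ k → (P 0 ∷ []) ⊆ pts (ℕ.suc k)
      oldest₁ k = ⊆-trans (≡.refl ∷ (_ ∷ʳ [])) (oldest k)

      oldest₂ : ∀ k → (⊝ P 0 ∷ []) ⊆ pts (ℕ.suc k)
      oldest₂ k = ⊆-trans (_ ∷ʳ ⊆-refl) (oldest k)

    module _ {m} (spans⇒Q : ∀ {X Y} → Spans m X Y → Q (X , Y)) where
      private
        -- Each further antipodal pair brings its diameter and two diagonals to the preceding pair.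
        count-pts : ∀ k → k ℕ.< m → 1 ℕ.+ 3 ℕ.* k ℕ.≤ count (pts (ℕ.suc k))
        count-pts ℕ.zero    0<m = ℕP.≤-trans (ℕP.m≤m+n 1 _) (length-filter-pairs Q? {ys = ⊝ P 0 ∷ []} (≡.refl ∷ []) (spans⇒Q (spans-diameter 0<m) ∷ []))
        count-pts (ℕ.suc k) k<m = ≡.subst (ℕ._≤ count (pts (2 ℕ.+ k))) (≡.sym (≡.cong ℕ.suc (ℕP.*-suc 3 k)))
          (ℕP.≤-trans (ℕP.+-monoʳ-≤ 2 (ℕP.≤-trans (ℕP.+-monoʳ-≤ 1 (count-pts k (ℕP.<⇒≤ k<m)))
            (length-filter-pairs Q? {ys = pts (ℕ.suc k)} (≡.refl ∷ minimum _) (spans⇒Q (spans-long₂ k<m) ∷ []))))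
            (length-filter-pairs Q? {ys = ⊝ P (ℕ.suc k) ∷ pts (ℕ.suc k)} (≡.refl ∷ (_ ∷ʳ (≡.refl ∷ minimum _)))
              (spans⇒Q (spans-diameter k<m) ∷ spans⇒Q (spans-long₁ k<m) ∷ [])))

      -- The last antipodal pair also carries the two closing diagonals, which gives 1 + 3(m - 2) +
      -- 5 = 3m.
      count-polygon : ∀ k → m ≡ 2 ℕ.+ k → 3 ℕ.* m ℕ.≤ count (pts m)
      -- For two antipodal pairs the preceding pair is also the first one, which changes the order
      -- of the sublists.
      count-polygon ℕ.zero ≡.refl =
        ℕP.≤-trans (ℕP.+-monoʳ-≤ 3 (ℕP.≤-trans (ℕP.+-monoʳ-≤ 2 (count-pts 0 (ℕ.s≤s ℕ.z≤n)))
          (length-filter-pairs Q? {zs = P 0 ∷ ⊝ P 0 ∷ []} {pts 1} ⊆-refl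
            (spans⇒Q (spans-long₂ ℕP.≤-refl) ∷ spans⇒Q (spans-wrap₂ ℕP.≤-refl) ∷ []))))
        (length-filter-pairs Q? {zs = ⊝ P 1 ∷ P 0 ∷ ⊝ P 0 ∷ []} {⊝ P 1 ∷ pts 1} ⊆-refl
          (spans⇒Q (spans-diameter ℕP.≤-refl) ∷ spans⇒Q (spans-wrap₁ ℕP.≤-refl) ∷ spans⇒Q (spans-long₁ ℕP.≤-refl) ∷ []))
      count-polygon (ℕ.suc k) ≡.refl = ≡.subst (ℕ._≤ count (pts (3 ℕ.+ k))) sum
        (ℕP.≤-trans (ℕP.+-monoʳ-≤ 3 (ℕP.≤-trans (ℕP.+-monoʳ-≤ 2 (count-pts (ℕ.suc k) (ℕP.m<n⇒m<1+n (ℕP.n<1+n _))))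
          (length-filter-pairs Q? {zs = P (ℕ.suc k) ∷ ⊝ P 0 ∷ []} {pts (2 ℕ.+ k)} (≡.refl ∷ (_ ∷ʳ oldest₂ k))
            (spans⇒Q (spans-long₂ ℕP.≤-refl) ∷ spans⇒Q (spans-wrap₂ ℕP.0<1+n) ∷ []))))
        (length-filter-pairs Q? {zs = ⊝ P (2 ℕ.+ k) ∷ ⊝ P (ℕ.suc k) ∷ P 0 ∷ []} {⊝ P (2 ℕ.+ k) ∷ pts (2 ℕ.+ k)} (≡.refl ∷ (_ ∷ʳ (≡.refl ∷ oldest₁ k)))
          (spans⇒Q (spans-diameter ℕP.≤-refl) ∷ spans⇒Q (spans-long₁ ℕP.≤-refl) ∷ spans⇒Q (spans-wrap₁ ℕP.0<1+n) ∷ [])))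
        where
        sum : 6 ℕ.+ 3 ℕ.* ℕ.suc k ≡ 3 ℕ.* (3 ℕ.+ k)
        sum = ≡.sym (≡.trans (ℕP.*-distribˡ-+ 3 2 (ℕ.suc k)) ≡.refl)

  triangle : FiniteSet
  triangle = record
    { points   = P 1 ∷ P 0 ∷ ⊝ P 0 ∷ []
    ; distinct = (P-injective ℕP.≤-refl ∷ P≉⊝P 1 0 ∷ []) ∷ (P≉⊝P 0 0 ∷ []) ∷ [] ∷ []
    }

  N-triangle : N triangle ≡ 3
  N-triangle = ≡.cong length (List.filter-all (doubleNormal? triangle)
    (restrict (spans-wrap₁ ℕP.≤-refl) ∷ restrict (spans-long₁ ℕP.≤-refl) ∷ restrict (spans-diameter (ℕ.s≤s ℕ.z≤n)) ∷ []))
    where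
    restrict : ∀ {X Y} → Spans 2 X Y → DoubleNormal triangle (X , Y)
    -- The origin and `⊝ P 1` are dropped.
    restrict (X≉Y , _ ∷ p₁ ∷ _ ∷ p₀ ∷ n₀ ∷ []) = X≉Y , p₁ ∷ p₀ ∷ n₀ ∷ []

  polygon : ℕ → FiniteSet
  polygon m = record { points = pts m ; distinct = pts! m }

  centred-polygon : ℕ → FiniteSet
  centred-polygon m = record
    { points   = 0ₚ ∷ pts m
    ; distinct = all-pts m (λ j _ → unit≉0 (P-unit j)) (λ j _ → unit≉0 (⊝-unit (P-unit j))) ∷ pts! m
    }

  attained : ∀ n → 3 ℕ.≤ n → ∃[ V ] (∣ V ∣ ≡ n × N V ≡ 3 ℕ.* ⌊ n /2⌋)
  attained n 3≤n with parity n
  ... | ℕ.suc ℕ.zero , inj₂ ≡.refl = triangle , ≡.refl , N-triangle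
  ... | 0 , inj₁ ≡.refl = contradiction 3≤n λ ()
  ... | 0 , inj₂ ≡.refl = contradiction 3≤n λ { (ℕ.s≤s ()) }
  ... | 1 , inj₁ ≡.refl = contradiction 3≤n λ { (ℕ.s≤s (ℕ.s≤s ())) }
  ... | m@(ℕ.suc (ℕ.suc k)) , inj₁ ≡.refl = V , length-pts m ,
    ℕP.≤-antisym (≡.subst (λ l → N V ℕ.≤ 3 ℕ.* ⌊ l /2⌋) (length-pts m) (Extremal.N≤3*⌊n/2⌋ ℝ V))
      (≡.subst (λ l → 3 ℕ.* l ℕ.≤ N V) (ℕP.n≡⌊n+n/2⌋ m)
        (count-polygon (doubleNormal? V) (λ (X≉Y , strips) → X≉Y , All.tail strips) k ≡.refl))
    where
    V : FiniteSet
    V = polygon m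
  ... | m@(ℕ.suc (ℕ.suc k)) , inj₂ ≡.refl = V , ≡.cong ℕ.suc (length-pts m) ,
    ℕP.≤-antisym (≡.subst (λ l → N V ℕ.≤ 3 ℕ.* ⌊ ℕ.suc l /2⌋) (length-pts m) (Extremal.N≤3*⌊n/2⌋ ℝ V))
      (≡.subst (λ l → 3 ℕ.* l ℕ.≤ N V) (ℕP.n≡⌈n+n/2⌉ m) (ℕP.≤-trans
        (count-polygon (doubleNormal? V) (λ s → s) k ≡.refl)
        -- No pair with the centre is counted; the centre only raises the cardinality by one.
        (length-filter-pairs (doubleNormal? V) {0ₚ} {[]} {pts m} (minimum _) [])))
    where
    V : FiniteSet
    V = centred-polygon m

open import Data.Nat using (_≤_; _*_; _/_)

theorem1 : ∀ {c ℓ₁ ℓ₂} (ℝ : CompleteOrderedField c ℓ₁ ℓ₂) →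
    let open Plane ℝ in
    (∀ (V : FiniteSet) → 3 ≤ ∣ V ∣ → N V ≤ 3 * ⌊ ∣ V ∣ /2⌋) ×
    (∀ (n : ℕ) → 3 ≤ n → ∃[ V ] (∣ V ∣ ≡ n × N V ≡ 3 * ⌊ n /2⌋)) ×
    (∀ (V : FiniteSet) → 3 ≤ ∣ V ∣ → 2 ∣ ∣ V ∣ → N V ≡ (3 * ∣ V ∣) / 2 →
    ∃[ o ] ∃[ r ] (LiesOnCircle V o r × SymmetricAbout V o))
theorem1 ℝ =
  (λ V _ → Extremal.N≤3*⌊n/2⌋ ℝ V) ,
  Construction.attained ℝ ,
  Extremal.extremal⇒circle ℝ
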